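{- Let $q=p^n$ be a power of an odd prime $p$ with $q\equiv 3 \pmod 4$ and $q\ge 27535^2$. Let $\mathcal{U}=\{0,\pm1\}$ if $p=3$ and $\mathcal{U}=\{0,\pm 1,\pm\frac{1}{3}\}$ if $p\neq 3$. Then for every $u\in\mathbb{F}_q\setminus\mathcal{U}$ with $\eta(1+u)=\eta(u-1)$, the differential uniformity of $F_{2,u}(x)=x^2\big(1+u\eta(x)\big)$ over $\mathbb{F}_q$ equals $5$.
   Context: $\eta$ denotes the quadratic character of $\mathbb{F}_q$: $\eta(0)=0$, $\eta(x)=1$ if $x$ is a nonzero square, $\eta(x)=-1$ if $x$ is a non-square. For a function $f:\mathbb{F}_q\to\mathbb{F}_q$ and $a,b\in\mathbb{F}_q$, $\delta_f(a,b)=\#\{x\in\mathbb{F}_q: f(x+a)-f(x)=b\}$, and the differential uniformity of $f$ is $\delta_f=\max_{a\in\mathbb{F}_q^*,\,b\in\mathbb{F}_q}\delta_f(a,b)$. -}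

module Defs where

open import Level using (0ℓ)
open import Data.Nat as ℕ using (ℕ)
open import Data.Fin as Fin using (Fin)
open import Data.Integer as ℤ using (ℤ; +_; -[1+_])
open import Data.List using (List; map; filter; length; foldr; concatMap; allFin)
import Data.List
import Data.Sum
import Relation.Binary.PropositionalEquality
open import Data.List.Relation.Unary.Any using (Any; any?)
open import Data.Product using (∃)
open import Function.Bundles using (_↔_; Inverse)
open import Algebra.Structures using (IsCommutativeRing)
open import Relation.Binary.PropositionalEquality using (_≡_; _≢_; cong; sym; trans)
open import Relation.Nullary using (Dec; yes; no; ¬_)
open import Relation.Nullary.Decidable using (map′)

record FiniteField (q : ℕ) : Set₁ where
  infixl 6 _+_ _-_
  infixl 7 _*_
  field
    F    : Set
    _+_  : F → F → F
    _*_  : F → F → F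
    -_   : F → F
    0#   : F
    1#   : F
    isCommutativeRing : IsCommutativeRing _≡_ _+_ _*_ -_ 0# 1#
    0≢1  : 0# ≢ 1#
    inverse : ∀ x → x ≢ 0# → ∃ λ y → x * y ≡ 1#
    enum : F ↔ Fin q

  _-_ : F → F → F
  x - y = x + (- y)

  open Inverse enum using (to; from; inverseˡ; inverseʳ)

  _≟_ : (x y : F) → Dec (x ≡ y)
  x ≟ y = map′ (λ e → trans (sym (inverseʳ refl')) (trans (cong from e) (inverseʳ refl')))
               (cong to) (to x Fin.≟ to y)
    where
      refl' : ∀ {a : Fin q} → a ≡ a
      refl' = Relation.Binary.PropositionalEquality.refl

  elements : List F
  elements = map from (Data.List.allFin q)

  nonzeroElements : List F
  nonzeroElements = filter (λ x → Relation.Nullary.¬? (x ≟ 0#)) elements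

  3# : F
  3# = 1# + 1# + 1#

  IsSquare : F → Set
  IsSquare x = Any (λ y → y * y ≡ x) elements

  isSquare? : (x : F) → Dec (IsSquare x)
  isSquare? x = any? (λ y → (y * y) ≟ x) elements

  η : F → ℤ
  η x with x ≟ 0#
  ... | yes _ = + 0
  ... | no _ with isSquare? x
  ...   | yes _ = + 1
  ...   | no _  = -[1+ 0 ]

  ιℕ : ℕ → F
  ιℕ ℕ.zero    = 0#
  ιℕ (ℕ.suc n) = 1# + ιℕ n

  ι : ℤ → F
  ι (+ n)    = ιℕ n
  ι -[1+ n ] = - ιℕ (ℕ.suc n)

  δ : (F → F) → F → F → ℕ
  δ f a b = length (filter (λ x → (f (x + a) - f x) ≟ b) elements)

  diffUniformity : (F → F) → ℕ
  diffUniformity f =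
    foldr ℕ._⊔_ 0 (Data.List.concatMap (λ a → map (δ f a) elements) nonzeroElements)

  F₂ : F → F → F
  F₂ u x = x * x * (1# + u * ι (η x))

  -- the exceptional set 𝒰 (depends on whether the characteristic p is 3)
  -- 1/3 is written via 3·u = ±1 (3 is invertible when p ≠ 3)
  InU : ℕ → F → Set
  InU p u with p ℕ.≟ 3
  ... | yes _ = (u ≡ 0#) Data.Sum.⊎ ((u ≡ 1#) Data.Sum.⊎ (u ≡ - 1#))
  ... | no _  = (u ≡ 0#) Data.Sum.⊎ ((u ≡ 1#) Data.Sum.⊎ ((u ≡ - 1#) Data.Sum.⊎
                ((3# * u ≡ 1#) Data.Sum.⊎ (3# * u ≡ - 1#))))

{-# OPTIONS --safe #-}
-- For a = 1 the solutions x of F(x + 1) − F(x) = b split by the pair (η(x + 1), η(x)): the pairs (1, 1) and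
-- (−1, −1) give linear equations, (1, −1) and (−1, 1) quadratic ones, hence at most six solutions; six are
-- impossible because the two quadratics having both roots fixes the characters of b ± (1 + u) to values that
-- exclude the pair (1, 1), as η(−1) = −1.
--
-- Five solutions amount to a point (r, r′) of the conic r² + r′² = 2(1 − u²) at which the eight numbers
-- r ± (1 + u), r ± (1 − u), r′ ± (1 + u), r′ ± (1 − u) have prescribed quadratic characters, where
-- b = (r² − 1 + u²)/(2u).  Parametrising the conic by rotations turns these numbers into pairwise coprime
-- separable quadratics in t, up to the factor 1 + t².  Expanding the indicator of a sign pattern into
-- character sums, it suffices to bound Σ η(f(t)) for the 2⁸ − 1 nontrivial products f, of degree at most 32.
--
-- This is done by Stepanov's method.  With h = (q − 1)/2, one looks for P = Σ_j (r_j + s_j f^h) X^(qj) vanishing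
-- to order ℓ at every t with f(t)^h = ±1; in the expansion at t + f(t) S the coefficients of S^k, k < ℓ, are
-- polynomials in t of small degree, so there are more unknowns than linear conditions.  P is nonzero because
-- r + s f^h ≡ 0 mod X^q forces r² f = s² f(0), which an infinite descent along a quadratic factor excludes.
module Submission where

open import Defs
open import Algebra.Bundles using (CommutativeRing)
import Algebra.Properties.AbelianGroup
import Algebra.Properties.CommutativeMonoid.Sum
import Algebra.Properties.CommutativeSemiring.Binomial
import Algebra.Properties.CommutativeSemiring.Exp
import Algebra.Properties.Ring
import Algebra.Properties.Semiring.Binomial
import Algebra.Properties.Semiring.Exp
import Algebra.Properties.Semiring.Mult
import Algebra.Properties.Semiring.Mult.TCOptimised
import Algebra.Properties.Semiring.Sum
import Algebra.Solver.Ring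
import Algebra.Solver.Ring.AlmostCommutativeRing as ACR
open import Data.Empty using (⊥-elim)
open import Data.Fin as Fin using (Fin; toℕ; fromℕ; inject₁; punchIn)
open import Data.Fin.Permutation using (permutation)
import Data.Fin.Properties as Finₚ
open import Data.Integer as ℤ using (ℤ; 0ℤ; 1ℤ; -1ℤ; ∣_∣)
import Data.Integer.Properties as ℤₚ
import Data.Integer.Solver
open import Data.List using (length; allFin; List; []; _∷_; _++_; filter; map; foldr; concatMap)
open import Data.List.Membership.Propositional using (_∈_; find; lose)
open import Data.List.Membership.Propositional.Properties using (∈-map⁺; ∈-allFin; ∈-∃++; ∈-filter⁺; ∈-++⁺ˡ; ∈-++⁺ʳ; ∈-++⁻; ∈-concatMap⁺)
open import Data.List.Properties using (length-map; length-tabulate; length-++; filter-all)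
open import Data.List.Relation.Unary.All as All using (All; []; _∷_)
import Data.List.Relation.Unary.All.Properties as Allₚ
open import Data.List.Relation.Unary.AllPairs using ([]; _∷_; AllPairs)
import Data.List.Relation.Unary.AllPairs.Properties as AllPairsₚ
open import Data.List.Relation.Unary.Any as Any using (Any; here; there)
open import Data.List.Relation.Unary.Unique.Propositional using (Unique)
import Data.List.Relation.Unary.Unique.Propositional.Properties as Uniqueₚ
open import Data.Maybe using (Maybe; just; nothing)
open import Data.Nat as ℕ using (ℕ; zero; suc; _∸_; _!; _≤_; _<_; z≤n; s≤s)
open import Data.Nat.Combinatorics as Comb using (nCk≡n!/k![n-k]!; k![n∸k]!∣n!; nCn≡1)
open import Data.Nat.DivMod using (m/n*n≡m; m≡m%n+[m/n]*n; /-monoˡ-≤)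
open import Data.Nat.Divisibility as Div using (divides; ∣⇒≤; m∣m*n; ∣-reflexive; ∣-trans)
open import Data.Nat.Primality using (Prime; euclidsLemma; prime⇒nonTrivial; ¬prime[0])
import Data.Nat.Properties as ℕₚ
import Data.Nat.Solver
open import Data.Product using (∃; _×_; _,_; proj₁; proj₂)
open import Data.Sum using (inj₁; inj₂; _⊎_)
open import Data.Unit using (⊤; tt)
open import Data.Vec as Vec using (Vec; []; _∷_)
import Data.Vec.Properties as Vecₚ
open import Function using (_∘_; id)
open import Function.Bundles using (Inverse)
open import Level using (0ℓ)
open import Relation.Binary.PropositionalEquality using (_≡_; cong; _≢_; refl; sym; trans; cong₂; subst; module ≡-Reasoning)
import Relation.Binary.Reasoning.Setoid
open import Relation.Nullary using (yes; no; ¬_; Dec; contradiction; ¬?)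
open import Relation.Nullary.Decidable using (_×-dec_; _⊎-dec_; decidable-stable)
open import Relation.Unary using (Decidable)

-- The characteristic may be 3 while P has to vanish to order 20000, so multiplicities cannot be
-- read off ordinary derivatives; they are read off expansions in a formal variable, and polynomials
-- are therefore treated inside a ring of power series. The step f(t) S, instead of S, makes f(t)
-- factor out of f(t + f(t) S): f^h becomes ±1 times the h-th power of a series with constant term
-- 1, and the huge exponent h leaves no trace in the degrees. Likewise X^q becomes t, by Frobenius
-- and Fermat.
--
-- It suffices to bound each of the 255 sums by slightly less than q/256. Hence ℓ is a fixed number,
-- and the error is a small fixed fraction of q; the size of q only has to provide enough unknowns
-- for this ℓ.
--
-- Each condition carries a factor 1 + t², so the products f are not squarefree. The descent runs
-- along one separable quadratic that is coprime to its cofactor in f, and coprimality is always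
-- witnessed by an explicit Bézout identity.

-- A ring solver with integer coefficients over any commutative ring.

module IntegerSolver (R : CommutativeRing 0ℓ 0ℓ) where
  open CommutativeRing R renaming (refl to ≈-refl; sym to ≈-sym; trans to ≈-trans)
  open Algebra.Properties.Ring ring
  open Algebra.Properties.AbelianGroup +-abelianGroup using (⁻¹-∙-comm)
  open Algebra.Properties.Semiring.Mult.TCOptimised semiring renaming (_×_ to _×ₙ_)
  open Relation.Binary.Reasoning.Setoid setoid

  private
    ⟦_⟧ᶻ : ℤ → Carrier
    ⟦ ℤ.+ n ⟧ᶻ      = n ×ₙ 1#
    ⟦ ℤ.-[1+ n ] ⟧ᶻ = - (suc n ×ₙ 1#)

    cancel-1 : ∀ a b → (1# + a) - (1# + b) ≈ a - b
    cancel-1 a b = begin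
      (1# + a) + - (1# + b)      ≈⟨ +-congˡ (⁻¹-∙-comm 1# b) ⟨
      (1# + a) + (- 1# + - b)    ≈⟨ +-congʳ (+-comm 1# a) ⟩
      (a + 1#) + (- 1# + - b)    ≈⟨ +-assoc a 1# _ ⟩
      a + (1# + (- 1# + - b))    ≈⟨ +-congˡ (+-assoc 1# (- 1#) (- b)) ⟨
      a + ((1# + - 1#) + - b)    ≈⟨ +-congˡ (+-congʳ (-‿inverseʳ 1#)) ⟩
      a + (0# + - b)             ≈⟨ +-congˡ (+-identityˡ _) ⟩
      a - b                      ∎

    ⊖-homo : ∀ m n → ⟦ m ℤ.⊖ n ⟧ᶻ ≈ m ×ₙ 1# - n ×ₙ 1#
    ⊖-homo m       zero    = begin
      ⟦ m ℤ.⊖ 0 ⟧ᶻ   ≈⟨ reflexive (cong ⟦_⟧ᶻ (ℤₚ.⊖-≥ {m} {0} ℕ.z≤n)) ⟩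
      m ×ₙ 1#       ≈⟨ +-identityʳ _ ⟨
      m ×ₙ 1# + 0#  ≈⟨ +-congˡ -0#≈0# ⟨
      m ×ₙ 1# - 0#  ∎
    ⊖-homo zero    (suc n) = ≈-sym (+-identityˡ _)
    ⊖-homo (suc m) (suc n) = begin
      ⟦ suc m ℤ.⊖ suc n ⟧ᶻ               ≈⟨ reflexive (cong ⟦_⟧ᶻ (ℤₚ.[1+m]⊖[1+n]≡m⊖n m n)) ⟩
      ⟦ m ℤ.⊖ n ⟧ᶻ                       ≈⟨ ⊖-homo m n ⟩
      m ×ₙ 1# - n ×ₙ 1#                  ≈⟨ cancel-1 _ _ ⟨
      (1# + m ×ₙ 1#) - (1# + n ×ₙ 1#)    ≈⟨ +-cong (1+× m 1#) (-‿cong (1+× n 1#)) ⟨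
      suc m ×ₙ 1# - suc n ×ₙ 1#          ∎

    -homo : ∀ i → ⟦ ℤ.- i ⟧ᶻ ≈ - ⟦ i ⟧ᶻ
    -homo (ℤ.+ zero)  = ≈-sym -0#≈0#
    -homo (ℤ.+ suc n) = ≈-refl
    -homo ℤ.-[1+ n ]  = ≈-sym (-‿involutive _)

    +-homo : ∀ i j → ⟦ i ℤ.+ j ⟧ᶻ ≈ ⟦ i ⟧ᶻ + ⟦ j ⟧ᶻ
    +-homo (ℤ.+ m)    (ℤ.+ n)    = ×-homo-+ 1# m n
    +-homo (ℤ.+ m)    ℤ.-[1+ n ] = ⊖-homo m (suc n)
    +-homo ℤ.-[1+ m ] (ℤ.+ n)    = ≈-trans (⊖-homo n (suc m)) (+-comm _ _)
    +-homo ℤ.-[1+ m ] ℤ.-[1+ n ] = begin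
      - (suc (suc (m ℕ.+ n)) ×ₙ 1#)       ≈⟨ reflexive (cong (λ z → - (suc z ×ₙ 1#)) (sym (ℕₚ.+-suc m n))) ⟩
      - ((suc m ℕ.+ suc n) ×ₙ 1#)         ≈⟨ -‿cong (×-homo-+ 1# (suc m) (suc n)) ⟩
      - (suc m ×ₙ 1# + suc n ×ₙ 1#)        ≈⟨ ⁻¹-∙-comm _ _ ⟨
      - (suc m ×ₙ 1#) + - (suc n ×ₙ 1#)    ∎

    *-homo : ∀ i j → ⟦ i ℤ.* j ⟧ᶻ ≈ ⟦ i ⟧ᶻ * ⟦ j ⟧ᶻ
    *-homo⁺ : ∀ m j → ⟦ ℤ.+ m ℤ.* j ⟧ᶻ ≈ ⟦ ℤ.+ m ⟧ᶻ * ⟦ j ⟧ᶻ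
    *-homo⁺ m (ℤ.+ n)    = ≈-trans (reflexive (cong ⟦_⟧ᶻ (sym (ℤₚ.pos-* m n)))) (×1-homo-* m n)
    *-homo⁺ m ℤ.-[1+ n ] = begin
      ⟦ ℤ.+ m ℤ.* ℤ.-[1+ n ] ⟧ᶻ       ≈⟨ reflexive (cong ⟦_⟧ᶻ (sym (ℤₚ.neg-distribʳ-* (ℤ.+ m) (ℤ.+ suc n)))) ⟩
      ⟦ ℤ.- (ℤ.+ m ℤ.* ℤ.+ suc n) ⟧ᶻ  ≈⟨ -homo (ℤ.+ m ℤ.* ℤ.+ suc n) ⟩
      - ⟦ ℤ.+ m ℤ.* ℤ.+ suc n ⟧ᶻ      ≈⟨ -‿cong (*-homo⁺ m (ℤ.+ suc n)) ⟩
      - (m ×ₙ 1# * (suc n ×ₙ 1#))   ≈⟨ -‿distribʳ-* _ _ ⟩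
      m ×ₙ 1# * - (suc n ×ₙ 1#)     ∎
    *-homo (ℤ.+ m)    j = *-homo⁺ m j
    *-homo ℤ.-[1+ m ] j = begin
      ⟦ ℤ.-[1+ m ] ℤ.* j ⟧ᶻ          ≈⟨ reflexive (cong ⟦_⟧ᶻ (sym (ℤₚ.neg-distribˡ-* (ℤ.+ suc m) j))) ⟩
      ⟦ ℤ.- (ℤ.+ suc m ℤ.* j) ⟧ᶻ     ≈⟨ -homo (ℤ.+ suc m ℤ.* j) ⟩
      - ⟦ ℤ.+ suc m ℤ.* j ⟧ᶻ         ≈⟨ -‿cong (*-homo⁺ (suc m) j) ⟩
      - (suc m ×ₙ 1# * ⟦ j ⟧ᶻ)      ≈⟨ -‿distribˡ-* _ _ ⟩
      - (suc m ×ₙ 1#) * ⟦ j ⟧ᶻ      ∎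

    morphism : ℤ.+-*-rawRing ACR.-Raw-AlmostCommutative⟶ ACR.fromCommutativeRing R
    morphism = record
      { ⟦_⟧ = ⟦_⟧ᶻ ; +-homo = +-homo ; *-homo = *-homo ; -‿homo = -homo
      ; 0-homo = ≈-refl ; 1-homo = ≈-refl }

    -- Coefficients are compared as integers because equality in the target ring may be undecidable,
    -- as it is for power series. Distinct integers may still coincide modulo the characteristic, so
    -- they yield no verdict.
    dec : ∀ i j → Maybe (⟦ i ⟧ᶻ ≈ ⟦ j ⟧ᶻ)
    dec i j with i ℤ.≟ j
    ... | yes i≡j = just (reflexive (cong ⟦_⟧ᶻ i≡j))
    ... | no  _   = nothing

  open Algebra.Solver.Ring ℤ.+-*-rawRing (ACR.fromCommutativeRing R) morphism dec public
    using (Polynomial; con; _:+_; _:*_; _:-_; :-_; _:=_; solve)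

-- Binomial coefficients modulo p and the Frobenius map.

prime∤k! : ∀ {p} → Prime p → ∀ k → k < p → ¬ (p Div.∣ k !)
prime∤k! {p} pr zero    k<p p∣1 = ℕₚ.<⇒≱ (ℕ.nonTrivial⇒n>1 p {{prime⇒nonTrivial pr}}) (∣⇒≤ p∣1)
prime∤k! {p} pr (suc k) k<p p∣k! with euclidsLemma (suc k) (k !) pr p∣k!
... | inj₁ p∣1+k = ℕₚ.<⇒≱ k<p (∣⇒≤ p∣1+k)
... | inj₂ p∣k!  = prime∤k! pr k (ℕₚ.<-trans (ℕₚ.n<1+n k) k<p) p∣k!

prime∣p! : ∀ {p} → Prime p → p Div.∣ p !
prime∣p! {zero}  pr = ⊥-elim (¬prime[0] pr)
prime∣p! {suc n} pr = m∣m*n (n !)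

-- p divides p! = C(p, k) · k! · (p - k)!, and it divides neither factorial.
prime∣C : ∀ {p} → Prime p → ∀ k → 0 < k → k < p → p Div.∣ p Comb.C k
prime∣C {p} pr k 0<k k<p with euclidsLemma (p Comb.C k) (k ! ℕ.* (p ∸ k) !) pr p∣product
  where
  instance _ = ℕₚ.m*n≢0 (k !) ((p ∸ k) !) {{ℕₚ._!≢0 k}} {{ℕₚ._!≢0 (p ∸ k)}}
  p∣product : p Div.∣ (p Comb.C k) ℕ.* (k ! ℕ.* (p ∸ k) !)
  p∣product = ∣-trans (prime∣p! pr) (∣-reflexive (sym (trans
    (cong (ℕ._* (k ! ℕ.* (p ∸ k) !)) (nCk≡n!/k![n-k]! (ℕₚ.<⇒≤ k<p)))
    (m/n*n≡m (k![n∸k]!∣n! (ℕₚ.<⇒≤ k<p))))))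
... | inj₁ p∣C = p∣C
... | inj₂ p∣k![p-k]! with euclidsLemma (k !) ((p ∸ k) !) pr p∣k![p-k]!
...   | inj₁ p∣k!     = ⊥-elim (prime∤k! pr k k<p p∣k!)
...   | inj₂ p∣[p-k]! = ⊥-elim (prime∤k! pr (p ∸ k) (ℕₚ.∸-monoʳ-< 0<k (ℕₚ.<⇒≤ k<p)) p∣[p-k]!)

module Frobenius (R : CommutativeRing 0ℓ 0ℓ) where
  open CommutativeRing R renaming (refl to ≈-refl; sym to ≈-sym; trans to ≈-trans)
  open Algebra.Properties.Semiring.Exp semiring
  open Algebra.Properties.Semiring.Mult semiring renaming (_×_ to _×ₙ_)
  open Algebra.Properties.Semiring.Sum semiring
  open Algebra.Properties.CommutativeSemiring.Binomial commutativeSemiring using () renaming (theorem to binomialTheorem)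
  open Relation.Binary.Reasoning.Setoid setoid

  module _ {p} (pr : Prime p) (p×1≈0 : p ×ₙ 1# ≈ 0#) where

    ∣⇒×≈0 : ∀ {n} → p Div.∣ n → ∀ x → n ×ₙ x ≈ 0#
    ∣⇒×≈0 {n} (divides k n≡k*p) x = begin
      n ×ₙ x                    ≈⟨ ×-congʳ n (*-identityˡ x) ⟨
      n ×ₙ (1# * x)             ≈⟨ ×-assoc-* n 1# x ⟨
      (n ×ₙ 1#) * x             ≈⟨ *-congʳ (reflexive (cong (_×ₙ 1#) n≡k*p)) ⟩
      ((k ℕ.* p) ×ₙ 1#) * x     ≈⟨ *-congʳ (×1-homo-* k p) ⟩
      (k ×ₙ 1#) * (p ×ₙ 1#) * x  ≈⟨ *-congʳ (*-congˡ p×1≈0) ⟩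
      (k ×ₙ 1#) * 0# * x        ≈⟨ *-congʳ (zeroʳ _) ⟩
      0# * x                   ≈⟨ zeroˡ x ⟩
      0#                       ∎

    frobenius : ∀ x y → (x + y) ^ p ≈ x ^ p + y ^ p
    -- The exponent is generalised to `n`, so that the binomial sum can be split into its two ends
    -- and its middle while `pr` still speaks of `p`.
    frobenius x y = go p refl
      where
      open Algebra.Properties.Semiring.Binomial semiring x y using (binomialTerm)
      go : ∀ n → p ≡ n → (x + y) ^ n ≈ x ^ n + y ^ n
      go zero    p≡0 = ⊥-elim (¬prime[0] (subst Prime p≡0 pr))
      go (suc n) p≡n = begin
        (x + y) ^ suc n                                       ≈⟨ binomialTheorem (suc n) x y ⟩
        term Fin.zero + sum (term ∘ Fin.suc)                  ≈⟨ +-cong term₀ (sum-init-last (term ∘ Fin.suc)) ⟩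
        y ^ suc n + (sum (term ∘ Fin.suc ∘ inject₁) + term (Fin.suc (fromℕ n)))
          ≈⟨ +-congˡ (+-cong (≈-trans (sum-cong-≋ middle) (sum-replicate-zero n)) termₙ) ⟩
        y ^ suc n + (0# + x ^ suc n)                          ≈⟨ +-congˡ (+-identityˡ _) ⟩
        y ^ suc n + x ^ suc n                                 ≈⟨ +-comm _ _ ⟩
        x ^ suc n + y ^ suc n                                 ∎
        where
        term : Fin (suc (suc n)) → Carrier
        term = binomialTerm (suc n)
        term₀ : term Fin.zero ≈ y ^ suc n
        term₀ = ≈-trans (+-identityʳ _) (*-identityˡ _)
        middle : ∀ (i : Fin n) → term (Fin.suc (inject₁ i)) ≈ 0#
        middle i = ∣⇒×≈0 (subst (λ m → m Div.∣ suc n Comb.C suc (toℕ (inject₁ i))) (sym p≡n)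
          (prime∣C (subst Prime p≡n pr) _ (s≤s z≤n)
            (s≤s (subst (_< n) (sym (Finₚ.toℕ-inject₁ i)) (Finₚ.toℕ<n i))))) _
        termₙ : term (Fin.suc (fromℕ n)) ≈ x ^ suc n
        termₙ rewrite Finₚ.toℕ-fromℕ n | nCn≡1 (suc n) | ℕₚ.n∸n≡0 n = ≈-trans (+-identityʳ _) (*-identityʳ _)

    frobenius-iterated : ∀ n x y → (x + y) ^ (p ℕ.^ n) ≈ x ^ (p ℕ.^ n) + y ^ (p ℕ.^ n)
    frobenius-iterated zero x y = begin
      (x + y) * 1#     ≈⟨ distribʳ _ _ _ ⟩
      x * 1# + y * 1#  ∎
    frobenius-iterated (suc n) x y = begin
      (x + y) ^ (p ℕ.* m)         ≈⟨ ^-assocʳ (x + y) p m ⟨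
      ((x + y) ^ p) ^ m           ≈⟨ ^-congˡ m (frobenius x y) ⟩
      (x ^ p + y ^ p) ^ m         ≈⟨ frobenius-iterated n (x ^ p) (y ^ p) ⟩
      (x ^ p) ^ m + (y ^ p) ^ m   ≈⟨ +-cong (^-assocʳ x p m) (^-assocʳ y p m) ⟩
      x ^ (p ℕ.* m) + y ^ (p ℕ.* m) ∎
      where
      m : ℕ
      m = p ℕ.^ n

-- Finite fields: cancellation, Fermat's theorem, characteristic.

module FieldFacts {q : ℕ} (K : FiniteField q) where
  open FiniteField K public

  ring : CommutativeRing 0ℓ 0ℓ
  ring = record { isCommutativeRing = isCommutativeRing }

  private module R = CommutativeRing ring
  open R public using
    ( +-assoc; +-comm; +-identityˡ; +-identityʳ; -‿inverseˡ; -‿inverseʳ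
    ; *-assoc; *-comm; *-identityˡ; *-identityʳ; distribʳ; zeroˡ; zeroʳ )
  open Algebra.Properties.Ring R.ring public using (-0#≈0#; -‿involutive; -1*x≈-x)
  open Algebra.Properties.Semiring.Exp R.semiring public using (_^_; ^-homo-*)
  open Algebra.Properties.CommutativeSemiring.Exp R.commutativeSemiring public using (^-distrib-*)
  open Algebra.Properties.Semiring.Mult R.semiring using (×1-homo-*) renaming (_×_ to _×ₙ_)
  module Solver = IntegerSolver ring

  *-cancelˡ-0 : ∀ {x y} → x ≢ 0# → x * y ≡ 0# → y ≡ 0#
  *-cancelˡ-0 {x} {y} x≢0 xy≡0 = begin
    y              ≡⟨ *-identityˡ y ⟨
    1# * y         ≡⟨ cong (_* y) (trans (sym (proj₂ (inverse x x≢0))) (*-comm x x⁻¹)) ⟩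
    x⁻¹ * x * y    ≡⟨ *-assoc x⁻¹ x y ⟩
    x⁻¹ * (x * y)  ≡⟨ cong (x⁻¹ *_) xy≡0 ⟩
    x⁻¹ * 0#       ≡⟨ zeroʳ x⁻¹ ⟩
    0#             ∎
    where
    open ≡-Reasoning
    x⁻¹ : F
    x⁻¹ = proj₁ (inverse x x≢0)

  *-nonzero : ∀ {x y} → x ≢ 0# → y ≢ 0# → x * y ≢ 0#
  *-nonzero x≢0 y≢0 xy≡0 = y≢0 (*-cancelˡ-0 x≢0 xy≡0)

  x-y≡0⇒x≡y : ∀ {x y} → x - y ≡ 0# → x ≡ y
  x-y≡0⇒x≡y {x} {y} e = begin
    x              ≡⟨ solve 2 (λ x y → x := (x :- y) :+ y) refl x y ⟩
    (x - y) + y    ≡⟨ cong (_+ y) e ⟩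
    0# + y         ≡⟨ +-identityˡ y ⟩
    y              ∎
    where
    open ≡-Reasoning
    open Solver

  x≡y⇒x-y≡0 : ∀ {x y} → x ≡ y → x - y ≡ 0#
  x≡y⇒x-y≡0 {x} refl = -‿inverseʳ x

  *-cancelˡ : ∀ {x y z} → x ≢ 0# → x * y ≡ x * z → y ≡ z
  *-cancelˡ {x} {y} {z} x≢0 e = x-y≡0⇒x≡y (*-cancelˡ-0 x≢0 (begin
    x * (y - z)    ≡⟨ solve 3 (λ x y z → x :* (y :- z) := x :* y :- x :* z) refl x y z ⟩
    x * y - x * z  ≡⟨ x≡y⇒x-y≡0 e ⟩
    0#             ∎))
    where
    open ≡-Reasoning
    open Solver

  -‿nonzero : ∀ {x} → x ≢ 0# → - x ≢ 0#
  -‿nonzero {x} x≢0 e = x≢0 (trans (sym (-‿involutive x)) (trans (cong -_ e) -0#≈0#))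

  ^-nonzero : ∀ {x} n → x ≢ 0# → x ^ n ≢ 0#
  ^-nonzero zero    x≢0 = 0≢1 ∘ sym
  ^-nonzero (suc n) x≢0 = *-nonzero x≢0 (^-nonzero n x≢0)

  0^suc : ∀ n → 0# ^ suc n ≡ 0#
  0^suc n = zeroˡ _

  open Inverse enum using (to; from; strictlyInverseˡ; strictlyInverseʳ)

  ∈-elements : ∀ x → x ∈ elements
  ∈-elements x = subst (_∈ elements) (strictlyInverseʳ x) (∈-map⁺ from (∈-allFin (to x)))

  elements-unique : Unique elements
  elements-unique = Uniqueₚ.map⁺ (λ {i} {j} e → trans (sym (strictlyInverseˡ i)) (trans (cong to e) (strictlyInverseˡ j))) (Uniqueₚ.allFin⁺ q)

  length-elements : length elements ≡ q
  length-elements = trans (length-map from (allFin q)) (length-tabulate {n = q} id)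

  -- Translation by 1 permutes the field, so the sum of all elements equals itself plus q · 1.
  q×1≡0 : q ×ₙ 1# ≡ 0#
  q×1≡0 = begin
    q ×ₙ 1#                        ≡⟨ solve 2 (λ a b → a := (b :+ a) :- b) refl _ total ⟩
    (total + q ×ₙ 1#) - total      ≡⟨ cong (_- total) (cong (total +_) (sum-replicate q)) ⟨
    (total + sum {q} (λ _ → 1#)) - total ≡⟨ cong (_- total) (∑-distrib-+ from (λ _ → 1#)) ⟨
    sum (λ i → from i + 1#) - total ≡⟨ cong (_- total) (sum-cong-≗ {q} (λ i → strictlyInverseʳ (from i + 1#))) ⟨
    sum (from ∘ shift) - total     ≡⟨ cong (_- total) (sum-permute from π) ⟨
    total - total                  ≡⟨ -‿inverseʳ total ⟩
    0#                             ∎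
    where
    open ≡-Reasoning
    open Solver
    open Algebra.Properties.CommutativeMonoid.Sum R.+-commutativeMonoid
    total : F
    total = sum from
    shift unshift : Fin q → Fin q
    shift   i = to (from i + 1#)
    unshift i = to (from i - 1#)
    π = permutation shift unshift
      (λ i → trans (cong to (trans (cong (_+ 1#) (strictlyInverseʳ _)) (solve 2 (λ a b → (a :- b) :+ b := a) refl (from i) 1#))) (strictlyInverseˡ i))
      (λ i → trans (cong to (trans (cong (_- 1#) (strictlyInverseʳ _)) (solve 2 (λ a b → (a :+ b) :- b := a) refl (from i) 1#))) (strictlyInverseˡ i))

  -- For x ≠ 0, multiplication by x permutes the field. In the product Π of all elements with 0
  -- replaced by 1 (`nz`), it multiplies every factor by x except the one at 0; `δ₀` supplies that
  -- missing x, whence Π x = x^q Π. Here `sum` is the iterated product, taken in the multiplicative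
  -- monoid.
  fermat : ∀ x → x ^ q ≡ x
  fermat x with x ≟ 0#
  ... | yes refl = go q (to 0#)
    where
    go : ∀ n → Fin n → 0# ^ n ≡ 0#
    go (suc n) _ = 0^suc n
  ... | no x≢0 = sym (*-cancelˡ (Π-nonzero q from) (begin
    Π * x ≡⟨ cong₂ _*_ (sum-permute (nz ∘ from) π) (sym (Π-single q (to 0#) (δ₀ ∘ from) δ₀-hit δ₀-miss)) ⟩
    sum (nz ∘ from ∘ mul) * sum (δ₀ ∘ from)  ≡⟨ ∑-distrib-+ (nz ∘ from ∘ mul) (δ₀ ∘ from) ⟨
    sum (λ i → nz (from (mul i)) * δ₀ (from i)) ≡⟨ sum-cong-≗ {q} pointwise ⟩
    sum (λ i → x * nz (from i))              ≡⟨ ∑-distrib-+ (λ _ → x) (nz ∘ from) ⟩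
    sum {q} (λ _ → x) * Π                    ≡⟨ cong (_* Π) (sum-replicate q) ⟩
    x ^ q * Π                                ≡⟨ *-comm _ _ ⟩
    Π * x ^ q                                ∎))
    where
    open ≡-Reasoning
    open Algebra.Properties.CommutativeMonoid.Sum R.*-commutativeMonoid
    x⁻¹ : F
    x⁻¹ = proj₁ (inverse x x≢0)
    x*x⁻¹ : x * x⁻¹ ≡ 1#
    x*x⁻¹ = proj₂ (inverse x x≢0)
    nz δ₀ : F → F
    nz y with y ≟ 0#
    ... | yes _ = 1#
    ... | no  _ = y
    δ₀ y with y ≟ 0#
    ... | yes _ = x
    ... | no  _ = 1#
    Π : F
    Π = sum (nz ∘ from)
    mul div : Fin q → Fin q
    mul i = to (x * from i)
    div i = to (x⁻¹ * from i)
    cancel : ∀ {a b} → a * b ≡ 1# → ∀ c → a * (b * c) ≡ c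
    cancel {a} {b} ab≡1 c = trans (sym (*-assoc a b c)) (trans (cong (_* c) ab≡1) (*-identityˡ c))
    π = permutation mul div
      (λ i → trans (cong to (trans (cong (x *_) (strictlyInverseʳ _)) (cancel x*x⁻¹ _))) (strictlyInverseˡ i))
      (λ i → trans (cong to (trans (cong (x⁻¹ *_) (strictlyInverseʳ _)) (cancel (trans (*-comm _ _) x*x⁻¹) _))) (strictlyInverseˡ i))
    nz-nonzero : ∀ y → nz y ≢ 0#
    nz-nonzero y with y ≟ 0#
    ... | yes _   = 0≢1 ∘ sym
    ... | no  y≢0 = y≢0
    Π-nonzero : ∀ n (v : Fin n → F) → sum (nz ∘ v) ≢ 0#
    Π-nonzero zero    v = 0≢1 ∘ sym
    Π-nonzero (suc n) v = *-nonzero (nz-nonzero (v Fin.zero)) (Π-nonzero n (v ∘ Fin.suc))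
    Π-single : ∀ n (i : Fin n) v → v i ≡ x → (∀ j → j ≢ i → v j ≡ 1#) → sum v ≡ x
    Π-single (suc n) i v hit miss = begin
      sum v                      ≡⟨ sum-remove {i = i} v ⟩
      v i * sum (v ∘ punchIn i)  ≡⟨ cong₂ _*_ hit (sum-cong-≗ {n} (λ j → miss _ (Finₚ.punchInᵢ≢i i j))) ⟩
      x * sum {n} (λ _ → 1#)     ≡⟨ cong (x *_) (sum-replicate-zero n) ⟩
      x * 1#                     ≡⟨ *-identityʳ x ⟩
      x                          ∎
    δ₀-hit : δ₀ (from (to 0#)) ≡ x
    δ₀-hit with from (to 0#) ≟ 0#
    ... | yes _ = refl
    ... | no ¬e = contradiction (strictlyInverseʳ 0#) ¬e
    δ₀-miss : ∀ j → j ≢ to 0# → δ₀ (from j) ≡ 1#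
    δ₀-miss j j≢ with from j ≟ 0#
    ... | yes e = contradiction (trans (sym (strictlyInverseˡ j)) (cong to e)) j≢
    ... | no  _ = refl
    nz*δ₀ : ∀ y → nz (x * y) * δ₀ y ≡ x * nz y
    nz*δ₀ y with y ≟ 0# | (x * y) ≟ 0#
    ... | yes _    | yes _ = *-comm 1# x
    ... | yes refl | no ¬e = contradiction (zeroʳ x) ¬e
    ... | no y≢0   | yes e = contradiction (*-cancelˡ-0 x≢0 e) y≢0
    ... | no _     | no _  = *-identityʳ _
    pointwise : ∀ i → nz (from (mul i)) * δ₀ (from i) ≡ x * nz (from i)
    pointwise i = trans (cong (λ z → nz z * δ₀ (from i)) (strictlyInverseʳ (x * from i))) (nz*δ₀ (from i))

  -- (p · 1)^n = q · 1 = 0, and a field has no nilpotents.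
  p×1≡0 : ∀ {p} n → q ≡ p ℕ.^ n → p ×ₙ 1# ≡ 0#
  p×1≡0 {p} n q≡pⁿ with (p ×ₙ 1#) ≟ 0#
  ... | yes e  = e
  ... | no p≢0 = contradiction (trans (sym (power n)) (trans (cong (_×ₙ 1#) (sym q≡pⁿ)) q×1≡0)) (^-nonzero n p≢0)
    where
    power : ∀ n → (p ℕ.^ n) ×ₙ 1# ≡ (p ×ₙ 1#) ^ n
    power zero    = +-identityʳ 1#
    power (suc n) = trans (×1-homo-* p (p ℕ.^ n)) (cong (p ×ₙ 1# *_) (power n))

  ∉U : ∀ p u → ¬ InU p u → u ≢ 0# × u ≢ 1# × u ≢ - 1# × (p ≢ 3 → 3# * u ≢ 1# × 3# * u ≢ - 1#)
  ∉U p u u∉ with p ℕ.≟ 3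
  ... | yes p≡3 = u∉ ∘ inj₁ , u∉ ∘ inj₂ ∘ inj₁ , u∉ ∘ inj₂ ∘ inj₂ , contradiction p≡3
  ... | no  _   = u∉ ∘ inj₁ , u∉ ∘ inj₂ ∘ inj₁ , u∉ ∘ inj₂ ∘ inj₂ ∘ inj₁
    , λ _ → u∉ ∘ inj₂ ∘ inj₂ ∘ inj₂ ∘ inj₁ , u∉ ∘ inj₂ ∘ inj₂ ∘ inj₂ ∘ inj₂

-- Formal power series over the field.

module PowerSeries {q : ℕ} (K : FiniteField q) where
  open FieldFacts K

  Series : Set
  Series = ℕ → F

  infix 4 _≋_ _≋[_]_
  _≋_ : Series → Series → Set
  f ≋ g = ∀ i → f i ≡ g i

  _≋[_]_ : Series → ℕ → Series → Set
  f ≋[ n ] g = ∀ i → i < n → f i ≡ g i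

  infixl 6 _⊕_
  infixl 7 _⊛_
  infix  8 ⊝_

  _⊕_ _⊛_ : Series → Series → Series
  (f ⊕ g) i = f i + g i
  (f ⊛ g) zero    = f 0 * g 0
  (f ⊛ g) (suc i) = f 0 * g (suc i) + ((f ∘ suc) ⊛ g) i

  ⊝_ : Series → Series
  (⊝ f) i = - f i

  ⌜_⌝ : F → Series
  ⌜ a ⌝ zero    = a
  ⌜ a ⌝ (suc i) = 0#

  𝟘 𝟙 X : Series
  𝟘 i = 0#
  𝟙   = ⌜ 1# ⌝
  X zero    = 0#
  X (suc i) = 𝟙 i

  private
    open Solver
    variable
      f f′ g g′ h : Series

  ⊛-cong[] : ∀ n → f ≋[ n ] f′ → g ≋[ n ] g′ → f ⊛ g ≋[ n ] f′ ⊛ g′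
  ⊛-cong[] n f≋ g≋ zero    i<n = cong₂ _*_ (f≋ 0 i<n) (g≋ 0 i<n)
  ⊛-cong[] (suc n) f≋ g≋ (suc i) (s≤s i<n) = cong₂ _+_
    (cong₂ _*_ (f≋ 0 (s≤s z≤n)) (g≋ (suc i) (s≤s i<n)))
    (⊛-cong[] n (λ j j<n → f≋ (suc j) (s≤s j<n)) (λ j j<n → g≋ j (ℕₚ.m≤n⇒m≤1+n j<n)) i i<n)

  ⊛-cong : f ≋ f′ → g ≋ g′ → f ⊛ g ≋ f′ ⊛ g′
  ⊛-cong f≋ g≋ i = ⊛-cong[] (suc i) (λ j _ → f≋ j) (λ j _ → g≋ j) i ℕₚ.≤-refl

  ⊛-distribʳ : ∀ h f g → (f ⊕ g) ⊛ h ≋ f ⊛ h ⊕ g ⊛ h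
  ⊛-distribʳ h f g zero    = distribʳ _ _ _
  ⊛-distribʳ h f g (suc i) = trans (cong ((f 0 + g 0) * h (suc i) +_) (⊛-distribʳ h (f ∘ suc) (g ∘ suc) i))
    (solve 5 (λ a b c x y → (a :+ b) :* c :+ (x :+ y) := (a :* c :+ x) :+ (b :* c :+ y)) refl (f 0) (g 0) (h (suc i)) _ _)

  ⊛-scale : ∀ a f g → (λ i → a * f i) ⊛ g ≋ λ i → a * (f ⊛ g) i
  ⊛-scale a f g zero    = *-assoc _ _ _
  ⊛-scale a f g (suc i) = trans (cong (_ +_) (⊛-scale a (f ∘ suc) g i))
    (solve 4 (λ a b c x → a :* b :* c :+ a :* x := a :* (b :* c :+ x)) refl _ _ _ _)

  ⊛-assoc : ∀ f g h → (f ⊛ g) ⊛ h ≋ f ⊛ (g ⊛ h)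
  ⊛-assoc f g h zero    = *-assoc _ _ _
  ⊛-assoc f g h (suc i) = begin
    f 0 * g 0 * h (suc i) + (((λ j → f 0 * g (suc j)) ⊕ (f ∘ suc) ⊛ g) ⊛ h) i
      ≡⟨ cong (f 0 * g 0 * h (suc i) +_) (⊛-distribʳ h _ _ i) ⟩
    f 0 * g 0 * h (suc i) + (((λ j → f 0 * g (suc j)) ⊛ h) i + (((f ∘ suc) ⊛ g) ⊛ h) i)
      ≡⟨ cong (f 0 * g 0 * h (suc i) +_) (cong₂ _+_ (⊛-scale (f 0) (g ∘ suc) h i) (⊛-assoc (f ∘ suc) g h i)) ⟩
    f 0 * g 0 * h (suc i) + (f 0 * ((g ∘ suc) ⊛ h) i + ((f ∘ suc) ⊛ (g ⊛ h)) i)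
      ≡⟨ solve 5 (λ a b c x y → a :* b :* c :+ (a :* x :+ y) := a :* (b :* c :+ x) :+ y) refl _ _ _ _ _ ⟩
    f 0 * (g 0 * h (suc i) + ((g ∘ suc) ⊛ h) i) + ((f ∘ suc) ⊛ (g ⊛ h)) i ∎
    where open ≡-Reasoning

  -- The mirror image of the defining recursion, peeling the constant term off the second factor;
  -- with it commutativity is a plain induction.
  ⊛-unfoldʳ : ∀ f g i → (f ⊛ g) (suc i) ≡ f (suc i) * g 0 + (f ⊛ (g ∘ suc)) i
  ⊛-unfoldʳ f g zero    = +-comm _ _
  ⊛-unfoldʳ f g (suc i) = trans (cong (_ +_) (⊛-unfoldʳ (f ∘ suc) g i))
    (solve 3 (λ a b c → a :+ (b :+ c) := b :+ (a :+ c)) refl _ _ _)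

  ⊛-comm : ∀ f g → f ⊛ g ≋ g ⊛ f
  ⊛-comm f g zero    = *-comm _ _
  ⊛-comm f g (suc i) = trans (cong₂ _+_ (*-comm _ _) (⊛-comm (f ∘ suc) g i)) (sym (⊛-unfoldʳ g f i))

  ⊛-zeroˡ : ∀ f → 𝟘 ⊛ f ≋ 𝟘
  ⊛-zeroˡ f zero    = zeroˡ _
  ⊛-zeroˡ f (suc i) = trans (cong₂ _+_ (zeroˡ _) (⊛-zeroˡ f i)) (+-identityˡ _)

  ⌜⌝-⊛ : ∀ a f → ⌜ a ⌝ ⊛ f ≋ λ i → a * f i
  ⌜⌝-⊛ a f zero    = refl
  ⌜⌝-⊛ a f (suc i) = trans (cong (_ +_) (⊛-zeroˡ f i)) (+-identityʳ _)

  ⊛-identityˡ : ∀ f → 𝟙 ⊛ f ≋ f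
  ⊛-identityˡ f i = trans (⌜⌝-⊛ 1# f i) (*-identityˡ _)

  X⊛-zero : ∀ f → (X ⊛ f) 0 ≡ 0#
  X⊛-zero f = zeroˡ _

  X⊛-suc : ∀ f i → (X ⊛ f) (suc i) ≡ f i
  X⊛-suc f i = trans (cong₂ _+_ (zeroˡ _) (⊛-identityˡ f i)) (+-identityˡ _)

  series : CommutativeRing 0ℓ 0ℓ
  series = record
    { Carrier = Series ; _≈_ = _≋_ ; _+_ = _⊕_ ; _*_ = _⊛_ ; -_ = ⊝_ ; 0# = 𝟘 ; 1# = 𝟙
    ; isCommutativeRing = record
      { isRing = record
        { +-isAbelianGroup = record
          { isGroup = record
            { isMonoid = record
              { isSemigroup = record
                { isMagma = record
                  { isEquivalence = record
                    { refl = λ _ → refl ; sym = λ e i → sym (e i) ; trans = λ e e′ i → trans (e i) (e′ i) }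
                  ; ∙-cong = λ e e′ i → cong₂ _+_ (e i) (e′ i) }
                ; assoc = λ f g h i → +-assoc _ _ _ }
              ; identity = (λ f i → +-identityˡ _) , (λ f i → +-identityʳ _) }
            ; inverse = (λ f i → -‿inverseˡ _) , (λ f i → -‿inverseʳ _)
            ; ⁻¹-cong = λ e i → cong -_ (e i) }
          ; comm = λ f g i → +-comm _ _ }
        ; *-cong = ⊛-cong
        ; *-assoc = ⊛-assoc
        ; *-identity = ⊛-identityˡ , λ f i → trans (⊛-comm f 𝟙 i) (⊛-identityˡ f i)
        ; distrib = (λ f g h i → trans (⊛-comm f _ i) (trans (⊛-distribʳ f g h i) (cong₂ _+_ (⊛-comm g f i) (⊛-comm h f i))))
                  , ⊛-distribʳ }
      ; *-comm = ⊛-comm } }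

  module S = CommutativeRing series
  module ≋-Reasoning = Relation.Binary.Reasoning.Setoid S.setoid
  module SeriesSolver = IntegerSolver series
  open Algebra.Properties.Semiring.Exp S.semiring public using ()
    renaming (_^_ to _^ˢ_; ^-homo-* to ^ˢ-homo-⊛; ^-congˡ to ^ˢ-cong)
  open Algebra.Properties.CommutativeSemiring.Exp S.commutativeSemiring public using ()
    renaming (^-distrib-* to ^ˢ-distrib-⊛)

  ⌜⌝-cong : ∀ {a b} → a ≡ b → ⌜ a ⌝ ≋ ⌜ b ⌝
  ⌜⌝-cong refl i = refl

  ⌜⌝-+ : ∀ a b → ⌜ a + b ⌝ ≋ ⌜ a ⌝ ⊕ ⌜ b ⌝
  ⌜⌝-+ a b zero    = refl
  ⌜⌝-+ a b (suc i) = sym (+-identityˡ _)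

  ⌜⌝-* : ∀ a b → ⌜ a * b ⌝ ≋ ⌜ a ⌝ ⊛ ⌜ b ⌝
  ⌜⌝-* a b i = trans (lemma i) (sym (⌜⌝-⊛ a ⌜ b ⌝ i))
    where
    lemma : ∀ i → ⌜ a * b ⌝ i ≡ a * ⌜ b ⌝ i
    lemma zero    = refl
    lemma (suc i) = sym (zeroʳ _)

  ⌜⌝-0 : ⌜ 0# ⌝ ≋ 𝟘
  ⌜⌝-0 zero    = refl
  ⌜⌝-0 (suc i) = refl

  ⌜⌝-^ : ∀ a n → ⌜ a ^ n ⌝ ≋ ⌜ a ⌝ ^ˢ n
  ⌜⌝-^ a zero    = S.refl
  ⌜⌝-^ a (suc n) = S.trans (⌜⌝-* a (a ^ n)) (S.*-congˡ {⌜ a ⌝} (⌜⌝-^ a n))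

  X-unfold : ∀ f → f ≋ ⌜ f 0 ⌝ ⊕ X ⊛ (f ∘ suc)
  X-unfold f zero    = sym (trans (cong (f 0 +_) (X⊛-zero (f ∘ suc))) (+-identityʳ _))
  X-unfold f (suc i) = sym (trans (+-identityˡ _) (X⊛-suc _ i))

  X^-low : ∀ n f i → i < n → (X ^ˢ n ⊛ f) i ≡ 0#
  X^-low (suc n) f zero    _ = trans (⊛-assoc X (X ^ˢ n) f 0) (X⊛-zero (X ^ˢ n ⊛ f))
  X^-low (suc n) f (suc i) (s≤s i<n) = trans (⊛-assoc X (X ^ˢ n) f (suc i)) (trans (X⊛-suc (X ^ˢ n ⊛ f) i) (X^-low n f i i<n))

  X^-shift : ∀ n f i → (X ^ˢ n ⊛ f) (n ℕ.+ i) ≡ f i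
  X^-shift zero    f i = ⊛-identityˡ f i
  X^-shift (suc n) f i = trans (⊛-assoc X (X ^ˢ n) f (suc (n ℕ.+ i))) (trans (X⊛-suc (X ^ˢ n ⊛ f) (n ℕ.+ i)) (X^-shift n f i))

  ≋⇒≋[] : ∀ {n} → f ≋ g → f ≋[ n ] g
  ≋⇒≋[] e i _ = e i

  ≋[]-trans : ∀ {n} → f ≋[ n ] g → g ≋[ n ] h → f ≋[ n ] h
  ≋[]-trans e e′ i i<n = trans (e i i<n) (e′ i i<n)

  ≋[]-⊕ : ∀ {n} → f ≋[ n ] f′ → g ≋[ n ] g′ → f ⊕ g ≋[ n ] f′ ⊕ g′
  ≋[]-⊕ e e′ i i<n = cong₂ _+_ (e i i<n) (e′ i i<n)

  ≋[]-weaken : ∀ {m n} → m ≤ n → f ≋[ n ] g → f ≋[ m ] g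
  ≋[]-weaken m≤n e i i<m = e i (ℕₚ.≤-trans i<m m≤n)

  private
    open Algebra.Properties.Semiring.Mult S.semiring using () renaming (_×_ to _×ˢ_)
    open Algebra.Properties.Semiring.Mult (CommutativeRing.semiring ring) using () renaming (_×_ to _×ₙ_)

    ×-⌜⌝ : ∀ n → n ×ˢ 𝟙 ≋ ⌜ n ×ₙ 1# ⌝
    ×-⌜⌝ zero    i = sym (⌜⌝-0 i)
    ×-⌜⌝ (suc n) i = trans (cong (𝟙 i +_) (×-⌜⌝ n i)) (sym (⌜⌝-+ 1# (n ×ₙ 1#) i))

  -- Frobenius: h^q = h(0)^q + X^q t^q, where h = h(0) + X t.
  ^q-constant : ∀ {p} → Prime p → ∀ n → q ≡ p ℕ.^ n → ∀ h → h ^ˢ q ≋[ q ] ⌜ h 0 ⌝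
  ^q-constant {p} pr n q≡pⁿ h i i<q = begin
    (h ^ˢ q) i                                        ≡⟨ ^ˢ-cong q (X-unfold h) i ⟩
    ((⌜ h 0 ⌝ ⊕ X ⊛ t) ^ˢ q) i                        ≡⟨ frob i ⟩
    (⌜ h 0 ⌝ ^ˢ q) i + ((X ⊛ t) ^ˢ q) i ≡⟨ cong₂ _+_ (trans (sym (⌜⌝-^ (h 0) q i)) (⌜⌝-cong (fermat (h 0)) i)) (^ˢ-distrib-⊛ X t q i) ⟩
    ⌜ h 0 ⌝ i + (X ^ˢ q ⊛ t ^ˢ q) i                   ≡⟨ cong (⌜ h 0 ⌝ i +_) (X^-low q _ i i<q) ⟩
    ⌜ h 0 ⌝ i + 0#                                    ≡⟨ +-identityʳ _ ⟩
    ⌜ h 0 ⌝ i                                         ∎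
    where
    open ≡-Reasoning
    t : Series
    t = h ∘ suc
    p×𝟙≋0 : p ×ˢ 𝟙 ≋ 𝟘
    p×𝟙≋0 = S.trans (×-⌜⌝ p) (S.trans (⌜⌝-cong (p×1≡0 n q≡pⁿ)) ⌜⌝-0)
    frob : (⌜ h 0 ⌝ ⊕ X ⊛ t) ^ˢ q ≋ ⌜ h 0 ⌝ ^ˢ q ⊕ (X ⊛ t) ^ˢ q
    frob = subst (λ m → (⌜ h 0 ⌝ ⊕ X ⊛ t) ^ˢ m ≋ ⌜ h 0 ⌝ ^ˢ m ⊕ (X ⊛ t) ^ˢ m) (sym q≡pⁿ)
      (Frobenius.frobenius-iterated series pr p×𝟙≋0 n ⌜ h 0 ⌝ (X ⊛ t))

-- Polynomials as coefficient lists, and their roots with multiplicity.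

module Polynomials {q : ℕ} (K : FiniteField q) where
  open FieldFacts K
  open PowerSeries K

  addL mulL : List F → List F → List F
  addL []      s       = s
  addL (a ∷ r) []      = a ∷ r
  addL (a ∷ r) (b ∷ s) = a + b ∷ addL r s

  scaleL : F → List F → List F
  scaleL a []      = []
  scaleL a (b ∷ s) = a * b ∷ scaleL a s

  mulL []      s = []
  mulL (a ∷ r) s = addL (scaleL a s) (0# ∷ mulL r s)

  powL : List F → ℕ → List F
  powL r zero    = 1# ∷ []
  powL r (suc n) = mulL r (powL r n)

  shiftL : ℕ → List F → List F
  shiftL zero    r = r
  shiftL (suc n) r = 0# ∷ shiftL n r

  length-addL : ∀ {n} r s → length r ≤ n → length s ≤ n → length (addL r s) ≤ n
  length-addL []      s       _ s≤        = s≤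
  length-addL (a ∷ r) []      r≤ _        = r≤
  length-addL (a ∷ r) (b ∷ s) (s≤s r≤) (s≤s s≤) = s≤s (length-addL r s r≤ s≤)

  length-scaleL : ∀ a s → length (scaleL a s) ≡ length s
  length-scaleL a []      = refl
  length-scaleL a (b ∷ s) = cong suc (length-scaleL a s)

  length-mulL : ∀ {m n} r s → length r ≤ suc m → length s ≤ suc n → length (mulL r s) ≤ suc (m ℕ.+ n)
  length-mulL         []       s r≤ s≤ = z≤n
  length-mulL {m} {n} (a ∷ []) s r≤ s≤ = length-addL (scaleL a s) (0# ∷ [])
    (ℕₚ.≤-trans (ℕₚ.≤-reflexive (length-scaleL a s)) (ℕₚ.≤-trans s≤ (s≤s (ℕₚ.m≤n+m n m)))) (s≤s z≤n)
  length-mulL {suc m} {n} (a ∷ r@(_ ∷ _)) s (s≤s r≤) s≤ = length-addL (scaleL a s) (0# ∷ mulL r s)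
    (ℕₚ.≤-trans (ℕₚ.≤-reflexive (length-scaleL a s)) (ℕₚ.≤-trans s≤ (s≤s (ℕₚ.m≤n+m n (suc m)))))
    (s≤s (length-mulL r s r≤ s≤))
  length-mulL {zero} (a ∷ (_ ∷ _)) s (s≤s ()) s≤

  length-powL : ∀ {m} r → length r ≤ suc m → ∀ n → length (powL r n) ≤ suc (n ℕ.* m)
  length-powL r r≤ zero    = s≤s z≤n
  length-powL r r≤ (suc n) = length-mulL r (powL r n) r≤ (length-powL r r≤ n)

  length-shiftL : ∀ n r → length (shiftL n r) ≡ n ℕ.+ length r
  length-shiftL zero    r = refl
  length-shiftL (suc n) r = cong suc (length-shiftL n r)

  -- The target ring is abstract because the same list is evaluated at field elements and, for
  -- expansions, at power series.
  module Evaluation (A : CommutativeRing 0ℓ 0ℓ) (κ : F → CommutativeRing.Carrier A)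
    (κ-0 : CommutativeRing._≈_ A (κ 0#) (CommutativeRing.0# A))
    (κ-1 : CommutativeRing._≈_ A (κ 1#) (CommutativeRing.1# A))
    (κ-+ : ∀ a b → CommutativeRing._≈_ A (κ (a + b)) (CommutativeRing._+_ A (κ a) (κ b)))
    (κ-* : ∀ a b → CommutativeRing._≈_ A (κ (a * b)) (CommutativeRing._*_ A (κ a) (κ b)))
    where
    private
      module A = CommutativeRing A
      open IntegerSolver A
      open Relation.Binary.Reasoning.Setoid A.setoid
      open Algebra.Properties.Semiring.Exp A.semiring using () renaming (_^_ to _^ᴬ_)

    ev : List F → A.Carrier → A.Carrier
    ev []      y = A.0#
    ev (a ∷ r) y = κ a A.+ y A.* ev r y

    ev-addL : ∀ r s y → ev (addL r s) y A.≈ ev r y A.+ ev s y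
    ev-addL []      s       y = A.sym (A.+-identityˡ _)
    ev-addL (a ∷ r) []      y = A.sym (A.+-identityʳ _)
    ev-addL (a ∷ r) (b ∷ s) y = begin
      κ (a + b) A.+ y A.* ev (addL r s) y              ≈⟨ A.+-cong (κ-+ a b) (A.*-congˡ (ev-addL r s y)) ⟩
      (κ a A.+ κ b) A.+ y A.* (ev r y A.+ ev s y) ≈⟨ solve 5 (λ a b y r s → (a :+ b) :+ y :* (r :+ s) := (a :+ y :* r) :+ (b :+ y :* s)) A.refl (κ a) (κ b) y (ev r y) (ev s y) ⟩
      (κ a A.+ y A.* ev r y) A.+ (κ b A.+ y A.* ev s y) ∎

    ev-scaleL : ∀ a s y → ev (scaleL a s) y A.≈ κ a A.* ev s y
    ev-scaleL a []      y = A.sym (A.zeroʳ _)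
    ev-scaleL a (b ∷ s) y = begin
      κ (a * b) A.+ y A.* ev (scaleL a s) y      ≈⟨ A.+-cong (κ-* a b) (A.*-congˡ (ev-scaleL a s y)) ⟩
      κ a A.* κ b A.+ y A.* (κ a A.* ev s y) ≈⟨ solve 4 (λ a b y s → a :* b :+ y :* (a :* s) := a :* (b :+ y :* s)) A.refl (κ a) (κ b) y (ev s y) ⟩
      κ a A.* (κ b A.+ y A.* ev s y)             ∎

    ev-mulL : ∀ r s y → ev (mulL r s) y A.≈ ev r y A.* ev s y
    ev-mulL []      s y = A.sym (A.zeroˡ _)
    ev-mulL (a ∷ r) s y = begin
      ev (addL (scaleL a s) (0# ∷ mulL r s)) y                   ≈⟨ ev-addL (scaleL a s) _ y ⟩
      ev (scaleL a s) y A.+ (κ 0# A.+ y A.* ev (mulL r s) y) ≈⟨ A.+-cong (ev-scaleL a s y) (A.+-cong κ-0 (A.*-congˡ (ev-mulL r s y))) ⟩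
      κ a A.* ev s y A.+ (A.0# A.+ y A.* (ev r y A.* ev s y))    ≈⟨ A.+-congˡ (A.+-identityˡ _) ⟩
      κ a A.* ev s y A.+ y A.* (ev r y A.* ev s y) ≈⟨ solve 4 (λ a s y r → a :* s :+ y :* (r :* s) := (a :+ y :* r) :* s) A.refl (κ a) (ev s y) y (ev r y) ⟩
      (κ a A.+ y A.* ev r y) A.* ev s y                          ∎

    ev-powL : ∀ r n y → ev (powL r n) y A.≈ ev r y ^ᴬ n
    ev-powL r zero    y = A.trans (A.+-cong κ-1 (A.zeroʳ y)) (A.+-identityʳ _)
    ev-powL r (suc n) y = A.trans (ev-mulL r (powL r n) y) (A.*-congˡ (ev-powL r n y))

    ev-shiftL : ∀ n r y → ev (shiftL n r) y A.≈ y ^ᴬ n A.* ev r y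
    ev-shiftL zero    r y = A.sym (A.*-identityˡ _)
    ev-shiftL (suc n) r y = begin
      κ 0# A.+ y A.* ev (shiftL n r) y    ≈⟨ A.+-cong κ-0 (A.*-congˡ (ev-shiftL n r y)) ⟩
      A.0# A.+ y A.* (y ^ᴬ n A.* ev r y)  ≈⟨ A.+-identityˡ _ ⟩
      y A.* (y ^ᴬ n A.* ev r y)           ≈⟨ A.*-assoc _ _ _ ⟨
      y A.* y ^ᴬ n A.* ev r y             ∎

  module EvF = Evaluation ring id refl refl (λ _ _ → refl) (λ _ _ → refl)
  module EvS = Evaluation series ⌜_⌝ ⌜⌝-0 S.refl ⌜⌝-+ ⌜⌝-*
  open EvF using (ev)
  open EvS using () renaming (ev to evˢ)

  -- The quotient of a ∷ r by X − x; it does not depend on a.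
  quotient : F → List F → List F
  quotient x []      = []
  quotient x (b ∷ r) = ev (b ∷ r) x ∷ quotient x r

  length-quotient : ∀ x r → length (quotient x r) ≡ length r
  length-quotient x []      = refl
  length-quotient x (b ∷ r) = cong suc (length-quotient x r)

  -- The argument y is arbitrary because the identity is read both at `X` and along every line z +
  -- γ(z) X.
  quotient-spec : ∀ x a r y → evˢ (a ∷ r) y ≋ (y ⊕ ⊝ ⌜ x ⌝) ⊛ evˢ (quotient x r) y ⊕ ⌜ ev (a ∷ r) x ⌝
  quotient-spec x a [] y = begin
    ⌜ a ⌝ ⊕ y ⊛ 𝟘 ≈⟨ solve 3 (λ a y x → a :+ y :* con (ℤ.+ 0) := (y :- x) :* con (ℤ.+ 0) :+ a) S.refl ⌜ a ⌝ y ⌜ x ⌝ ⟩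
    (y ⊕ ⊝ ⌜ x ⌝) ⊛ 𝟘 ⊕ ⌜ a ⌝ ≈⟨ S.+-congˡ {(y ⊕ ⊝ ⌜ x ⌝) ⊛ 𝟘} (⌜⌝-cong (trans (cong (a +_) (zeroʳ x)) (+-identityʳ a))) ⟨
    (y ⊕ ⊝ ⌜ x ⌝) ⊛ 𝟘 ⊕ ⌜ a + x * 0# ⌝   ∎
    where
    open ≋-Reasoning
    open SeriesSolver
  quotient-spec x a r@(b ∷ r′) y = begin
    ⌜ a ⌝ ⊕ y ⊛ evˢ r y                            ≈⟨ S.+-congˡ {⌜ a ⌝} (S.*-congˡ {y} (quotient-spec x b r′ y)) ⟩
    ⌜ a ⌝ ⊕ y ⊛ ((y ⊕ ⊝ ⌜ x ⌝) ⊛ Q ⊕ ⌜ v ⌝) ≈⟨ solve 5 (λ a y x Q v → a :+ y :* ((y :- x) :* Q :+ v) := (y :- x) :* (v :+ y :* Q) :+ (a :+ x :* v)) S.refl ⌜ a ⌝ y ⌜ x ⌝ Q ⌜ v ⌝ ⟩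
    (y ⊕ ⊝ ⌜ x ⌝) ⊛ (⌜ v ⌝ ⊕ y ⊛ Q) ⊕ (⌜ a ⌝ ⊕ ⌜ x ⌝ ⊛ ⌜ v ⌝) ≈⟨ S.+-congˡ {(y ⊕ ⊝ ⌜ x ⌝) ⊛ (⌜ v ⌝ ⊕ y ⊛ Q)} (S.trans (⌜⌝-+ a (x * v)) (S.+-congˡ {⌜ a ⌝} (⌜⌝-* x v))) ⟨
    (y ⊕ ⊝ ⌜ x ⌝) ⊛ (⌜ v ⌝ ⊕ y ⊛ Q) ⊕ ⌜ a + x * v ⌝ ∎
    where
    open ≋-Reasoning
    open SeriesSolver
    Q : Series
    Q = evˢ (quotient x r′) y
    v : F
    v = ev r x

  line : F → F → Series
  line x γ = ⌜ x ⌝ ⊕ ⌜ γ ⌝ ⊛ X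

  line-⊛-zero : ∀ e γ v → (line e γ ⊛ v) 0 ≡ e * v 0
  line-⊛-zero e γ v = cong (_* v 0) (trans (cong (e +_) (zeroʳ γ)) (+-identityʳ e))

  line-⊛-suc : ∀ e γ v i → (line e γ ⊛ v) (suc i) ≡ e * v (suc i) + γ * v i
  line-⊛-suc e γ v i = begin
    (line e γ ⊛ v) (suc i)                              ≡⟨ ⊛-distribʳ v ⌜ e ⌝ (⌜ γ ⌝ ⊛ X) (suc i) ⟩
    (⌜ e ⌝ ⊛ v) (suc i) + ((⌜ γ ⌝ ⊛ X) ⊛ v) (suc i)     ≡⟨ cong₂ _+_ (⌜⌝-⊛ e v (suc i)) (⊛-assoc ⌜ γ ⌝ X v (suc i)) ⟩
    e * v (suc i) + (⌜ γ ⌝ ⊛ (X ⊛ v)) (suc i)           ≡⟨ cong (e * v (suc i) +_) (⌜⌝-⊛ γ (X ⊛ v) (suc i)) ⟩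
    e * v (suc i) + γ * (X ⊛ v) (suc i)                 ≡⟨ cong (λ z → e * v (suc i) + γ * z) (X⊛-suc v i) ⟩
    e * v (suc i) + γ * v i                             ∎
    where open ≡-Reasoning

  -- For e ≠ 0 the line is an invertible series, so cancelling it keeps the order of vanishing; for
  -- e = 0 (`line-cancel-X`) it is a constant multiple of X and one order is lost.
  line-cancel-unit : ∀ {e} γ v k → e ≢ 0# → line e γ ⊛ v ≋[ k ] 𝟘 → v ≋[ k ] 𝟘
  line-cancel-unit {e} γ v k e≢0 lv≋0 zero    i<k = *-cancelˡ-0 e≢0 (trans (sym (line-⊛-zero e γ v)) (lv≋0 0 i<k))
  line-cancel-unit {e} γ v k e≢0 lv≋0 (suc i) i<k = *-cancelˡ-0 e≢0 (begin
    e * v (suc i)               ≡⟨ trans (cong (_ +_) (zeroʳ γ)) (+-identityʳ _) ⟨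
    e * v (suc i) + γ * 0# ≡⟨ cong (λ z → e * v (suc i) + γ * z) (line-cancel-unit γ v k e≢0 lv≋0 i (ℕₚ.<-trans (ℕₚ.n<1+n i) i<k)) ⟨
    e * v (suc i) + γ * v i     ≡⟨ line-⊛-suc e γ v i ⟨
    (line e γ ⊛ v) (suc i)      ≡⟨ lv≋0 (suc i) i<k ⟩
    0#                          ∎)
    where open ≡-Reasoning

  line-cancel-X : ∀ {γ} v k → γ ≢ 0# → line 0# γ ⊛ v ≋[ suc k ] 𝟘 → v ≋[ k ] 𝟘
  line-cancel-X {γ} v k γ≢0 lv≋0 i i<k = *-cancelˡ-0 γ≢0 (begin
    γ * v i                     ≡⟨ trans (cong (_+ γ * v i) (zeroˡ _)) (+-identityˡ _) ⟨
    0# * v (suc i) + γ * v i    ≡⟨ line-⊛-suc 0# γ v i ⟨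
    (line 0# γ ⊛ v) (suc i)     ≡⟨ lv≋0 (suc i) (s≤s i<k) ⟩
    0#                          ∎)
    where open ≡-Reasoning

  line-minus : ∀ z γ x → line z γ ⊕ ⊝ ⌜ x ⌝ ≋ line (z - x) γ
  line-minus z γ x i = trans (solve 3 (λ a b c → (a :+ b) :- c := (a :- c) :+ b) refl (⌜ z ⌝ i) _ (⌜ x ⌝ i))
    (cong (_+ (⌜ γ ⌝ ⊛ X) i) (lemma i))
    where
    open Solver
    lemma : ∀ i → ⌜ z ⌝ i - ⌜ x ⌝ i ≡ ⌜ z - x ⌝ i
    lemma zero    = refl
    lemma (suc i) = -‿inverseʳ 0#

  ev-line-zero : ∀ r x γ → evˢ r (line x γ) 0 ≡ ev r x
  ev-line-zero []      x γ = refl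
  ev-line-zero (a ∷ r) x γ = cong (a +_) (trans (line-⊛-zero x γ (evˢ r (line x γ))) (cong (x *_) (ev-line-zero r x γ)))

  ev-X-zero : ∀ r → evˢ r X 0 ≡ ev r 0#
  ev-X-zero []      = refl
  ev-X-zero (a ∷ r) = cong (a +_) (trans (X⊛-zero (evˢ r X)) (sym (zeroˡ _)))

  -- Multiplicity at least k at z, provided γ z ≠ 0: the expansion variable is only rescaled. The
  -- scale γ is kept because it will be the value of f.
  VanishesAt : List F → (F → F) → ℕ → F → Set
  VanishesAt r γ k z = evˢ r (line z (γ z)) ≋[ k ] 𝟘

  -- A polynomial with n coefficients and at least n roots, counted with multiplicity, is zero. One
  -- linear factor is divided out at a time: `x` is the root in use, with `k` of its multiplicity
  -- left, and the other roots keep multiplicity ℓ because X - x is a unit there.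
  vanish-everywhere : ∀ (γ : F → F) ℓ n r → length r ≡ n → ∀ k x xs →
    All (λ z → γ z ≢ 0#) (x ∷ xs) → Unique (x ∷ xs) →
    VanishesAt r γ k x → All (VanishesAt r γ ℓ) xs →
    n ≤ k ℕ.+ length xs ℕ.* ℓ → evˢ r X ≋ 𝟘
  vanish-everywhere γ ℓ zero    []      _   k x xs γ≢0 uniq vx vxs n≤ = S.refl
  vanish-everywhere γ ℓ (suc n) (a ∷ r) len zero x []        γ≢0 uniq vx vxs ()
  vanish-everywhere γ ℓ (suc n) (a ∷ r) len zero x (x′ ∷ xs) (_ ∷ γ≢0) (_ ∷ uniq) vx (vx′ ∷ vxs) n≤ =
    vanish-everywhere γ ℓ (suc n) (a ∷ r) len ℓ x′ xs γ≢0 uniq vx′ vxs n≤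
  vanish-everywhere γ ℓ (suc n) (a ∷ r) len (suc k) x xs (γx≢0 ∷ γ≢0) (x∉ ∷ uniq) vx vxs (s≤s n≤) = begin
    evˢ (a ∷ r) X                            ≈⟨ quotient-spec x a r X ⟩
    (X ⊕ ⊝ ⌜ x ⌝) ⊛ evˢ (quotient x r) X ⊕ ⌜ ev (a ∷ r) x ⌝
      ≈⟨ S.+-cong (S.*-congˡ {X ⊕ ⊝ ⌜ x ⌝} IH) (S.trans (⌜⌝-cong root) ⌜⌝-0) ⟩
    (X ⊕ ⊝ ⌜ x ⌝) ⊛ 𝟘 ⊕ 𝟘                    ≈⟨ S.trans (S.+-identityʳ _) (S.zeroʳ _) ⟩
    𝟘                                        ∎
    where
    open ≋-Reasoning
    root : ev (a ∷ r) x ≡ 0#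
    root = trans (sym (ev-line-zero (a ∷ r) x (γ x))) (vx 0 (s≤s z≤n))
    factored : ∀ z → evˢ (a ∷ r) (line z (γ z)) ≋ line (z - x) (γ z) ⊛ evˢ (quotient x r) (line z (γ z))
    factored z = begin
      evˢ (a ∷ r) y                                       ≈⟨ quotient-spec x a r y ⟩
      (y ⊕ ⊝ ⌜ x ⌝) ⊛ evˢ (quotient x r) y ⊕ ⌜ ev (a ∷ r) x ⌝ ≈⟨ S.+-cong (S.*-congʳ {evˢ (quotient x r) y} (line-minus z (γ z) x)) (S.trans (⌜⌝-cong root) ⌜⌝-0) ⟩
      line (z - x) (γ z) ⊛ evˢ (quotient x r) y ⊕ 𝟘       ≈⟨ S.+-identityʳ _ ⟩
      line (z - x) (γ z) ⊛ evˢ (quotient x r) y           ∎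
      where
      y : Series
      y = line z (γ z)
    at-x : VanishesAt (quotient x r) γ k x
    at-x = line-cancel-X (evˢ (quotient x r) (line x (γ x))) k γx≢0
      (subst (λ e → line e (γ x) ⊛ evˢ (quotient x r) (line x (γ x)) ≋[ suc k ] 𝟘) (-‿inverseʳ x)
        (≋[]-trans (≋⇒≋[] (S.sym (factored x))) vx))
    at-z : ∀ {z} → x ≢ z × VanishesAt (a ∷ r) γ ℓ z → VanishesAt (quotient x r) γ ℓ z
    at-z {z} (x≢z , vz) = line-cancel-unit (γ z) (evˢ (quotient x r) (line z (γ z))) ℓ
      (λ e → x≢z (sym (x-y≡0⇒x≡y e))) (≋[]-trans (≋⇒≋[] (S.sym (factored z))) vz)
    IH : evˢ (quotient x r) X ≋ 𝟘
    IH = vanish-everywhere γ ℓ n (quotient x r) (trans (length-quotient x r) (ℕₚ.suc-injective len)) k x xs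
      (γx≢0 ∷ γ≢0) (x∉ ∷ uniq) at-x (All.map at-z (All.zip (x∉ , vxs))) n≤

-- Gaussian elimination: underdetermined systems have nonzero solutions.

module LinearAlgebra {q : ℕ} (K : FiniteField q) where
  open FieldFacts K
  open Solver

  -- The unknowns form a function on ℕ, so that blocks of unknowns are obtained by shifting the
  -- index.
  dot : ∀ {n} → Vec F n → (ℕ → F) → F
  dot []       c = 0#
  dot (a ∷ as) c = c 0 * a + dot as (c ∘ suc)

  dot-0 : ∀ {n} (as : Vec F n) → dot as (λ _ → 0#) ≡ 0#
  dot-0 []       = refl
  dot-0 (a ∷ as) = trans (cong₂ _+_ (zeroˡ a) (dot-0 as)) (+-identityˡ 0#)

  -- Replaces row (b ∷ bs) by bs − t·as, the tail of (b ∷ bs) − t·pivot.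
  reduce : ∀ {n} → F → Vec F n → Vec F n → Vec F n
  reduce t []       []       = []
  reduce t (a ∷ as) (b ∷ bs) = b - t * a ∷ reduce t as bs

  dot-reduce : ∀ {n} t (as bs : Vec F n) c → dot (reduce t as bs) c ≡ dot bs c - t * dot as c
  dot-reduce t []       []       c = solve 1 (λ t → con (ℤ.+ 0) := con (ℤ.+ 0) :- t :* con (ℤ.+ 0)) refl t
  dot-reduce t (a ∷ as) (b ∷ bs) c = trans (cong (c 0 * (b - t * a) +_) (dot-reduce t as bs (c ∘ suc)))
    (solve 6 (λ c a b t x y → c :* (b :- t :* a) :+ (y :- t :* x) := (c :* b :+ y) :- t :* (c :* a :+ x)) refl
      (c 0) a b t (dot as (c ∘ suc)) (dot bs (c ∘ suc)))

  reduceAll : ∀ {n} → F → Vec F n → List (Vec F (suc n)) → List (Vec F n)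
  reduceAll a⁻¹ as []                = []
  reduceAll a⁻¹ as ((b ∷ bs) ∷ rows) = reduce (b * a⁻¹) as bs ∷ reduceAll a⁻¹ as rows

  length-reduceAll : ∀ {n} a⁻¹ (as : Vec F n) rows → length (reduceAll a⁻¹ as rows) ≡ length rows
  length-reduceAll a⁻¹ as []                = refl
  length-reduceAll a⁻¹ as ((b ∷ bs) ∷ rows) = cong suc (length-reduceAll a⁻¹ as rows)

  private
    ZeroHead : ∀ {n} → Vec F (suc n) → Set
    ZeroHead row = Vec.head row ≡ 0#

    e₀ : ℕ → F
    e₀ zero    = 1#
    e₀ (suc _) = 0#

  -- The last component stands in for a permutation: to transfer a property back to all rows is
  -- everything elimination requires from the extraction of the pivot.
  findPivot : ∀ {n} (rows : List (Vec F (suc n))) →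
    All ZeroHead rows ⊎
    ∃ λ pivot → Vec.head pivot ≢ 0# × ∃ λ rest → suc (length rest) ≡ length rows ×
      (∀ {P : Vec F (suc n) → Set} → P pivot → All P rest → All P rows)
  findPivot [] = inj₁ []
  findPivot (row ∷ rows) with Vec.head row ≟ 0#
  ... | no ≢0 = inj₂ (row , ≢0 , rows , refl , _∷_)
  ... | yes e with findPivot rows
  ...   | inj₁ zeros = inj₁ (e ∷ zeros)
  ...   | inj₂ (pivot , ≢0 , rest , len , restore) =
    inj₂ (pivot , ≢0 , row ∷ rest , cong suc len , λ { Pp (Pr ∷ Prest) → Pr ∷ restore Pp Prest })

  -- If the first column vanishes, the first unit vector is a solution. Otherwise the pivot row
  -- clears the column, the induction solves for the remaining unknowns, and the pivot row
  -- determines the first one.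
  kernel : ∀ n (rows : List (Vec F n)) → length rows < n →
    ∃ λ (c : ℕ → F) → (∃ λ i → i < n × c i ≢ 0#) × All (λ row → dot row c ≡ 0#) rows
  kernel (suc n) rows (s≤s len) with findPivot rows
  ... | inj₁ zeros = e₀ , (0 , s≤s z≤n , 0≢1 ∘ sym) , All.map (λ {row} → go row) zeros
    where
    go : ∀ (row : Vec F (suc n)) → ZeroHead row → dot row e₀ ≡ 0#
    go (_ ∷ as) refl = trans (cong₂ _+_ (zeroʳ 1#) (dot-0 as)) (+-identityˡ 0#)
  ... | inj₂ (a ∷ as , a≢0 , rest , lenRest , restore) with kernel n (reduceAll (proj₁ (inverse a a≢0)) as rest)
      (ℕₚ.≤-trans (ℕₚ.≤-reflexive (trans (cong suc (length-reduceAll _ as rest)) lenRest)) len)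
  ... | c , (i , i<n , ci≢0) , zeros = c′ , (suc i , s≤s i<n , ci≢0) , restore atPivot (lift rest zeros)
    where
    a⁻¹ : F
    a⁻¹ = proj₁ (inverse a a≢0)
    c′ : ℕ → F
    c′ zero    = - (a⁻¹ * dot as c)
    c′ (suc i) = c i
    aa⁻¹ : a * a⁻¹ ≡ 1#
    aa⁻¹ = proj₂ (inverse a a≢0)
    atPivot : c′ 0 * a + dot as c ≡ 0#
    atPivot = begin
      - (a⁻¹ * D) * a + D     ≡⟨ solve 3 (λ a b D → :- (b :* D) :* a :+ D := D :* (con (ℤ.+ 1) :- a :* b)) refl a a⁻¹ D ⟩
      D * (1# - a * a⁻¹)      ≡⟨ cong (D *_) (x≡y⇒x-y≡0 (sym aa⁻¹)) ⟩
      D * 0#                  ≡⟨ zeroʳ D ⟩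
      0#                      ∎
      where
      open ≡-Reasoning
      D : F
      D = dot as c
    atRow : ∀ b bs → dot (reduce (b * a⁻¹) as bs) c ≡ 0# → c′ 0 * b + dot bs c ≡ 0#
    atRow b bs e = begin
      - (a⁻¹ * dot as c) * b + dot bs c ≡⟨ solve 4 (λ b i x y → :- (i :* x) :* b :+ y := y :- (b :* i) :* x) refl b a⁻¹ (dot as c) (dot bs c) ⟩
      dot bs c - b * a⁻¹ * dot as c          ≡⟨ dot-reduce (b * a⁻¹) as bs c ⟨
      dot (reduce (b * a⁻¹) as bs) c         ≡⟨ e ⟩
      0#                                     ∎
      where open ≡-Reasoning
    lift : ∀ rs → All (λ row → dot row c ≡ 0#) (reduceAll a⁻¹ as rs) → All (λ row → dot row c′ ≡ 0#) rs
    lift []              []       = []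
    lift ((b ∷ bs) ∷ rs) (e ∷ es) = atRow b bs e ∷ lift rs es

-- Degree bounds for functions of the base point, and linear families of expansions.

module PolynomialFunctions {q : ℕ} (K : FiniteField q) where
  open FieldFacts K
  open PowerSeries K
  open LinearAlgebra K
  open Solver

  -- A Horner presentation of degree at most d. The constructors hold pointwise equations, so a
  -- coefficient of a product of series qualifies in whatever form it arises.
  data PolyFun : ℕ → (F → F) → Set where
    const : ∀ {d φ} a → (∀ x → φ x ≡ a) → PolyFun d φ
    step  : ∀ {d φ ψ} a → PolyFun d ψ → (∀ x → φ x ≡ a + x * ψ x) → PolyFun (suc d) φ

  private variable
    d d′ n : ℕ
    φ ψ : F → F

  PolyFun-cong : (∀ x → ψ x ≡ φ x) → PolyFun d φ → PolyFun d ψ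
  PolyFun-cong e (const a φ≡)  = const a (λ x → trans (e x) (φ≡ x))
  PolyFun-cong e (step a p φ≡) = step a p (λ x → trans (e x) (φ≡ x))

  PolyFun-weaken : d ≤ d′ → PolyFun d φ → PolyFun d′ φ
  PolyFun-weaken d≤d′       (const a φ≡)  = const a φ≡
  PolyFun-weaken (s≤s d≤d′) (step a p φ≡) = step a (PolyFun-weaken d≤d′ p) φ≡

  PolyFun-x : PolyFun 1 (λ x → x)
  PolyFun-x = step 0# (const 1# (λ _ → refl)) (λ x → solve 1 (λ x → x := con (ℤ.+ 0) :+ x :* con (ℤ.+ 1)) refl x)

  PolyFun-+ : PolyFun d φ → PolyFun d ψ → PolyFun d (λ x → φ x + ψ x)
  PolyFun-+ (const a φ≡)  (const b ψ≡)  = const (a + b) (λ x → cong₂ _+_ (φ≡ x) (ψ≡ x))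
  PolyFun-+ (const a φ≡)  (step b p ψ≡) = step (a + b) p (λ x → trans (cong₂ _+_ (φ≡ x) (ψ≡ x)) (sym (+-assoc _ _ _)))
  PolyFun-+ (step a p φ≡) (const b ψ≡)  = step (a + b) p (λ x → trans (cong₂ _+_ (φ≡ x) (ψ≡ x))
    (solve 3 (λ a b y → (a :+ y) :+ b := (a :+ b) :+ y) refl _ _ _))
  PolyFun-+ (step a p φ≡) (step b p′ ψ≡) = step (a + b) (PolyFun-+ p p′) (λ x → trans (cong₂ _+_ (φ≡ x) (ψ≡ x))
    (solve 5 (λ a b x y z → (a :+ x :* y) :+ (b :+ x :* z) := (a :+ b) :+ x :* (y :+ z)) refl _ _ x _ _))

  PolyFun-scale : ∀ b → PolyFun d φ → PolyFun d (λ x → b * φ x)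
  PolyFun-scale b (const a φ≡)  = const (b * a) (λ x → cong (b *_) (φ≡ x))
  PolyFun-scale b (step a p φ≡) = step (b * a) (PolyFun-scale b p) (λ x → trans (cong (b *_) (φ≡ x))
    (solve 4 (λ a b x y → b :* (a :+ x :* y) := b :* a :+ x :* (b :* y)) refl a b x _))

  PolyFun-* : PolyFun d φ → PolyFun d′ ψ → PolyFun (d ℕ.+ d′) (λ x → φ x * ψ x)
  PolyFun-* {d} {d′ = d′} (const a φ≡) p′ = PolyFun-weaken (ℕₚ.m≤n+m d′ d)
    (PolyFun-cong (λ x → cong (_* _) (φ≡ x)) (PolyFun-scale a p′))
  PolyFun-* {suc d} {d′ = d′} {ψ = ψ} (step {ψ = χ} a p φ≡) p′ =
    PolyFun-cong (λ x → trans (cong (_* _) (φ≡ x))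
        (solve 4 (λ a x y z → (a :+ x :* y) :* z := a :* z :+ (con (ℤ.+ 0) :+ x :* (y :* z))) refl a x (χ x) (ψ x)))
      (PolyFun-+ (PolyFun-weaken (ℕₚ.m≤n+m d′ (suc d)) (PolyFun-scale a p′))
                 (step 0# (PolyFun-* p p′) (λ _ → refl)))

  horner : Vec F n → F → F
  horner []       x = 0#
  horner (a ∷ as) x = a + x * horner as x

  coefficients : PolyFun d φ → ∃ λ (as : Vec F (suc d)) → ∀ x → φ x ≡ horner as x
  coefficients {d} (const a φ≡) = a ∷ Vec.replicate d 0# ,
    λ x → trans (φ≡ x) (sym (trans (cong (λ z → a + x * z) (zeros d x)) (trans (cong (a +_) (zeroʳ x)) (+-identityʳ a))))
    where
    zeros : ∀ n x → horner (Vec.replicate n 0#) x ≡ 0#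
    zeros zero    x = refl
    zeros (suc n) x = trans (cong (λ z → 0# + x * z) (zeros n x)) (trans (+-identityˡ _) (zeroʳ x))
  coefficients (step a p φ≡) with coefficients p
  ... | as , ψ≡ = a ∷ as , λ x → trans (φ≡ x) (cong (λ z → a + x * z) (ψ≡ x))

  module Weighted (e : ℕ) where

    -- Models expansions at x + f(x) S with deg f = e + 1: each power of S multiplies by f(x) and differentiates once.
    Weight : ℕ → (F → Series) → Set
    Weight d Ψ = ∀ k → PolyFun (d ℕ.+ k ℕ.* e) (λ x → Ψ x k)

    Weight-cong : ∀ {Ψ Φ} → (∀ x → Φ x ≋ Ψ x) → Weight d Ψ → Weight d Φ
    Weight-cong Φ≋Ψ w k = PolyFun-cong (λ x → Φ≋Ψ x k) (w k)

    Weight-weaken : ∀ {Ψ} → d ≤ d′ → Weight d Ψ → Weight d′ Ψ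
    Weight-weaken d≤d′ w k = PolyFun-weaken (ℕₚ.+-monoˡ-≤ (k ℕ.* e) d≤d′) (w k)

    Weight-⌜⌝ : PolyFun d φ → Weight d (λ x → ⌜ φ x ⌝)
    Weight-⌜⌝ p zero    = PolyFun-weaken (ℕₚ.m≤m+n _ _) p
    Weight-⌜⌝ p (suc k) = const 0# (λ _ → refl)

    Weight-⊕ : ∀ {Ψ Φ} → Weight d Ψ → Weight d Φ → Weight d (λ x → Ψ x ⊕ Φ x)
    Weight-⊕ w w′ k = PolyFun-+ (w k) (w′ k)

    Weight-tail : ∀ {Ψ} → Weight d Ψ → Weight (d ℕ.+ e) (λ x → Ψ x ∘ suc)
    Weight-tail {d} w k = PolyFun-weaken (ℕₚ.≤-reflexive (sym (ℕₚ.+-assoc d e (k ℕ.* e)))) (w (suc k))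

    Weight-⊛ : ∀ {Ψ Φ} → Weight d Ψ → Weight d′ Φ → Weight (d ℕ.+ d′) (λ x → Ψ x ⊛ Φ x)
    Weight-⊛ {d} {d′} w w′ zero = PolyFun-weaken (ℕₚ.≤-reflexive eq) (PolyFun-* (w 0) (w′ 0))
      where
      eq : (d ℕ.+ 0) ℕ.+ (d′ ℕ.+ 0) ≡ d ℕ.+ d′ ℕ.+ 0
      eq rewrite ℕₚ.+-identityʳ d | ℕₚ.+-identityʳ d′ | ℕₚ.+-identityʳ (d ℕ.+ d′) = refl
    Weight-⊛ {d} {d′} w w′ (suc k) = PolyFun-+
      (PolyFun-weaken (ℕₚ.≤-reflexive eq₁) (PolyFun-* (w 0) (w′ (suc k))))
      (PolyFun-weaken (ℕₚ.≤-reflexive eq₂) (Weight-⊛ (Weight-tail w) w′ k))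
      where
      eq₁ : (d ℕ.+ 0) ℕ.+ (d′ ℕ.+ (e ℕ.+ k ℕ.* e)) ≡ d ℕ.+ d′ ℕ.+ (e ℕ.+ k ℕ.* e)
      eq₁ rewrite ℕₚ.+-identityʳ d = sym (ℕₚ.+-assoc d d′ _)
      eq₂ : d ℕ.+ e ℕ.+ d′ ℕ.+ k ℕ.* e ≡ d ℕ.+ d′ ℕ.+ (e ℕ.+ k ℕ.* e)
      eq₂ rewrite ℕₚ.+-assoc d e d′ | ℕₚ.+-comm e d′ | sym (ℕₚ.+-assoc d d′ e) = ℕₚ.+-assoc (d ℕ.+ d′) e _

    Weight-^ : ∀ {Ψ} → Weight 0 Ψ → ∀ n → Weight 0 (λ x → Ψ x ^ˢ n)
    Weight-^ w zero    = Weight-⌜⌝ (const 1# (λ _ → refl))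
    Weight-^ w (suc n) = Weight-⊛ w (Weight-^ w n)

    -- Linearity in the unknowns in explicit form: the constructors list the series that multiply
    -- the single unknowns, and the rows of the linear system are read off from them.
    data LinearFamily (d : ℕ) : ℕ → ((ℕ → F) → F → Series) → Set where
      nil  : ∀ {Ψ} → (∀ c x → Ψ c x ≋ 𝟘) → LinearFamily d 0 Ψ
      cons : ∀ {n Ψ Ψ′} ψ → Weight d ψ → LinearFamily d n Ψ′ →
        (∀ c x → Ψ c x ≋ ⌜ c 0 ⌝ ⊛ ψ x ⊕ Ψ′ (c ∘ suc) x) → LinearFamily d (suc n) Ψ

    LinearFamily-++ : ∀ {m n Ψ Ψ₁ Ψ₂} → LinearFamily d m Ψ₁ → LinearFamily d n Ψ₂ →
      (∀ c x → Ψ c x ≋ Ψ₁ c x ⊕ Ψ₂ (c ∘ (m ℕ.+_)) x) → LinearFamily d (m ℕ.+ n) Ψ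
    LinearFamily-++ (nil Ψ₁≋0) L₂ Ψ≋ = go L₂ (λ c x → S.trans (Ψ≋ c x) (S.trans (S.+-congʳ (Ψ₁≋0 c x)) (S.+-identityˡ _)))
      where
      go : ∀ {n Ψ Ψ′} → LinearFamily d n Ψ → (∀ c x → Ψ′ c x ≋ Ψ c x) → LinearFamily d n Ψ′
      go (nil z)        eq = nil (λ c x → S.trans (eq c x) (z c x))
      go (cons ψ w L z) eq = cons ψ w L (λ c x → S.trans (eq c x) (z c x))
    LinearFamily-++ {m = suc m} {Ψ₂ = Ψ₂} (cons {Ψ′ = Ψ′} ψ w L₁ Ψ₁≋) L₂ Ψ≋ =
      cons ψ w (LinearFamily-++ {Ψ = λ c x → Ψ′ c x ⊕ Ψ₂ (c ∘ (m ℕ.+_)) x} L₁ L₂ (λ c x → S.refl))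
        (λ c x → S.trans (Ψ≋ c x) (S.trans (S.+-congʳ (Ψ₁≋ c x)) (S.+-assoc _ _ _)))

    LinearFamily-⊛ : ∀ {n Ψ Ψ′ Φ} → Weight d′ Φ → LinearFamily d n Ψ →
      (∀ c x → Ψ′ c x ≋ Φ x ⊛ Ψ c x) → LinearFamily (d′ ℕ.+ d) n Ψ′
    LinearFamily-⊛ wΦ (nil Ψ≋0) eq = nil (λ c x → S.trans (eq c x) (S.trans (S.*-congˡ (Ψ≋0 c x)) (S.zeroʳ _)))
    LinearFamily-⊛ {Φ = Φ} wΦ (cons {Ψ′ = Ψ″} ψ w L Ψ≋) eq =
      cons (λ x → Φ x ⊛ ψ x) (Weight-⊛ wΦ w) (LinearFamily-⊛ {Ψ′ = λ c x → Φ x ⊛ Ψ″ c x} wΦ L (λ c x → S.refl))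
        (λ c x → S.trans (eq c x) (S.trans (S.*-congˡ (Ψ≋ c x))
          (SS.solve 4 (λ f a p r → f SS.:* (a SS.:* p SS.:+ r) SS.:= a SS.:* (f SS.:* p) SS.:+ f SS.:* r) S.refl
            (Φ x) ⌜ c 0 ⌝ (ψ x) (Ψ″ (c ∘ suc) x))))
      where module SS = SeriesSolver

    LinearFamily-weaken : ∀ {n Ψ} → d ≤ d′ → LinearFamily d n Ψ → LinearFamily d′ n Ψ
    LinearFamily-weaken d≤d′ (nil z)        = nil z
    LinearFamily-weaken d≤d′ (cons ψ w L z) = cons ψ (Weight-weaken d≤d′ w) (LinearFamily-weaken d≤d′ L) z

    private
      -- A polynomial in x whose coefficients are linear forms in the unknowns, one row per
      -- coefficient.
      hornerRows : ∀ {m} → Vec (Vec F n) m → (ℕ → F) → F → F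
      hornerRows []           c x = 0#
      hornerRows (row ∷ rows) c x = dot row c + x * hornerRows rows c x

      hornerRows-[] : ∀ m c x → hornerRows (Vec.replicate m []) c x ≡ 0#
      hornerRows-[] zero    c x = refl
      hornerRows-[] (suc m) c x = trans (cong (λ z → 0# + x * z) (hornerRows-[] m c x)) (trans (+-identityˡ _) (zeroʳ x))

      hornerRows-∷ : ∀ {m} (as : Vec F m) (rows : Vec (Vec F n) m) c x →
        hornerRows (Vec.zipWith _∷_ as rows) c x ≡ c 0 * horner as x + hornerRows rows (c ∘ suc) x
      hornerRows-∷ []       []           c x = sym (trans (cong (_+ 0#) (zeroʳ (c 0))) (+-identityʳ 0#))
      hornerRows-∷ (a ∷ as) (row ∷ rows) c x =
        trans (cong (λ z → c 0 * a + dot row (c ∘ suc) + x * z) (hornerRows-∷ as rows c x))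
          (solve 6 (λ c a d x h r → c :* a :+ d :+ x :* (c :* h :+ r) := c :* (a :+ x :* h) :+ (d :+ x :* r)) refl _ _ _ _ _ _)

      hornerRows-0 : ∀ {m} (rows : Vec (Vec F n) m) c → All (λ row → dot row c ≡ 0#) (Vec.toList rows) →
        ∀ x → hornerRows rows c x ≡ 0#
      hornerRows-0 []           c []       x = refl
      hornerRows-0 (row ∷ rows) c (z ∷ zs) x =
        trans (cong₂ (λ y z → y + x * z) z (hornerRows-0 rows c zs x)) (trans (+-identityˡ _) (zeroʳ x))

      equations : ∀ {n Ψ} → LinearFamily d n Ψ → ∀ k →
        ∃ λ (rows : Vec (Vec F n) (suc (d ℕ.+ k ℕ.* e))) → ∀ c x → Ψ c x k ≡ hornerRows rows c x
      equations {d} (nil Ψ≋0) k = Vec.replicate _ [] , λ c x → trans (Ψ≋0 c x k) (sym (hornerRows-[] (suc (d ℕ.+ k ℕ.* e)) c x))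
      equations (cons ψ w L Ψ≋) k with coefficients (w k) | equations L k
      ... | as , ψ≡ | rows , Ψ′≡ = Vec.zipWith _∷_ as rows , λ c x → trans (Ψ≋ c x k) (trans
        (cong₂ _+_ (trans (⌜⌝-⊛ (c 0) (ψ x) k) (cong (c 0 *_) (ψ≡ x))) (Ψ′≡ (c ∘ suc) x))
        (sym (hornerRows-∷ as rows c x)))

      -- The coefficient of S^k has degree at most d + k e in x. Each k is charged with the count d
      -- + ℓ e + 1 of the largest order, which keeps the total a product.
      equationsUpTo : ∀ {n Ψ} → LinearFamily d n Ψ → ∀ m ℓ → m ≤ ℓ →
        ∃ λ (rows : List (Vec F n)) → length rows ≤ m ℕ.* suc (d ℕ.+ ℓ ℕ.* e) ×
          (∀ c → All (λ row → dot row c ≡ 0#) rows → ∀ x k → k < m → Ψ c x k ≡ 0#)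
      equationsUpTo L zero    ℓ _   = [] , z≤n , λ _ _ _ _ ()
      equationsUpTo {d} {Ψ = Ψ} L (suc m) ℓ m<ℓ with equations L m | equationsUpTo L m ℓ (ℕₚ.<⇒≤ m<ℓ)
      ... | rows , Ψ≡ | rows′ , len , sol = Vec.toList rows ++ rows′ , len′ , sol′
        where
        len′ : length (Vec.toList rows ++ rows′) ≤ suc m ℕ.* suc (d ℕ.+ ℓ ℕ.* e)
        len′ = ℕₚ.≤-trans (ℕₚ.≤-reflexive (trans (length-++ (Vec.toList rows)) (cong (ℕ._+ length rows′) (Vecₚ.length-toList rows))))
          (ℕₚ.+-mono-≤ (s≤s (ℕₚ.+-monoʳ-≤ d (ℕₚ.*-monoˡ-≤ e (ℕₚ.<⇒≤ m<ℓ)))) len)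
        sol′ : ∀ c → All (λ row → dot row c ≡ 0#) (Vec.toList rows ++ rows′) → ∀ x k → k < suc m → Ψ c x k ≡ 0#
        sol′ c zs x k k<1+m with ℕₚ.m≤n⇒m<n∨m≡n (ℕₚ.≤-pred k<1+m)
        ... | inj₁ k<m  = sol c (Allₚ.++⁻ʳ (Vec.toList rows) zs) x k k<m
        ... | inj₂ refl = trans (Ψ≡ c x) (hornerRows-0 rows c (Allₚ.++⁻ˡ (Vec.toList rows) zs) x)

    -- The heart of the method: the coefficients of S^k are made to vanish as polynomials in x, so
    -- the number of conditions does not depend on how many points x are to become zeros.
    nontrivial-solution : ∀ {n Ψ} → LinearFamily d n Ψ → ∀ ℓ → ℓ ℕ.* suc (d ℕ.+ ℓ ℕ.* e) < n →
      ∃ λ (c : ℕ → F) → (∃ λ i → i < n × c i ≢ 0#) × ∀ x → Ψ c x ≋[ ℓ ] 𝟘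
    nontrivial-solution {n = n} L ℓ few with equationsUpTo L ℓ ℓ ℕₚ.≤-refl
    ... | rows , len , sol with kernel n rows (ℕₚ.≤-<-trans len few)
    ... | c , c≢0 , zs = c , c≢0 , sol c zs

-- Degrees of power series.

module Degree {q : ℕ} (K : FiniteField q) where
  open FieldFacts K
  open PowerSeries K
  open Polynomials K
  open EvS using () renaming (ev to evˢ)

  Deg< : ℕ → Series → Set
  Deg< n f = ∀ i → n ≤ i → f i ≡ 0#

  private variable
    m n : ℕ
    f g : Series

  Deg<-0 : Deg< 0 f → f ≋ 𝟘
  Deg<-0 d i = d i z≤n

  Deg<-weaken : m ≤ n → Deg< m f → Deg< n f
  Deg<-weaken m≤n d i n≤i = d i (ℕₚ.≤-trans m≤n n≤i)

  Deg<-⊕ : Deg< n f → Deg< n g → Deg< n (f ⊕ g)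
  Deg<-⊕ d d′ i n≤i = trans (cong₂ _+_ (d i n≤i) (d′ i n≤i)) (+-identityˡ 0#)

  Deg<-⌜⌝ : ∀ a → Deg< 1 ⌜ a ⌝
  Deg<-⌜⌝ a (suc i) _ = refl

  Deg<-⊛ : ∀ m {n f g} → Deg< m f → Deg< n g → Deg< (m ℕ.+ n) (f ⊛ g)
  Deg<-⊛ zero {f = f} {g} d d′ i _ = trans (⊛-cong {f} {𝟘} {g} {g} (Deg<-0 d) S.refl i) (⊛-zeroˡ g i)
  Deg<-⊛ (suc m) {n} d d′ (suc i) (s≤s m+n≤i) = trans (cong₂ _+_
    (trans (cong (_ *_) (d′ (suc i) (ℕₚ.m≤n⇒m≤1+n (ℕₚ.≤-trans (ℕₚ.m≤n+m n m) m+n≤i)))) (zeroʳ _))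
    (Deg<-⊛ m (λ j m≤j → d (suc j) (s≤s m≤j)) d′ i m+n≤i)) (+-identityˡ 0#)

  Deg<-ev : ∀ r → Deg< (length r) (evˢ r X)
  Deg<-ev []      i       _         = refl
  Deg<-ev (a ∷ r) (suc i) (s≤s n≤i) = trans (+-identityˡ _) (trans (X⊛-suc (evˢ r X) i) (Deg<-ev r i n≤i))

  Deg<-≋[] : Deg< n f → Deg< n g → f ≋[ n ] g → f ≋ g
  Deg<-≋[] {n} d d′ e i with i ℕₚ.<? n
  ... | yes i<n = e i i<n
  ... | no  i≮n = trans (d i (ℕₚ.≮⇒≥ i≮n)) (sym (d′ i (ℕₚ.≮⇒≥ i≮n)))

-- Stepanov's auxiliary polynomial.

module Stepanov {q : ℕ} (K : FiniteField q) where
  open FieldFacts K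
  open PowerSeries K
  open Polynomials K
  open PolynomialFunctions K
  open Degree K
  open EvF using (ev)
  open EvS using (ev-addL; ev-mulL; ev-powL; ev-shiftL) renaming (ev to evˢ)
  open SeriesSolver

  coeffList : ℕ → (ℕ → F) → List F
  coeffList zero    c = []
  coeffList (suc n) c = c 0 ∷ coeffList n (c ∘ suc)

  length-coeffList : ∀ n c → length (coeffList n c) ≡ n
  length-coeffList zero    c = refl
  length-coeffList (suc n) c = cong suc (length-coeffList n (c ∘ suc))

  ev-coeffList : ∀ n c i → i < n → evˢ (coeffList n c) X i ≡ c i
  ev-coeffList (suc n) c zero    _         = trans (cong (c 0 +_) (X⊛-zero (evˢ (coeffList n (c ∘ suc)) X))) (+-identityʳ _)
  ev-coeffList (suc n) c (suc i) (s≤s i<n) = trans (+-identityˡ _)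
    (trans (X⊛-suc (evˢ (coeffList n (c ∘ suc)) X) i) (ev-coeffList n (c ∘ suc) i i<n))

  Deg<-coeffList : ∀ n c → Deg< n (evˢ (coeffList n c) X)
  Deg<-coeffList n c = subst (λ m → Deg< m (evˢ (coeffList n c) X)) (length-coeffList n c) (Deg<-ev (coeffList n c))

  PolyFun-ev : ∀ {d} r → length r ≤ suc d → PolyFun d (ev r)
  PolyFun-ev         []          _  = const 0# (λ _ → refl)
  PolyFun-ev         (a ∷ [])    _  = const a (λ x → trans (cong (a +_) (zeroʳ x)) (+-identityʳ a))
  PolyFun-ev {suc d} (a ∷ b ∷ r) (s≤s r≤) = step a (PolyFun-ev (b ∷ r) r≤) (λ _ → refl)

  -- For f(0) ≠ 0 this says that f is not f(0) times the square of a rational function with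
  -- numerator and denominator of degree below R. The constant f(0) is what f^q leaves modulo X^q.
  NotSquare : ℕ → Series → Set
  NotSquare R f = ∀ r s → Deg< R r → Deg< R s → r ⊛ r ⊛ f ≋ s ⊛ s ⊛ ⌜ f 0 ⌝ → r ≋ 𝟘 × s ≋ 𝟘

  module _ {p n : ℕ} (pr : Prime p) (q≡pⁿ : q ≡ p ℕ.^ n)
    (e h R : ℕ) (q≡1+2h : q ≡ suc (h ℕ.+ h)) (small : R ℕ.+ R ℕ.+ suc (suc e) ≤ q)
    (f : List F) (len-f : length f ≤ suc (suc e)) (f-notSquare : NotSquare R (evˢ f X))
    (a : F) where
    open Weighted e

    private
      γ : F → F
      γ = ev f

      y : F → Series
      y x = line x (γ x)

      -- The difference quotient of r along the line: r(x + f(x) S) = r(x) + f(x) S · D, as `taylor`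
      -- shows. In expansions at a point x the series `X` plays the part of S.
      D : List F → F → Series
      D []      x = 𝟘
      D (b ∷ r) x = ⌜ ev r x ⌝ ⊕ y x ⊛ D r x

      unit : F → Series
      unit x = 𝟙 ⊕ X ⊛ D f x

      taylor : ∀ r x → evˢ r (y x) ≋ ⌜ ev r x ⌝ ⊕ ⌜ γ x ⌝ ⊛ X ⊛ D r x
      taylor []      x = S.sym (S.trans (S.+-cong ⌜⌝-0 (S.zeroʳ _)) (S.+-identityˡ _))
      taylor (b ∷ r) x = begin
        ⌜ b ⌝ ⊕ y x ⊛ evˢ r (y x)
          ≈⟨ S.+-congˡ {⌜ b ⌝} (S.*-congˡ {y x} (taylor r x)) ⟩
        ⌜ b ⌝ ⊕ (⌜ x ⌝ ⊕ ⌜ γ x ⌝ ⊛ X) ⊛ (⌜ ev r x ⌝ ⊕ ⌜ γ x ⌝ ⊛ X ⊛ D r x)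
          ≈⟨ solve 6 (λ b x g X v D → b :+ (x :+ g :* X) :* (v :+ g :* X :* D)
               := (b :+ x :* v) :+ g :* X :* (v :+ (x :+ g :* X) :* D)) S.refl
               ⌜ b ⌝ ⌜ x ⌝ ⌜ γ x ⌝ X ⌜ ev r x ⌝ (D r x) ⟩
        (⌜ b ⌝ ⊕ ⌜ x ⌝ ⊛ ⌜ ev r x ⌝) ⊕ ⌜ γ x ⌝ ⊛ X ⊛ (⌜ ev r x ⌝ ⊕ y x ⊛ D r x)
          ≈⟨ S.+-congʳ {⌜ γ x ⌝ ⊛ X ⊛ D (b ∷ r) x} (S.trans (⌜⌝-+ b (x * ev r x)) (S.+-congˡ {⌜ b ⌝} (⌜⌝-* x (ev r x)))) ⟨
        ⌜ b + x * ev r x ⌝ ⊕ ⌜ γ x ⌝ ⊛ X ⊛ D (b ∷ r) x ∎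
        where open ≋-Reasoning

      -- This is the gain from the step f(x) S: raised to the power h, the first factor becomes
      -- f(x)^h = a.
      factor : ∀ x → evˢ f (y x) ≋ ⌜ γ x ⌝ ⊛ unit x
      factor x = S.trans (taylor f x) (solve 3 (λ g X D → g :+ g :* X :* D := g :* (con (ℤ.+ 1) :+ X :* D)) S.refl
        ⌜ γ x ⌝ X (D f x))

      Weight-y : Weight 1 y
      Weight-y = Weight-⊕ (Weight-⌜⌝ PolyFun-x) (Weight-cong (λ x → ⌜⌝-⊛ (γ x) X) w)
        where
        w : Weight 1 (λ x i → γ x * X i)
        w zero          = const 0# (λ x → zeroʳ (γ x))
        w (suc zero)    = PolyFun-cong (λ x → *-identityʳ (γ x))
          (PolyFun-ev f (ℕₚ.≤-trans len-f (s≤s (s≤s (ℕₚ.≤-reflexive (sym (ℕₚ.+-identityʳ e)))))))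
        w (suc (suc k)) = const 0# (λ x → zeroʳ (γ x))

      Weight-𝟘 : ∀ {d Ψ} → (∀ x → Ψ x ≋ 𝟘) → Weight d Ψ
      Weight-𝟘 Ψ≋0 k = const 0# (λ x → Ψ≋0 x k)

      D-singleton : ∀ b x → D (b ∷ []) x ≋ 𝟘
      D-singleton b x = S.trans (S.+-cong ⌜⌝-0 (S.zeroʳ (y x))) (S.+-identityˡ 𝟘)

      Weight-D : ∀ d r → length r ≤ suc (suc d) → Weight d (D r)
      Weight-D d       []          _ = Weight-𝟘 (λ x → S.refl)
      Weight-D d       (b ∷ [])    _ = Weight-𝟘 (D-singleton b)
      Weight-D zero    (b ∷ b′ ∷ []) _ = Weight-⊕ (Weight-⌜⌝ (PolyFun-ev (b′ ∷ []) (s≤s z≤n)))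
        (Weight-𝟘 (λ x → S.trans (S.*-congˡ {y x} (D-singleton b′ x)) (S.zeroʳ (y x))))
      Weight-D zero    (b ∷ b′ ∷ b″ ∷ r) (s≤s (s≤s ()))
      Weight-D (suc d) (b ∷ b′ ∷ r) (s≤s r≤) = Weight-⊕ (Weight-⌜⌝ (PolyFun-ev (b′ ∷ r) r≤))
        (Weight-⊛ Weight-y (Weight-D d (b′ ∷ r) r≤))

      -- `D f` has weight e, and the factor S in front of it moves every coefficient one order up,
      -- which brings the weight down to 0. Powers of a series of weight 0 again have weight 0,
      -- whatever the exponent.
      Weight-unit : Weight 0 unit
      Weight-unit = Weight-⊕ (Weight-⌜⌝ (const 1# (λ _ → refl))) w
        where
        w : Weight 0 (λ x → X ⊛ D f x)
        w zero    = const 0# (λ x → X⊛-zero (D f x))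
        w (suc k) = PolyFun-cong (λ x → X⊛-suc (D f x) k) (Weight-D e f len-f k)

      G : F → Series
      G x = ⌜ a ⌝ ⊛ unit x ^ˢ h

      Weight-G : Weight 0 G
      Weight-G = Weight-⊛ (Weight-⌜⌝ (const a (λ _ → refl))) (Weight-^ Weight-unit h)

      -- P(x + f(x) S) mod S^ℓ at a point x with f(x)^h = a, where P is the polynomial defined below.
      T : ℕ → (ℕ → F) → F → Series
      T zero    c x = 𝟘
      T (suc J) c x = (evˢ (coeffList R c) (y x) ⊕ G x ⊛ evˢ (coeffList R (c ∘ (R ℕ.+_))) (y x))
        ⊕ ⌜ x ⌝ ⊛ T J (c ∘ (R ℕ.+ R ℕ.+_)) x

      family-ev : ∀ n → LinearFamily n n (λ c x → evˢ (coeffList n c) (y x))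
      family-ev zero    = nil (λ c x → S.refl)
      family-ev (suc n) = cons {Ψ′ = λ c x → y x ⊛ evˢ (coeffList n c) (y x)} (λ _ → 𝟙) (Weight-⌜⌝ (const 1# (λ _ → refl)))
        (LinearFamily-⊛ Weight-y (family-ev n) (λ c x → S.refl))
        (λ c x → S.+-congʳ {y x ⊛ evˢ (coeffList n (c ∘ suc)) (y x)} (S.sym (S.*-identityʳ ⌜ c 0 ⌝)))

      family-block : LinearFamily R (R ℕ.+ R) (λ c x → evˢ (coeffList R c) (y x) ⊕ G x ⊛ evˢ (coeffList R (c ∘ (R ℕ.+_))) (y x))
      family-block = LinearFamily-++ {Ψ₂ = λ c x → G x ⊛ evˢ (coeffList R c) (y x)}
        (family-ev R) (LinearFamily-⊛ Weight-G (family-ev R) (λ c x → S.refl)) (λ c x → S.refl)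

      -- R bounds the weight contributed by the polynomials r_j and s_j; every further block adds
      -- one factor x.
      family : ∀ J → LinearFamily (R ℕ.+ J) (J ℕ.* (R ℕ.+ R)) (T J)
      family zero    = nil (λ c x → S.refl)
      family (suc J) = LinearFamily-++ {Ψ₂ = λ c x → ⌜ x ⌝ ⊛ T J c x}
        (LinearFamily-weaken (ℕₚ.m≤m+n R (suc J)) family-block)
        (LinearFamily-weaken (ℕₚ.≤-reflexive (sym (ℕₚ.+-suc R J)))
          (LinearFamily-⊛ (Weight-⌜⌝ PolyFun-x) (family J) (λ c x → S.refl)))
        (λ c x → S.refl)

      -- Each block of 2 R unknowns holds the coefficients of r_j, then those of s_j. The nesting by
      -- `shiftL q` matches that of `T`, where X^q has turned into x.
      P : ℕ → (ℕ → F) → List F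
      P zero    c = []
      P (suc J) c = addL (addL (coeffList R c) (mulL (powL f h) (coeffList R (c ∘ (R ℕ.+_)))))
        (shiftL q (P J (c ∘ (R ℕ.+ R ℕ.+_))))

      length-P : ∀ J c → length (P J c) ≤ suc (h ℕ.* suc e ℕ.+ R) ℕ.+ J ℕ.* q
      length-P zero    c = z≤n
      length-P (suc J) c = length-addL (addL r gs) (shiftL q (P J _))
        (ℕₚ.≤-trans (length-addL r gs
          (ℕₚ.≤-trans (ℕₚ.≤-reflexive (length-coeffList R c)) (ℕₚ.m≤n⇒m≤1+n (ℕₚ.m≤n+m R (h ℕ.* suc e))))
          (length-mulL (powL f h) (coeffList R _) (length-powL f len-f h)
            (ℕₚ.m≤n⇒m≤1+n (ℕₚ.≤-reflexive (length-coeffList R _)))))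
          (ℕₚ.m≤m+n L (suc J ℕ.* q)))
        (ℕₚ.≤-trans (ℕₚ.≤-reflexive (length-shiftL q (P J _)))
          (ℕₚ.≤-trans (ℕₚ.+-monoʳ-≤ q (length-P J _)) (ℕₚ.≤-reflexive eq)))
        where
        L : ℕ
        L = suc (h ℕ.* suc e ℕ.+ R)
        r gs : List F
        r = coeffList R c
        gs = mulL (powL f h) (coeffList R (c ∘ (R ℕ.+_)))
        eq : q ℕ.+ (L ℕ.+ J ℕ.* q) ≡ L ℕ.+ (q ℕ.+ J ℕ.* q)
        eq = trans (sym (ℕₚ.+-assoc q L _)) (trans (cong (ℕ._+ J ℕ.* q) (ℕₚ.+-comm q L)) (ℕₚ.+-assoc L q _))

      ev-P : ∀ J c z → evˢ (P (suc J) c) z ≋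
        (evˢ (coeffList R c) z ⊕ evˢ f z ^ˢ h ⊛ evˢ (coeffList R (c ∘ (R ℕ.+_))) z)
          ⊕ z ^ˢ q ⊛ evˢ (P J (c ∘ (R ℕ.+ R ℕ.+_))) z
      ev-P J c z = S.trans (ev-addL (addL r (mulL g s)) (shiftL q P′) z)
        (S.+-cong (S.trans (ev-addL r (mulL g s) z) (S.+-congˡ {evˢ r z} (S.trans (ev-mulL g s z) (S.*-congʳ {evˢ s z} (ev-powL f h z)))))
                  (ev-shiftL q P′ z))
        where
        r s g P′ : List F
        r  = coeffList R c
        s  = coeffList R (c ∘ (R ℕ.+_))
        g  = powL f h
        P′ = P J (c ∘ (R ℕ.+ R ℕ.+_))

      -- Modulo S^q the power (x + f(x) S)^q is the constant x, so X^(qj) contributes only degree j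
      -- in x; and f^h is a times a power of `unit`.
      truncate : ∀ {ℓ} → ℓ ≤ q → ∀ x → γ x ^ h ≡ a → ∀ J c → evˢ (P J c) (y x) ≋[ ℓ ] T J c x
      truncate ℓ≤q x γʰ≡a zero    c i _ = refl
      truncate {ℓ} ℓ≤q x γʰ≡a (suc J) c = ≋[]-trans (≋⇒≋[] (ev-P J c (y x)))
        (≋[]-⊕ (≋⇒≋[] (S.+-congˡ {evˢ (coeffList R c) (y x)} (S.*-congʳ {evˢ (coeffList R (c ∘ (R ℕ.+_))) (y x)} gʰ)))
               (⊛-cong[] ℓ (≋[]-trans (≋[]-weaken ℓ≤q (^q-constant pr n q≡pⁿ (y x))) (≋⇒≋[] (⌜⌝-cong y0)))
                           (truncate ℓ≤q x γʰ≡a J (c ∘ (R ℕ.+ R ℕ.+_)))))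
        where
        y0 : y x 0 ≡ x
        y0 = trans (cong (x +_) (zeroʳ (γ x))) (+-identityʳ x)
        gʰ : evˢ f (y x) ^ˢ h ≋ G x
        gʰ = S.trans (^ˢ-cong h (factor x)) (S.trans (^ˢ-distrib-⊛ ⌜ γ x ⌝ (unit x) h)
          (S.*-congʳ {unit x ^ˢ h} (S.trans (S.sym (⌜⌝-^ (γ x) h)) (⌜⌝-cong γʰ≡a))))

      fX : Series
      fX = evˢ f X

      -- If r + s f^h ≡ 0 mod X^q, squaring gives r² f ≡ s² f^q ≡ s² f(0), an equality by degrees.
      independent : ∀ r s → Deg< R r → Deg< R s → r ⊕ fX ^ˢ h ⊛ s ≋[ q ] 𝟘 → r ≋ 𝟘 × s ≋ 𝟘
      independent r s dr ds rel = f-notSquare r s dr ds (Deg<-≋[] degˡ degʳ congruent)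
        where
        g : Series
        g = fX ^ˢ h
        degˡ : Deg< q (r ⊛ r ⊛ fX)
        degˡ = Deg<-weaken small (Deg<-⊛ (R ℕ.+ R) (Deg<-⊛ R dr dr) (Deg<-weaken len-f (Deg<-ev f)))
        degʳ : Deg< q (s ⊛ s ⊛ ⌜ fX 0 ⌝)
        degʳ = Deg<-weaken (ℕₚ.≤-trans (ℕₚ.+-monoʳ-≤ (R ℕ.+ R) (s≤s z≤n)) small)
          (Deg<-⊛ (R ℕ.+ R) (Deg<-⊛ R ds ds) (Deg<-⌜⌝ (fX 0)))
        r≋ : r ≋[ q ] ⊝ (g ⊛ s)
        r≋ i i<q = x-y≡0⇒x≡y (trans (cong (r i +_) (-‿involutive _)) (rel i i<q))
        ggf : g ⊛ g ⊛ fX ≋[ q ] ⌜ fX 0 ⌝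
        ggf = ≋[]-trans (≋⇒≋[] (S.trans (S.*-comm (g ⊛ g) fX) (S.*-congˡ {fX} (S.sym (^ˢ-homo-⊛ fX h h)))))
          (subst (λ m → fX ^ˢ m ≋[ q ] ⌜ fX 0 ⌝) q≡1+2h (^q-constant pr n q≡pⁿ fX))
        congruent : r ⊛ r ⊛ fX ≋[ q ] s ⊛ s ⊛ ⌜ fX 0 ⌝
        congruent = ≋[]-trans (⊛-cong[] q (⊛-cong[] q r≋ r≋) (≋⇒≋[] S.refl))
          (≋[]-trans (≋⇒≋[] (solve 3 (λ g s f → (:- (g :* s)) :* (:- (g :* s)) :* f := s :* s :* (g :* g :* f)) S.refl g s fX))
            (⊛-cong[] q (≋⇒≋[] S.refl) ggf))

      -- Blocks are peeled off from the bottom: modulo X^q only r₀ + s₀ f^h is visible, and once it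
      -- is zero the rest is X^q times a polynomial of the same shape.
      P≋0⇒c≡0 : ∀ J c → evˢ (P J c) X ≋ 𝟘 → ∀ i → i < J ℕ.* (R ℕ.+ R) → c i ≡ 0#
      P≋0⇒c≡0 (suc J) c P≋0 = conclude
        where
        r s P′ : Series
        r  = evˢ (coeffList R c) X
        s  = evˢ (coeffList R (c ∘ (R ℕ.+_))) X
        P′ = evˢ (P J (c ∘ (R ℕ.+ R ℕ.+_))) X
        low : r ⊕ fX ^ˢ h ⊛ s ≋[ q ] 𝟘
        low i i<q = begin
          (r ⊕ fX ^ˢ h ⊛ s) i                      ≡⟨ +-identityʳ _ ⟨
          (r ⊕ fX ^ˢ h ⊛ s) i + 0#                 ≡⟨ cong ((r ⊕ fX ^ˢ h ⊛ s) i +_) (X^-low q P′ i i<q) ⟨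
          (r ⊕ fX ^ˢ h ⊛ s) i + (X ^ˢ q ⊛ P′) i    ≡⟨ ev-P J c X i ⟨
          evˢ (P (suc J) c) X i                    ≡⟨ P≋0 i ⟩
          0#                                       ∎
          where open ≡-Reasoning
        rs≋0 : r ≋ 𝟘 × s ≋ 𝟘
        rs≋0 = independent r s (Deg<-coeffList R c) (Deg<-coeffList R (c ∘ (R ℕ.+_))) low
        P′≋0 : P′ ≋ 𝟘
        P′≋0 i = begin
          P′ i                                     ≡⟨ X^-shift q P′ i ⟨
          (X ^ˢ q ⊛ P′) (q ℕ.+ i)                  ≡⟨ +-identityˡ _ ⟨
          0# + (X ^ˢ q ⊛ P′) (q ℕ.+ i)             ≡⟨ cong (_+ (X ^ˢ q ⊛ P′) (q ℕ.+ i)) (block≋0 (q ℕ.+ i)) ⟨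
          (r ⊕ fX ^ˢ h ⊛ s) (q ℕ.+ i) + (X ^ˢ q ⊛ P′) (q ℕ.+ i) ≡⟨ ev-P J c X (q ℕ.+ i) ⟨
          evˢ (P (suc J) c) X (q ℕ.+ i)            ≡⟨ P≋0 (q ℕ.+ i) ⟩
          0#                                       ∎
          where
          open ≡-Reasoning
          block≋0 : r ⊕ fX ^ˢ h ⊛ s ≋ 𝟘
          block≋0 = S.trans (S.+-cong (proj₁ rs≋0) (S.trans (S.*-congˡ {fX ^ˢ h} (proj₂ rs≋0)) (S.zeroʳ (fX ^ˢ h)))) (S.+-identityˡ 𝟘)
        conclude : ∀ i → i < R ℕ.+ R ℕ.+ J ℕ.* (R ℕ.+ R) → c i ≡ 0#
        conclude i i<n with i ℕₚ.<? R ℕ.+ R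
        ... | no i≮2R = subst (λ j → c j ≡ 0#) (ℕₚ.m+[n∸m]≡n 2R≤i)
          (P≋0⇒c≡0 J (c ∘ (R ℕ.+ R ℕ.+_)) P′≋0 (i ℕ.∸ (R ℕ.+ R))
            (ℕₚ.+-cancelˡ-< (R ℕ.+ R) _ _ (subst (_< R ℕ.+ R ℕ.+ J ℕ.* (R ℕ.+ R)) (sym (ℕₚ.m+[n∸m]≡n 2R≤i)) i<n)))
          where
          2R≤i : R ℕ.+ R ≤ i
          2R≤i = ℕₚ.≮⇒≥ i≮2R
        ... | yes i<2R with i ℕₚ.<? R
        ...   | yes i<R = trans (sym (ev-coeffList R c i i<R)) (proj₁ rs≋0 i)
        ...   | no  i≮R = subst (λ j → c j ≡ 0#) (ℕₚ.m+[n∸m]≡n R≤i)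
          (trans (sym (ev-coeffList R (c ∘ (R ℕ.+_)) (i ℕ.∸ R)
            (ℕₚ.+-cancelˡ-< R _ _ (subst (_< R ℕ.+ R) (sym (ℕₚ.m+[n∸m]≡n R≤i)) i<2R)))) (proj₂ rs≋0 (i ℕ.∸ R)))
          where
          R≤i : R ≤ i
          R≤i = ℕₚ.≮⇒≥ i≮R

    -- A nonzero choice of unknowns makes P vanish to order ℓ at all the points; if their number
    -- times ℓ exceeded the length of P, then P and hence all unknowns would be zero.
    stepanov : ∀ ℓ J → ℓ ≤ q → ℓ ℕ.* suc (R ℕ.+ J ℕ.+ ℓ ℕ.* e) < J ℕ.* (R ℕ.+ R) →
      ∀ xs → Unique xs → All (λ x → ev f x ≢ 0# × ev f x ^ h ≡ a) xs →
      length xs ℕ.* ℓ ≤ suc (h ℕ.* suc e ℕ.+ R) ℕ.+ J ℕ.* q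
    stepanov ℓ J ℓ≤q few [] _ _ = z≤n
    stepanov ℓ J ℓ≤q few (x ∷ xs) uniq good with nontrivial-solution (family J) ℓ few
    ... | c , (i , i<n , ci≢0) , T≋0 with ℕₚ.≤-total (length (x ∷ xs) ℕ.* ℓ) (suc (h ℕ.* suc e ℕ.+ R) ℕ.+ J ℕ.* q)
    ...   | inj₁ ≤L = ≤L
    ...   | inj₂ L≤ = contradiction (P≋0⇒c≡0 J c P≋0 i i<n) ci≢0
      where
      vanish : ∀ {z} → ev f z ≢ 0# × ev f z ^ h ≡ a → VanishesAt (P J c) (ev f) ℓ z
      vanish {z} (_ , γʰ≡a) = ≋[]-trans (truncate ℓ≤q z γʰ≡a J c) (T≋0 z)
      P≋0 : evˢ (P J c) X ≋ 𝟘
      P≋0 = vanish-everywhere (ev f) ℓ _ (P J c) refl ℓ x xs (All.map proj₁ good) uniq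
        (vanish (All.head good)) (All.map vanish (All.tail good)) (ℕₚ.≤-trans (length-P J c) L≤)

-- Divisibility by a separable quadratic, and the descent.

module QuadraticFactors {q : ℕ} (K : FiniteField q) where
  open FieldFacts K
  open PowerSeries K
  open Polynomials K
  open Degree K
  open Stepanov K using (NotSquare)
  open EvS using () renaming (ev to evˢ)
  open SeriesSolver

  IsPoly : Series → Set
  IsPoly f = ∃ λ n → Deg< n f

  private variable
    f g : Series

  IsPoly-⊕ : IsPoly f → IsPoly g → IsPoly (f ⊕ g)
  IsPoly-⊕ (m , df) (n , dg) = m ℕ.+ n , Deg<-⊕ (Deg<-weaken (ℕₚ.m≤m+n m n) df) (Deg<-weaken (ℕₚ.m≤n+m n m) dg)

  IsPoly-⊛ : IsPoly f → IsPoly g → IsPoly (f ⊛ g)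
  IsPoly-⊛ (m , df) (n , dg) = m ℕ.+ n , Deg<-⊛ m df dg

  IsPoly-⊝ : IsPoly f → IsPoly (⊝ f)
  IsPoly-⊝ (n , df) = n , λ i n≤i → trans (cong -_ (df i n≤i)) -0#≈0#

  IsPoly-⌜⌝ : ∀ a → IsPoly ⌜ a ⌝
  IsPoly-⌜⌝ a = 1 , Deg<-⌜⌝ a

  IsPoly-X : IsPoly X
  IsPoly-X = 2 , λ { (suc zero) (s≤s ()) ; (suc (suc i)) _ → refl }

  IsPoly-line : ∀ a b → IsPoly (line a b)
  IsPoly-line a b = IsPoly-⊕ (IsPoly-⌜⌝ a) (IsPoly-⊛ (IsPoly-⌜⌝ b) IsPoly-X)

  ⌜⌝-- : ∀ a → ⌜ - a ⌝ ≋ ⊝ ⌜ a ⌝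
  ⌜⌝-- a zero    = refl
  ⌜⌝-- a (suc i) = sym -0#≈0#

  module Quadratic (q₀ q₁ q₂ : F) (q₂≢0 : q₂ ≢ 0#) where

    Q : Series
    Q = evˢ (q₀ ∷ q₁ ∷ q₂ ∷ []) X

    IsPoly-Q : IsPoly Q
    IsPoly-Q = 3 , Deg<-ev (q₀ ∷ q₁ ∷ q₂ ∷ [])

    Q-0 : ∀ w → (Q ⊛ w) 0 ≡ q₀ * w 0
    Q-0 w = cong (_* w 0) (trans (cong (q₀ +_) (X⊛-zero (evˢ (q₁ ∷ q₂ ∷ []) X))) (+-identityʳ q₀))

    Q-suc : ∀ w i → (Q ⊛ w) (suc i) ≡ q₀ * w (suc i) + (evˢ (q₁ ∷ q₂ ∷ []) X ⊛ w) i
    Q-suc w i = trans (⊛-distribʳ w ⌜ q₀ ⌝ (X ⊛ Q′) (suc i)) (cong₂ _+_ (⌜⌝-⊛ q₀ w (suc i))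
      (trans (⊛-assoc X Q′ w (suc i)) (X⊛-suc (Q′ ⊛ w) i)))
      where
      Q′ : Series
      Q′ = evˢ (q₁ ∷ q₂ ∷ []) X

    private
      evˢ-line : evˢ (q₁ ∷ q₂ ∷ []) X ≋ line q₁ q₂
      evˢ-line = solve 3 (λ a b x → a :+ x :* (b :+ x :* con (ℤ.+ 0)) := a :+ b :* x) S.refl ⌜ q₁ ⌝ ⌜ q₂ ⌝ X

    Q-1 : ∀ w → (Q ⊛ w) 1 ≡ q₀ * w 1 + q₁ * w 0
    Q-1 w = trans (Q-suc w 0) (cong (q₀ * w 1 +_) (trans (⊛-cong {g = w} evˢ-line S.refl 0) (line-⊛-zero q₁ q₂ w)))

    Q-2+ : ∀ w i → (Q ⊛ w) (suc (suc i)) ≡ q₀ * w (suc (suc i)) + (q₁ * w (suc i) + q₂ * w i)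
    Q-2+ w i = trans (Q-suc w (suc i)) (cong (q₀ * w (suc (suc i)) +_)
      (trans (⊛-cong {g = w} evˢ-line S.refl (suc i)) (line-⊛-suc q₁ q₂ w i)))

    -- If w_n is the top coefficient of w, then q₂ w_n is that of Q w; so the top terms of w are
    -- shown to vanish one after the other.
    Deg<-quotient : ∀ {w} k → IsPoly w → Deg< (suc (suc k)) (Q ⊛ w) → Deg< k w
    Deg<-quotient {w} k (n , dw) dQw = go n dw
      where
      go : ∀ n → Deg< n w → Deg< k w
      go zero    d = Deg<-weaken z≤n d
      go (suc n) d with suc n ℕₚ.≤? k
      ... | yes 1+n≤k = Deg<-weaken 1+n≤k d
      ... | no  1+n≰k = go n d′
        where
        k≤n : k ≤ n
        k≤n = ℕₚ.≤-pred (ℕₚ.≰⇒> 1+n≰k)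
        top : q₂ * w n ≡ 0#
        top = begin
          q₂ * w n ≡⟨ Solver.solve 3 (λ a b c → c Solver.:= a Solver.:* Solver.con (ℤ.+ 0) Solver.:+ (b Solver.:* Solver.con (ℤ.+ 0) Solver.:+ c)) refl q₀ q₁ (q₂ * w n) ⟩
          q₀ * 0# + (q₁ * 0# + q₂ * w n) ≡⟨ cong₂ (λ x y → q₀ * x + (q₁ * y + q₂ * w n)) (d (suc (suc n)) (ℕₚ.n≤1+n _)) (d (suc n) ℕₚ.≤-refl) ⟨
          q₀ * w (suc (suc n)) + (q₁ * w (suc n) + q₂ * w n)      ≡⟨ Q-2+ w n ⟨
          (Q ⊛ w) (suc (suc n))                                   ≡⟨ dQw (suc (suc n)) (s≤s (s≤s k≤n)) ⟩
          0#                                                      ∎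
          where open ≡-Reasoning
        d′ : Deg< n w
        d′ i n≤i with ℕₚ.m≤n⇒m<n∨m≡n n≤i
        ... | inj₁ n<i  = d i n<i
        ... | inj₂ refl = *-cancelˡ-0 q₂≢0 top

    -- Q (f - g) = 0 has degree below 2, hence f - g has degree below 0.
    Q-cancel : IsPoly f → IsPoly g → Q ⊛ f ≋ Q ⊛ g → f ≋ g
    Q-cancel {f} {g} pf pg e i = x-y≡0⇒x≡y (Deg<-quotient {f ⊕ ⊝ g} 0 (IsPoly-⊕ pf (IsPoly-⊝ pg)) zero′ i z≤n)
      where
      zero′ : Deg< 2 (Q ⊛ (f ⊕ ⊝ g))
      zero′ j _ = trans (solve 3 (λ Q f g → Q :* (f :- g) := Q :* f :- Q :* g) S.refl Q f g j) (x≡y⇒x-y≡0 (e j))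

    Divides : Series → Set
    Divides f = ∃ λ w → IsPoly w × f ≋ Q ⊛ w

    divMod : ∀ n → Deg< n f → ∃ λ t → ∃ λ a → ∃ λ b → IsPoly t × f ≋ Q ⊛ t ⊕ line a b
    divMod {f} zero d = 𝟘 , 0# , 0# , (0 , λ _ _ → refl) , S.trans (Deg<-0 d) (S.sym
      (S.trans (S.+-cong (S.zeroʳ Q) (S.trans (S.+-cong ⌜⌝-0 (S.trans (S.*-congʳ {X} ⌜⌝-0) (S.zeroˡ X))) (S.+-identityˡ 𝟘))) (S.+-identityˡ 𝟘)))
    divMod {f} (suc n) d with divMod {f ∘ suc} n (λ i n≤i → d (suc i) (s≤s n≤i))
    ... | t , a , b , pt , f≋ = X ⊛ t ⊕ ⌜ k ⌝ , f 0 - k * q₀ , a - k * q₁ , IsPoly-⊕ (IsPoly-⊛ IsPoly-X pt) (IsPoly-⌜⌝ k) , (begin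
        f                                                        ≈⟨ X-unfold f ⟩
        ⌜ f 0 ⌝ ⊕ X ⊛ (f ∘ suc) ≈⟨ S.+-congˡ {⌜ f 0 ⌝} (S.*-congˡ {X} (S.trans f≋ (S.+-congˡ {Q ⊛ t} (S.+-congˡ {⌜ a ⌝} (S.*-congʳ {X} (S.trans (⌜⌝-cong (sym kq₂≡b)) (⌜⌝-* k q₂))))))) ⟩
        ⌜ f 0 ⌝ ⊕ X ⊛ (Q ⊛ t ⊕ (⌜ a ⌝ ⊕ ⌜ k ⌝ ⊛ ⌜ q₂ ⌝ ⊛ X))
          ≈⟨ solve 8 (λ f₀ X t a k q₀ q₁ q₂ →
               f₀ :+ X :* ((q₀ :+ X :* (q₁ :+ X :* (q₂ :+ X :* con (ℤ.+ 0)))) :* t :+ (a :+ k :* q₂ :* X))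
               := (q₀ :+ X :* (q₁ :+ X :* (q₂ :+ X :* con (ℤ.+ 0)))) :* (X :* t :+ k)
                 :+ ((f₀ :- k :* q₀) :+ (a :- k :* q₁) :* X)) S.refl
               ⌜ f 0 ⌝ X t ⌜ a ⌝ ⌜ k ⌝ ⌜ q₀ ⌝ ⌜ q₁ ⌝ ⌜ q₂ ⌝ ⟩
        Q ⊛ (X ⊛ t ⊕ ⌜ k ⌝) ⊕ ((⌜ f 0 ⌝ ⊕ ⊝ (⌜ k ⌝ ⊛ ⌜ q₀ ⌝)) ⊕ (⌜ a ⌝ ⊕ ⊝ (⌜ k ⌝ ⊛ ⌜ q₁ ⌝)) ⊛ X)
          ≈⟨ S.+-congˡ {Q ⊛ (X ⊛ t ⊕ ⌜ k ⌝)} (S.+-cong (hom (f 0) q₀) (S.*-congʳ {X} (hom a q₁))) ⟨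
        Q ⊛ (X ⊛ t ⊕ ⌜ k ⌝) ⊕ line (f 0 - k * q₀) (a - k * q₁)   ∎)
      where
      open ≋-Reasoning
      -- X (a + b X) ends in b X²; subtracting k Q with k = b/q₂ makes the remainder linear again.
      k : F
      k = b * proj₁ (inverse q₂ q₂≢0)
      kq₂≡b : k * q₂ ≡ b
      kq₂≡b = trans (*-assoc b _ q₂) (trans (cong (b *_) (trans (*-comm _ q₂) (proj₂ (inverse q₂ q₂≢0)))) (*-identityʳ b))
      hom : ∀ x y → ⌜ x - k * y ⌝ ≋ ⌜ x ⌝ ⊕ ⊝ (⌜ k ⌝ ⊛ ⌜ y ⌝)
      hom x y = S.trans (⌜⌝-+ x (- (k * y))) (S.+-congˡ {⌜ x ⌝} (S.trans (⌜⌝-- (k * y)) (S.-‿cong (⌜⌝-* k y))))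

    module _ (disc≢0 : q₁ * q₁ - (1# + 1# + 1# + 1#) * (q₀ * q₂) ≢ 0#) where

      -- A square (a + b X)² divisible by Q is a constant multiple κ Q, so κ² disc Q = 0.
      linear-square : ∀ a b w → IsPoly w → line a b ⊛ line a b ≋ Q ⊛ w → a ≡ 0# × b ≡ 0#
      linear-square a b w pw e = square-zero (trans coeff₀ (trans (cong (q₀ *_) κ≡0) (zeroʳ q₀)))
                               , square-zero (trans coeff₂ (trans (cong (q₂ *_) κ≡0) (zeroʳ q₂)))
        where
        L : Series
        L = line a b
        L0 : L 0 ≡ a
        L0 = trans (cong (a +_) (zeroʳ b)) (+-identityʳ a)
        L1 : L 1 ≡ b
        L1 = trans (+-identityˡ _) (trans (⌜⌝-⊛ b X 1) (*-identityʳ b))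
        L2+ : ∀ i → L (suc (suc i)) ≡ 0#
        L2+ i = trans (+-identityˡ _) (trans (⌜⌝-⊛ b X (suc (suc i))) (zeroʳ b))
        degLL : Deg< 3 (L ⊛ L)
        degLL (suc zero)          (s≤s ())
        degLL (suc (suc zero))    (s≤s (s≤s ()))
        degLL (suc (suc (suc i))) _ = trans (line-⊛-suc a b L (suc (suc i)))
          (trans (cong₂ (λ x y → a * x + b * y) (L2+ (suc i)) (L2+ i)) (trans (cong₂ _+_ (zeroʳ a) (zeroʳ b)) (+-identityˡ 0#)))
        degw : Deg< 1 w
        degw = Deg<-quotient {w} 1 pw (λ i le → trans (sym (e i)) (degLL i le))
        κ : F
        κ = w 0
        coeff₀ : a * a ≡ q₀ * κ
        coeff₀ = trans (sym (trans (line-⊛-zero a b L) (cong (a *_) L0))) (trans (e 0) (Q-0 w))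
        coeff₁ : a * b + b * a ≡ q₁ * κ
        coeff₁ = trans (sym (trans (line-⊛-suc a b L 0) (cong₂ (λ x y → a * x + b * y) L1 L0))) (trans (e 1)
          (trans (Q-1 w) (trans (cong (λ z → q₀ * z + q₁ * κ) (degw 1 (s≤s z≤n))) (trans (cong (_+ q₁ * κ) (zeroʳ q₀)) (+-identityˡ _)))))
        coeff₂ : b * b ≡ q₂ * κ
        coeff₂ = trans (sym (trans (line-⊛-suc a b L 1) (trans (cong₂ (λ x y → a * x + b * y) (L2+ 0) L1)
            (trans (cong (_+ b * b) (zeroʳ a)) (+-identityˡ _))))) (trans (e 2) (trans (Q-2+ w 0)
          (trans (cong₂ (λ x y → q₀ * x + (q₁ * y + q₂ * κ)) (degw 2 (s≤s z≤n)) (degw 1 (s≤s z≤n)))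
            (Solver.solve 3 (λ a b c → a Solver.:* Solver.con (ℤ.+ 0) Solver.:+ (b Solver.:* Solver.con (ℤ.+ 0) Solver.:+ c) Solver.:= c) refl q₀ q₁ (q₂ * κ)))))
        square-zero : ∀ {x} → x * x ≡ 0# → x ≡ 0#
        square-zero {x} xx≡0 with x ≟ 0#
        ... | yes x≡0 = x≡0
        ... | no  x≢0 = *-cancelˡ-0 x≢0 xx≡0
        κ≡0 : κ ≡ 0#
        κ≡0 = square-zero (*-cancelˡ-0 disc≢0 (begin
          (q₁ * q₁ - (1# + 1# + 1# + 1#) * (q₀ * q₂)) * (κ * κ)
            ≡⟨ Solver.solve 4 (λ q₀ q₁ q₂ k → (q₁ Solver.:* q₁ Solver.:- four Solver.:* (q₀ Solver.:* q₂)) Solver.:* (k Solver.:* k)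
                 Solver.:= (q₁ Solver.:* k) Solver.:* (q₁ Solver.:* k) Solver.:- four Solver.:* ((q₀ Solver.:* k) Solver.:* (q₂ Solver.:* k))) refl q₀ q₁ q₂ κ ⟩
          (q₁ * κ) * (q₁ * κ) - (1# + 1# + 1# + 1#) * ((q₀ * κ) * (q₂ * κ))
            ≡⟨ cong₂ (λ x y → x * x - (1# + 1# + 1# + 1#) * y) coeff₁ (cong₂ _*_ coeff₀ coeff₂) ⟨
          (a * b + b * a) * (a * b + b * a) - (1# + 1# + 1# + 1#) * ((a * a) * (b * b))
            ≡⟨ Solver.solve 2 (λ a b → (a Solver.:* b Solver.:+ b Solver.:* a) Solver.:* (a Solver.:* b Solver.:+ b Solver.:* a)
                 Solver.:- four Solver.:* ((a Solver.:* a) Solver.:* (b Solver.:* b)) Solver.:= Solver.con (ℤ.+ 0)) refl a b ⟩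
          0# ∎))
          where
          open ≡-Reasoning
          one four : ∀ {n} → Solver.Polynomial n
          one = Solver.con (ℤ.+ 1)
          four = one Solver.:+ one Solver.:+ one Solver.:+ one

      -- Separability takes the place of irreducibility, as Q may split over the field: for f = Q t
      -- + L with L linear, Q divides L², and `linear-square` gives L = 0.
      divides-square : IsPoly f → Divides (f ⊛ f) → Divides f
      divides-square {f} (n , df) (v , pv , ff≋) with divMod n df
      ... | t , a , b , pt , f≋ = t , pt , S.trans f≋ (S.trans (S.+-congˡ {Q ⊛ t} L≋0) (S.+-identityʳ _))
        where
        L w : Series
        L = line a b
        w = v ⊕ ⊝ (Q ⊛ t ⊛ t ⊕ t ⊛ L ⊕ t ⊛ L)
        pw : IsPoly w
        pw = IsPoly-⊕ pv (IsPoly-⊝ (IsPoly-⊕ (IsPoly-⊕ (IsPoly-⊛ (IsPoly-⊛ IsPoly-Q pt) pt) (IsPoly-⊛ pt (IsPoly-line a b))) (IsPoly-⊛ pt (IsPoly-line a b))))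
        LL≋ : L ⊛ L ≋ Q ⊛ w
        LL≋ = begin
          L ⊛ L ≈⟨ solve 3 (λ Q t L → L :* L := (Q :* t :+ L) :* (Q :* t :+ L) :- Q :* (Q :* t :* t :+ t :* L :+ t :* L)) S.refl Q t L ⟩
          (Q ⊛ t ⊕ L) ⊛ (Q ⊛ t ⊕ L) ⊕ ⊝ (Q ⊛ (Q ⊛ t ⊛ t ⊕ t ⊛ L ⊕ t ⊛ L)) ≈⟨ S.+-congʳ {⊝ (Q ⊛ (Q ⊛ t ⊛ t ⊕ t ⊛ L ⊕ t ⊛ L))} (S.trans (S.sym (S.*-cong f≋ f≋)) ff≋) ⟩
          Q ⊛ v ⊕ ⊝ (Q ⊛ (Q ⊛ t ⊛ t ⊕ t ⊛ L ⊕ t ⊛ L)) ≈⟨ solve 3 (λ Q v z → Q :* v :- Q :* z := Q :* (v :- z)) S.refl Q v (Q ⊛ t ⊛ t ⊕ t ⊛ L ⊕ t ⊛ L) ⟩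
          Q ⊛ w                                                   ∎
          where open ≋-Reasoning
        ab≡0 : a ≡ 0# × b ≡ 0#
        ab≡0 = linear-square a b w pw LL≋
        L≋0 : L ≋ 𝟘
        L≋0 = S.trans (S.+-cong (S.trans (⌜⌝-cong (proj₁ ab≡0)) ⌜⌝-0)
          (S.trans (S.*-congʳ {X} (S.trans (⌜⌝-cong (proj₂ ab≡0)) ⌜⌝-0)) (S.zeroˡ X))) (S.+-identityˡ 𝟘)

      -- Coprimality to Q in the form of Euclid's lemma, which passes to products without any
      -- computation.
      Cancels : Series → Set
      Cancels G = ∀ w → IsPoly w → Divides (G ⊛ w) → Divides w

      Divides-resp : f ≋ g → Divides f → Divides g
      Divides-resp e (w , pw , f≋) = w , pw , S.trans (S.sym e) f≋

      Cancels-⊛ : IsPoly g → Cancels f → Cancels g → Cancels (f ⊛ g)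
      Cancels-⊛ {g} {f} pg cf cg w pw d = cg w pw (cf (g ⊛ w) (IsPoly-⊛ pg pw) (Divides-resp (S.*-assoc f g w) d))

      Cancels-resp : f ≋ g → Cancels f → Cancels g
      Cancels-resp e c w pw d = c w pw (Divides-resp (S.*-congʳ {w} (S.sym e)) d)

      Cancels-⌜⌝ : ∀ {κ} → κ ≢ 0# → Cancels ⌜ κ ⌝
      Cancels-⌜⌝ {κ} κ≢0 w pw (v , pv , e) = ⌜ κ⁻¹ ⌝ ⊛ v , IsPoly-⊛ (IsPoly-⌜⌝ κ⁻¹) pv , (begin
          w                              ≈⟨ S.*-identityˡ w ⟨
          𝟙 ⊛ w                          ≈⟨ S.*-congʳ {w} (⌜⌝-cong (trans (*-comm _ _) (proj₂ (inverse κ κ≢0)))) ⟨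
          ⌜ κ⁻¹ * κ ⌝ ⊛ w                ≈⟨ S.*-congʳ {w} (⌜⌝-* κ⁻¹ κ) ⟩
          ⌜ κ⁻¹ ⌝ ⊛ ⌜ κ ⌝ ⊛ w            ≈⟨ S.*-assoc ⌜ κ⁻¹ ⌝ ⌜ κ ⌝ w ⟩
          ⌜ κ⁻¹ ⌝ ⊛ (⌜ κ ⌝ ⊛ w)          ≈⟨ S.*-congˡ {⌜ κ⁻¹ ⌝} e ⟩
          ⌜ κ⁻¹ ⌝ ⊛ (Q ⊛ v)              ≈⟨ solve 3 (λ a b c → a :* (b :* c) := b :* (a :* c)) S.refl ⌜ κ⁻¹ ⌝ Q v ⟩
          Q ⊛ (⌜ κ⁻¹ ⌝ ⊛ v)              ∎)
        where
        open ≋-Reasoning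
        κ⁻¹ : F
        κ⁻¹ = proj₁ (inverse κ κ≢0)

      -- From Q | g w follows Q | (A Q + B g) w = H w. H is any cancelling series because the
      -- identities used later end in constant multiples of powers of 1 + t².
      Cancels-Bézout : ∀ A B H → IsPoly A → IsPoly B → A ⊛ Q ⊕ B ⊛ g ≋ H → Cancels H → Cancels g
      Cancels-Bézout {g} A B H pA pB bezout cH w pw (v , pv , e) = cH w pw (A ⊛ w ⊕ B ⊛ v , IsPoly-⊕ (IsPoly-⊛ pA pw) (IsPoly-⊛ pB pv) , (begin
          H ⊛ w                          ≈⟨ S.*-congʳ {w} bezout ⟨
          (A ⊛ Q ⊕ B ⊛ g) ⊛ w ≈⟨ solve 5 (λ A Q B g w → (A :* Q :+ B :* g) :* w := A :* Q :* w :+ B :* (g :* w)) S.refl A Q B g w ⟩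
          A ⊛ Q ⊛ w ⊕ B ⊛ (g ⊛ w)        ≈⟨ S.+-congˡ {A ⊛ Q ⊛ w} (S.*-congˡ {B} e) ⟩
          A ⊛ Q ⊛ w ⊕ B ⊛ (Q ⊛ v) ≈⟨ solve 5 (λ A Q B v w → A :* Q :* w :+ B :* (Q :* v) := Q :* (A :* w :+ B :* v)) S.refl A Q B v w ⟩
          Q ⊛ (A ⊛ w ⊕ B ⊛ v)            ∎))
        where open ≋-Reasoning

      -- Infinite descent: a solution of r² f = f(0) s² is divisible by Q.
      notSquare : ∀ {f G} → IsPoly G → f ≋ Q ⊛ G → f 0 ≢ 0# → Cancels G → ∀ n → NotSquare n f
      notSquare pG f≋ f0≢0 cG zero r s dr ds _ = Deg<-0 dr , Deg<-0 ds
      notSquare {f} {G} pG f≋ f0≢0 cG (suc n) r s dr ds rel = S.trans r≋ (zero-multiple (proj₁ IH)) , S.trans s≋ (zero-multiple (proj₂ IH))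
        where
        open ≋-Reasoning
        c : Series
        c = ⌜ f 0 ⌝
        pr : IsPoly r
        pr = suc n , dr
        ps : IsPoly s
        ps = suc n , ds
        pc : IsPoly c
        pc = IsPoly-⌜⌝ (f 0)
        Q∣s : Divides s
        Q∣s = divides-square ps (Cancels-⌜⌝ f0≢0 (s ⊛ s) (IsPoly-⊛ ps ps) (r ⊛ r ⊛ G , IsPoly-⊛ (IsPoly-⊛ pr pr) pG , (begin
          c ⊛ (s ⊛ s)          ≈⟨ S.*-comm c (s ⊛ s) ⟩
          s ⊛ s ⊛ c            ≈⟨ rel ⟨
          r ⊛ r ⊛ f            ≈⟨ S.*-congˡ {r ⊛ r} f≋ ⟩
          r ⊛ r ⊛ (Q ⊛ G)      ≈⟨ solve 3 (λ r Q G → r :* r :* (Q :* G) := Q :* (r :* r :* G)) S.refl r Q G ⟩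
          Q ⊛ (r ⊛ r ⊛ G)      ∎)))
        s₁ : Series
        s₁ = proj₁ Q∣s
        ps₁ : IsPoly s₁
        ps₁ = proj₁ (proj₂ Q∣s)
        s≋ : s ≋ Q ⊛ s₁
        s≋ = proj₂ (proj₂ Q∣s)
        -- With s = Q s₁ the relation reads r² Q G = f(0) Q² s₁². Cancelling a single Q leaves Q | G
        -- r², and G cancels.
        once : G ⊛ (r ⊛ r) ≋ Q ⊛ (s₁ ⊛ s₁ ⊛ c)
        once = Q-cancel (IsPoly-⊛ pG (IsPoly-⊛ pr pr)) (IsPoly-⊛ IsPoly-Q (IsPoly-⊛ (IsPoly-⊛ ps₁ ps₁) pc)) (begin
          Q ⊛ (G ⊛ (r ⊛ r))             ≈⟨ solve 3 (λ r Q G → Q :* (G :* (r :* r)) := r :* r :* (Q :* G)) S.refl r Q G ⟩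
          r ⊛ r ⊛ (Q ⊛ G)               ≈⟨ S.*-congˡ {r ⊛ r} f≋ ⟨
          r ⊛ r ⊛ f                     ≈⟨ rel ⟩
          s ⊛ s ⊛ c                     ≈⟨ S.*-congʳ {c} (S.*-cong s≋ s≋) ⟩
          (Q ⊛ s₁) ⊛ (Q ⊛ s₁) ⊛ c ≈⟨ solve 3 (λ s Q c → (Q :* s) :* (Q :* s) :* c := Q :* (Q :* (s :* s :* c))) S.refl s₁ Q c ⟩
          Q ⊛ (Q ⊛ (s₁ ⊛ s₁ ⊛ c))       ∎)
        Q∣r : Divides r
        Q∣r = divides-square pr (cG (r ⊛ r) (IsPoly-⊛ pr pr) (s₁ ⊛ s₁ ⊛ c , IsPoly-⊛ (IsPoly-⊛ ps₁ ps₁) pc , once))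
        r₁ : Series
        r₁ = proj₁ Q∣r
        pr₁ : IsPoly r₁
        pr₁ = proj₁ (proj₂ Q∣r)
        r≋ : r ≋ Q ⊛ r₁
        r≋ = proj₂ (proj₂ Q∣r)
        rel₁ : r₁ ⊛ r₁ ⊛ f ≋ s₁ ⊛ s₁ ⊛ c
        rel₁ = Q-cancel (IsPoly-resp (S.*-congˡ {r₁ ⊛ r₁} (S.sym f≋)) (IsPoly-⊛ (IsPoly-⊛ pr₁ pr₁) (IsPoly-⊛ IsPoly-Q pG)))
            (IsPoly-⊛ (IsPoly-⊛ ps₁ ps₁) pc) (begin
          Q ⊛ (r₁ ⊛ r₁ ⊛ f)             ≈⟨ S.*-congˡ {Q} (S.*-congˡ {r₁ ⊛ r₁} f≋) ⟩
          Q ⊛ (r₁ ⊛ r₁ ⊛ (Q ⊛ G)) ≈⟨ solve 3 (λ r Q G → Q :* (r :* r :* (Q :* G)) := G :* ((Q :* r) :* (Q :* r))) S.refl r₁ Q G ⟩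
          G ⊛ ((Q ⊛ r₁) ⊛ (Q ⊛ r₁))     ≈⟨ S.*-congˡ {G} (S.*-cong r≋ r≋) ⟨
          G ⊛ (r ⊛ r)                   ≈⟨ once ⟩
          Q ⊛ (s₁ ⊛ s₁ ⊛ c)             ∎)
          where
          IsPoly-resp : ∀ {f g} → f ≋ g → IsPoly f → IsPoly g
          IsPoly-resp e (m , d) = m , λ i m≤i → trans (sym (e i)) (d i m≤i)
        degree : ∀ {v v₁} → IsPoly v₁ → v ≋ Q ⊛ v₁ → Deg< (suc n) v → Deg< n v₁
        degree {v} {v₁} pv₁ v≋ dv = Deg<-quotient {v₁} n pv₁ (λ i le → trans (sym (v≋ i)) (dv i (ℕₚ.≤-trans (ℕₚ.n≤1+n _) le)))
        IH : r₁ ≋ 𝟘 × s₁ ≋ 𝟘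
        IH = notSquare pG f≋ f0≢0 cG n r₁ s₁ (degree {r} pr₁ r≋ dr) (degree {s} ps₁ s≋ ds) rel₁
        zero-multiple : ∀ {v} → v ≋ 𝟘 → Q ⊛ v ≋ 𝟘
        zero-multiple v≋0 = S.trans (S.*-congˡ {Q} v≋0) (S.zeroʳ Q)

-- The quadratic character for q ≡ 3 mod 4.

module QuadraticCharacter {q : ℕ} (K : FiniteField q) (k : ℕ) (q≡4k+3 : q ≡ suc (suc (k ℕ.+ k) ℕ.+ suc (k ℕ.+ k))) where
  open FieldFacts K
  open Solver

  h : ℕ
  h = suc (k ℕ.+ k)

  2# : F
  2# = 1# + 1#

  -- q · 1 = 0 with q odd, so 2 = 0 would give 1 = 0.
  2≢0 : 2# ≢ 0#
  2≢0 2≡0 = 0≢1 (sym (begin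
    1#                   ≡⟨ +-identityʳ 1# ⟨
    1# + 0#              ≡⟨ cong (1# +_) (trans (×-homo-+ 1# h h) (double h)) ⟨
    suc (h ℕ.+ h) ×ₙ 1#  ≡⟨ cong (_×ₙ 1#) q≡4k+3 ⟨
    q ×ₙ 1#              ≡⟨ q×1≡0 ⟩
    0#                   ∎))
    where
    open ≡-Reasoning
    open Algebra.Properties.Semiring.Mult (CommutativeRing.semiring ring) using (×-homo-+) renaming (_×_ to _×ₙ_)
    double : ∀ n → n ×ₙ 1# + n ×ₙ 1# ≡ 0#
    double zero    = +-identityˡ 0#
    double (suc n) = trans (solve 2 (λ a b → (a :+ b) :+ (a :+ b) := (a :+ a) :+ (b :+ b)) refl 1# (n ×ₙ 1#))
      (trans (cong₂ _+_ 2≡0 (double n)) (+-identityˡ 0#))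

  x+x≢0 : ∀ {x} → x ≢ 0# → x + x ≢ 0#
  x+x≢0 {x} x≢0 e = *-nonzero 2≢0 x≢0 (trans (solve 1 (λ x → (con 1ℤ :+ con 1ℤ) :* x := x :+ x) refl x) e)

  1≢-1 : 1# ≢ - 1#
  1≢-1 e = 2≢0 (trans (cong (1# +_) e) (-‿inverseʳ 1#))

  square^h : ∀ {y} → y ≢ 0# → (y * y) ^ h ≡ 1#
  square^h {y} y≢0 = *-cancelˡ y≢0 (begin
    y * (y * y) ^ h      ≡⟨ cong (y *_) (^-distrib-* y y h) ⟩
    y * (y ^ h * y ^ h)  ≡⟨ cong (y *_) (^-homo-* y h h) ⟨
    y ^ suc (h ℕ.+ h)    ≡⟨ cong (y ^_) q≡4k+3 ⟨
    y ^ q                ≡⟨ fermat y ⟩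
    y                    ≡⟨ *-identityʳ y ⟨
    y * 1#               ∎)
    where open ≡-Reasoning

  euler : ∀ {x} → x ≢ 0# → x ^ h ≡ 1# ⊎ x ^ h ≡ - 1#
  euler {x} x≢0 with (x ^ h) ≟ 1#
  ... | yes e  = inj₁ e
  ... | no  ≢1 = inj₂ (x-y≡0⇒x≡y (*-cancelˡ-0 (≢1 ∘ x-y≡0⇒x≡y) (begin
    (a - 1#) * (a - (- 1#))  ≡⟨ solve 1 (λ a → (a :- con 1ℤ) :* (a :- (:- con 1ℤ)) := a :* a :- con 1ℤ) refl a ⟩
    a * a - 1#               ≡⟨ x≡y⇒x-y≡0 (trans (sym (^-distrib-* x x h)) (square^h x≢0)) ⟩
    0#                       ∎)))
    where
    open ≡-Reasoning
    a : F
    a = x ^ h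

  -- As q = 4k + 3, a square root of x is x^(k+1).
  root : ∀ {x} → x ^ h ≡ 1# → (x ^ suc k) * (x ^ suc k) ≡ x
  root {x} e = begin
    x ^ suc k * x ^ suc k      ≡⟨ ^-homo-* x (suc k) (suc k) ⟨
    x ^ (suc k ℕ.+ suc k)      ≡⟨ cong (x ^_) (cong suc (ℕₚ.+-suc k k)) ⟩
    x * x ^ h                  ≡⟨ cong (x *_) e ⟩
    x * 1#                     ≡⟨ *-identityʳ x ⟩
    x                          ∎
    where open ≡-Reasoning

  -1^h : (- 1#) ^ h ≡ - 1#
  -1^h = begin
    - 1# * (- 1#) ^ (k ℕ.+ k)        ≡⟨ cong (- 1# *_) (^-homo-* (- 1#) k k) ⟩
    - 1# * ((- 1#) ^ k * (- 1#) ^ k) ≡⟨ cong (- 1# *_) (^-distrib-* (- 1#) (- 1#) k) ⟨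
    - 1# * (- 1# * - 1#) ^ k         ≡⟨ cong (λ z → - 1# * z ^ k) (solve 0 ((:- con 1ℤ) :* (:- con 1ℤ) := con 1ℤ) refl) ⟩
    - 1# * 1# ^ k                    ≡⟨ cong (- 1# *_) (one k) ⟩
    - 1# * 1#                        ≡⟨ *-identityʳ _ ⟩
    - 1#                             ∎
    where
    open ≡-Reasoning
    one : ∀ n → 1# ^ n ≡ 1#
    one zero    = refl
    one (suc n) = trans (*-identityˡ _) (one n)

  neg^h : ∀ x → (- x) ^ h ≡ - (x ^ h)
  neg^h x = begin
    (- x) ^ h            ≡⟨ cong (_^ h) (-1*x≈-x x) ⟨
    (- 1# * x) ^ h       ≡⟨ ^-distrib-* (- 1#) x h ⟩
    (- 1#) ^ h * x ^ h   ≡⟨ cong (_* x ^ h) -1^h ⟩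
    - 1# * x ^ h         ≡⟨ -1*x≈-x (x ^ h) ⟩
    - (x ^ h)            ∎
    where open ≡-Reasoning

  -- η is defined by a search for a square root. The view ties its value to Euler's power x^h, on
  -- which multiplicativity and Stepanov's method rest.
  data ηView (x : F) : Set where
    is-zero   : x ≡ 0# → η x ≡ 0ℤ → ηView x
    is-square : x ≢ 0# → x ^ h ≡ 1# → η x ≡ 1ℤ → ηView x
    nonsquare : x ≢ 0# → x ^ h ≡ - 1# → η x ≡ -1ℤ → ηView x

  η-0 : ∀ {x} → x ≡ 0# → η x ≡ 0ℤ
  η-0 {x} x≡0 with x ≟ 0#
  ... | yes _  = refl
  ... | no x≢0 = contradiction x≡0 x≢0

  η-1 : ∀ {x} → x ≢ 0# → x ^ h ≡ 1# → η x ≡ 1ℤ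
  η-1 {x} x≢0 e with x ≟ 0#
  ... | yes x≡0 = contradiction x≡0 x≢0
  ... | no _ with isSquare? x
  ...   | yes _ = refl
  ...   | no ¬sq = contradiction (lose (∈-elements (x ^ suc k)) (root e)) ¬sq

  η--1 : ∀ {x} → x ≢ 0# → x ^ h ≡ - 1# → η x ≡ -1ℤ
  η--1 {x} x≢0 e with x ≟ 0#
  ... | yes x≡0 = contradiction x≡0 x≢0
  ... | no _ with isSquare? x
  ...   | no _ = refl
  ...   | yes sq with find sq
  ...     | y , _ , yy≡x = contradiction (trans (sym (trans (cong (_^ h) (sym yy≡x)) (square^h y≢0))) e) 1≢-1
    where
    y≢0 : y ≢ 0#
    y≢0 refl = x≢0 (trans (sym yy≡x) (zeroˡ 0#))

  ηview : ∀ x → ηView x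
  ηview x with x ≟ 0#
  ... | yes x≡0 = is-zero x≡0 (η-0 x≡0)
  ... | no  x≢0 with euler x≢0
  ...   | inj₁ e = is-square x≢0 e (η-1 x≢0 e)
  ...   | inj₂ e = nonsquare x≢0 e (η--1 x≢0 e)

  η-* : ∀ x y → η (x * y) ≡ η x ℤ.* η y
  η-* x y with ηview x | ηview y
  ... | is-zero refl ηx | _ rewrite ηx = η-0 (zeroˡ y)
  ... | is-square _ _ ηx | is-zero refl ηy rewrite ηx | ηy = η-0 (zeroʳ x)
  ... | nonsquare _ _ ηx | is-zero refl ηy rewrite ηx | ηy = η-0 (zeroʳ x)
  ... | is-square x≢0 ex ηx | is-square y≢0 ey ηy rewrite ηx | ηy =
    η-1 (*-nonzero x≢0 y≢0) (trans (^-distrib-* x y h) (trans (cong₂ _*_ ex ey) (*-identityˡ 1#)))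
  ... | is-square x≢0 ex ηx | nonsquare y≢0 ey ηy rewrite ηx | ηy =
    η--1 (*-nonzero x≢0 y≢0) (trans (^-distrib-* x y h) (trans (cong₂ _*_ ex ey) (*-identityˡ _)))
  ... | nonsquare x≢0 ex ηx | is-square y≢0 ey ηy rewrite ηx | ηy =
    η--1 (*-nonzero x≢0 y≢0) (trans (^-distrib-* x y h) (trans (cong₂ _*_ ex ey) (*-identityʳ _)))
  ... | nonsquare x≢0 ex ηx | nonsquare y≢0 ey ηy rewrite ηx | ηy =
    η-1 (*-nonzero x≢0 y≢0) (trans (^-distrib-* x y h) (trans (cong₂ _*_ ex ey) (solve 0 ((:- con 1ℤ) :* (:- con 1ℤ) := con 1ℤ) refl)))

  η-neg : ∀ x → η (- x) ≡ ℤ.- η x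
  η-neg x with ηview x
  ... | is-zero refl ηx rewrite ηx = η-0 -0#≈0#
  ... | is-square x≢0 ex ηx rewrite ηx = η--1 (-‿nonzero x≢0) (trans (neg^h x) (cong -_ ex))
  ... | nonsquare x≢0 ex ηx rewrite ηx = η-1 (-‿nonzero x≢0) (trans (neg^h x) (trans (cong -_ ex) (-‿involutive 1#)))

  η-one : η 1# ≡ 1ℤ
  η-one = η-1 (0≢1 ∘ sym) (trans (cong (_^ h) (sym (*-identityˡ 1#))) (square^h (0≢1 ∘ sym)))

  IsSign : ℤ → Set
  IsSign s = s ≡ 1ℤ ⊎ s ≡ -1ℤ

  η-sign : ∀ {x} → x ≢ 0# → IsSign (η x)
  η-sign {x} x≢0 with ηview x
  ... | is-zero x≡0 _     = contradiction x≡0 x≢0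
  ... | is-square _ _ ηx  = inj₁ ηx
  ... | nonsquare _ _ ηx  = inj₂ ηx

  sign-nonzero : ∀ {x s} → IsSign s → η x ≡ s → x ≢ 0#
  sign-nonzero (inj₁ refl) ηx x≡0 with () ← trans (sym ηx) (η-0 x≡0)
  sign-nonzero (inj₂ refl) ηx x≡0 with () ← trans (sym ηx) (η-0 x≡0)

  η-square : ∀ {x} → x ≢ 0# → η (x * x) ≡ 1ℤ
  η-square x≢0 = η-1 (*-nonzero x≢0 x≢0) (square^h x≢0)

  -- Sums are written r - (- α), so that all shifts have the shape r - κ. Since r and r′ are
  -- nonzero, the roots belonging to r and - r, or to r′ and - r′, will be distinct.
  Attained : F → F → F → (s₁ s₂ s₃ s₄ s₅ s₆ s₇ s₈ : ℤ) → Set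
  Attained D α β s₁ s₂ s₃ s₄ s₅ s₆ s₇ s₈ = ∃ λ r → ∃ λ r′ → r * r + r′ * r′ ≡ D × r ≢ 0# × r′ ≢ 0# ×
    (η (r - α) ≡ s₁ × η (r - (- α)) ≡ s₂ × η (r - β) ≡ s₃ × η (r - (- β)) ≡ s₄) ×
    (η (r′ - α) ≡ s₅ × η (r′ - (- α)) ≡ s₆ × η (r′ - β) ≡ s₇ × η (r′ - (- β)) ≡ s₈)

  private
    ascent : (P : ℕ → Set) → (∀ n → Dec (P n)) → P 0 → ∀ n → ¬ P n → ∃ λ m → P m × ¬ P (suc m)
    ascent P P? P0 zero    ¬P = contradiction P0 ¬P
    ascent P P? P0 (suc n) ¬P with P? n
    ... | yes Pn = n , Pn , ¬P
    ... | no ¬Pn = ascent P P? P0 n ¬Pn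

    open Algebra.Properties.Semiring.Mult (CommutativeRing.semiring ring) using () renaming (_×_ to _×ₙ_)

    nonsquare⇒neg-square : ∀ {x} → ¬ IsSquare x → ∃ λ y → y * y ≡ - x
    nonsquare⇒neg-square {x} ¬sq with x ≟ 0#
    ... | yes refl = 0# , trans (zeroˡ 0#) (sym -0#≈0#)
    ... | no x≢0 with euler x≢0
    ...   | inj₁ e = contradiction (lose (∈-elements (x ^ suc k)) (root e)) ¬sq
    ...   | inj₂ e = (- x) ^ suc k , root (trans (neg^h x) (trans (cong -_ e) (-‿involutive 1#)))

    -- Counting 0, 1, 2, … up to −1 = q − 1 passes from a square m to a nonsquare m + 1.
    -1-sum-of-squares : ∃ λ a → ∃ λ b → a * a + b * b ≡ - 1#
    -1-sum-of-squares with ascent (λ n → IsSquare (n ×ₙ 1#)) (λ n → isSquare? (n ×ₙ 1#))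
                             (lose (∈-elements 0#) (zeroˡ 0#)) (h ℕ.+ h) last-nonsquare
      where
      last≡-1 : (h ℕ.+ h) ×ₙ 1# ≡ - 1#
      last≡-1 = x-y≡0⇒x≡y (trans (solve 1 (λ a → a :- (:- con 1ℤ) := con 1ℤ :+ a) refl ((h ℕ.+ h) ×ₙ 1#))
        (trans (cong (_×ₙ 1#) (sym q≡4k+3)) q×1≡0))
      last-nonsquare : ¬ IsSquare ((h ℕ.+ h) ×ₙ 1#)
      last-nonsquare sq with find sq
      ... | y , _ , yy≡ with y ≟ 0#
      ...   | yes refl = -‿nonzero (0≢1 ∘ sym) (trans (sym last≡-1) (trans (sym yy≡) (zeroˡ 0#)))
      ...   | no y≢0 = 1≢-1 (trans (sym (square^h y≢0)) (trans (cong (_^ h) (trans yy≡ last≡-1)) -1^h))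
    ... | m , sq , ¬sq with find sq | nonsquare⇒neg-square ¬sq
    ...   | a , _ , aa≡ | b , bb≡ = a , b , trans (cong₂ _+_ aa≡ bb≡)
      (solve 1 (λ x → x :+ (:- (con 1ℤ :+ x)) := :- con 1ℤ) refl (m ×ₙ 1#))

  -- If d is a nonsquare then - d = y², and -1 = a² + b² gives d = (y a)² + (y b)². This supplies
  -- the first point of the conic.
  sum-of-squares : ∀ d → ∃ λ a → ∃ λ b → a * a + b * b ≡ d
  sum-of-squares d with isSquare? d
  ... | yes sq with find sq
  ...   | y , _ , yy≡d = y , 0# , trans (cong (y * y +_) (zeroˡ 0#)) (trans (+-identityʳ _) yy≡d)
  sum-of-squares d | no ¬sq = combine (nonsquare⇒neg-square ¬sq) -1-sum-of-squares
    where
    open ≡-Reasoning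
    combine : (∃ λ y → y * y ≡ - d) → (∃ λ a → ∃ λ b → a * a + b * b ≡ - 1#) → ∃ λ a → ∃ λ b → a * a + b * b ≡ d
    combine (y , yy≡-d) (a , b , aabb) = y * a , y * b , (begin
      y * a * (y * a) + y * b * (y * b) ≡⟨ solve 3 (λ y a b → y :* a :* (y :* a) :+ y :* b :* (y :* b) := y :* y :* (a :* a :+ b :* b)) refl y a b ⟩
      y * y * (a * a + b * b)            ≡⟨ cong₂ _*_ yy≡-d aabb ⟩
      - d * - 1#                         ≡⟨ solve 1 (λ d → (:- d) :* (:- con 1ℤ) := d) refl d ⟩
      d                                  ∎)

-- Finite sums of integers.

∑ : ∀ {A : Set} → List A → (A → ℤ) → ℤ
∑ []       φ = 0ℤ
∑ (x ∷ xs) φ = φ x ℤ.+ ∑ xs φ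

module _ {A : Set} where

  ∑-cong : ∀ (xs : List A) {φ ψ : A → ℤ} → (∀ x → φ x ≡ ψ x) → ∑ xs φ ≡ ∑ xs ψ
  ∑-cong []       e = refl
  ∑-cong (x ∷ xs) e = cong₂ ℤ._+_ (e x) (∑-cong xs e)

  ∑-linear : ∀ (xs : List A) (φ ψ : A → ℤ) s → ∑ xs (λ x → φ x ℤ.+ s ℤ.* ψ x) ≡ ∑ xs φ ℤ.+ s ℤ.* ∑ xs ψ
  ∑-linear []       φ ψ s = sym (trans (ℤₚ.+-identityˡ _) (ℤₚ.*-zeroʳ s))
  ∑-linear (x ∷ xs) φ ψ s = trans (cong (ℤ._+_ (φ x ℤ.+ s ℤ.* ψ x)) (∑-linear xs φ ψ s))
    (solve 5 (λ a b s u v → (a :+ s :* b) :+ (u :+ s :* v) := (a :+ u) :+ s :* (b :+ v)) refl (φ x) (ψ x) s (∑ xs φ) (∑ xs ψ))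
    where open Data.Integer.Solver.+-*-Solver

  ∑-1 : ∀ (xs : List A) {φ : A → ℤ} → (∀ x → φ x ≡ 1ℤ) → ∣ ∑ xs φ ∣ ≡ length xs
  ∑-1 xs e = cong ∣_∣ (trans (∑-cong xs e) (count xs))
    where
    count : ∀ (xs : List A) → ∑ xs (λ _ → 1ℤ) ≡ ℤ.+ length xs
    count []       = refl
    count (x ∷ xs) = cong (ℤ._+_ 1ℤ) (count xs)

  ∑-bound : ∀ {P : A → Set} (P? : Decidable P) (xs : List A) (φ : A → ℤ) B →
    (∀ x → ¬ P x → φ x ≡ 0ℤ) → (∀ x → ∣ φ x ∣ ≤ B) → ∣ ∑ xs φ ∣ ≤ length (filter P? xs) ℕ.* B
  ∑-bound P? []       φ B off on = z≤n
  ∑-bound P? (x ∷ xs) φ B off on with P? x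
  ... | yes _ = ℕₚ.≤-trans (ℤₚ.∣i+j∣≤∣i∣+∣j∣ (φ x) (∑ xs φ)) (ℕₚ.+-mono-≤ (on x) (∑-bound P? xs φ B off on))
  ... | no ¬p rewrite off x ¬p | ℤₚ.+-identityˡ (∑ xs φ) = ∑-bound P? xs φ B off on

  ∑-signs : ∀ (φ : A → ℤ) → (∀ x → φ x ≡ 0ℤ ⊎ φ x ≡ 1ℤ ⊎ φ x ≡ -1ℤ) → ∀ xs →
    let N₊ = length (filter (λ x → φ x ℤ.≟ 1ℤ) xs)
        N₋ = length (filter (λ x → φ x ℤ.≟ -1ℤ) xs)
        N₀ = length (filter (λ x → φ x ℤ.≟ 0ℤ) xs)
    in ∑ xs φ ≡ ℤ.+ N₊ ℤ.- ℤ.+ N₋ × length xs ≡ N₊ ℕ.+ N₋ ℕ.+ N₀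
  ∑-signs φ values []       = refl , refl
  ∑-signs φ values (x ∷ xs) with ∑-signs φ values xs | values x
  ... | sum , len | inj₁ e rewrite e = trans (ℤₚ.+-identityˡ _) sum , trans (cong suc len) (sym (ℕₚ.+-suc _ _))
  ... | sum , len | inj₂ (inj₁ e) rewrite e = trans (cong (ℤ._+_ 1ℤ) sum) (sym (ℤₚ.+-assoc 1ℤ (ℤ.+ N₊) (ℤ.- (ℤ.+ N₋)))) , cong suc len
    where
    N₊ N₋ : ℕ
    N₊ = length (filter (λ x → φ x ℤ.≟ 1ℤ) xs)
    N₋ = length (filter (λ x → φ x ℤ.≟ -1ℤ) xs)
  ... | sum , len | inj₂ (inj₂ e) rewrite e = trans (cong (ℤ._+_ -1ℤ) sum)
      (solve 2 (λ a b → con -1ℤ :+ (a :- b) := a :- (con 1ℤ :+ b)) refl (ℤ.+ N₊) (ℤ.+ N₋))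
    , trans (cong suc len) (cong (ℕ._+ N₀) (sym (ℕₚ.+-suc N₊ N₋)))
    where
    open Data.Integer.Solver.+-*-Solver
    N₊ N₋ N₀ : ℕ
    N₊ = length (filter (λ x → φ x ℤ.≟ 1ℤ) xs)
    N₋ = length (filter (λ x → φ x ℤ.≟ -1ℤ) xs)
    N₀ = length (filter (λ x → φ x ℤ.≟ 0ℤ) xs)

∣-∣-bound : ∀ w a b C → w ℕ.* a ≤ w ℕ.* b ℕ.+ C → w ℕ.* b ≤ w ℕ.* a ℕ.+ C → w ℕ.* ∣ ℤ.+ a ℤ.- ℤ.+ b ∣ ≤ C
∣-∣-bound w a b C a≤ b≤ with ℕₚ.≤-total b a
... | inj₁ b≤a = subst (λ z → w ℕ.* z ≤ C) (sym (cong ∣_∣ (trans (ℤₚ.m-n≡m⊖n a b) (ℤₚ.⊖-≥ b≤a))))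
  (ℕₚ.≤-trans (ℕₚ.≤-reflexive (ℕₚ.*-distribˡ-∸ w a b)) (ℕₚ.m≤n+o⇒m∸n≤o (w ℕ.* a) (w ℕ.* b) a≤))
... | inj₂ a≤b = subst (λ z → w ℕ.* z ≤ C) (sym (trans (cong ∣_∣ (trans (ℤₚ.m-n≡m⊖n a b) (ℤₚ.⊖-≤ a≤b))) (ℤₚ.∣-i∣≡∣i∣ (ℤ.+ (b ℕ.∸ a)))))
  (ℕₚ.≤-trans (ℕₚ.≤-reflexive (ℕₚ.*-distribˡ-∸ w b a)) (ℕₚ.m≤n+o⇒m∸n≤o (w ℕ.* b) (w ℕ.* a) b≤))

-- Sign patterns through character sums.

module SignPatterns {q : ℕ} (K : FiniteField q) (k : ℕ) (q≡4k+3 : q ≡ suc (suc (k ℕ.+ k) ℕ.+ suc (k ℕ.+ k))) where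
  open FieldFacts K
  open Polynomials K
  open QuadraticCharacter K k q≡4k+3
  open EvF using (ev; ev-mulL)

  Condition : Set
  Condition = List F × ℤ

  Holds : F → Condition → Set
  Holds t (f , s) = η (ev f t) ≡ s

  -- Where no f vanishes, this is 2^n times the indicator of the prescribed pattern of n signs.
  weight : List Condition → F → ℤ
  weight []              t = 1ℤ
  weight ((f , s) ∷ cs)  t = (1ℤ ℤ.+ s ℤ.* η (ev f t)) ℤ.* weight cs t

  -- A partially expanded product: `g` collects the factors already taken, `cs` holds the conditions
  -- still to be expanded.
  characterSum : List F → List Condition → ℤ
  characterSum g cs = ∑ elements (λ t → η (ev g t) ℤ.* weight cs t)

  characterSum-∷ : ∀ g f s cs → characterSum g ((f , s) ∷ cs) ≡ characterSum g cs ℤ.+ s ℤ.* characterSum (mulL g f) cs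
  characterSum-∷ g f s cs = trans (∑-cong elements pointwise)
    (∑-linear elements (λ t → η (ev g t) ℤ.* weight cs t) (λ t → η (ev (mulL g f) t) ℤ.* weight cs t) s)
    where
    open Data.Integer.Solver.+-*-Solver
    pointwise : ∀ t → η (ev g t) ℤ.* ((1ℤ ℤ.+ s ℤ.* η (ev f t)) ℤ.* weight cs t) ≡
                      η (ev g t) ℤ.* weight cs t ℤ.+ s ℤ.* (η (ev (mulL g f) t) ℤ.* weight cs t)
    pointwise t rewrite ev-mulL g f t | η-* (ev g t) (ev f t) =
      solve 4 (λ a b s w → a :* ((con 1ℤ :+ s :* b) :* w) := a :* w :+ s :* ((a :* b) :* w)) refl (η (ev g t)) (η (ev f t)) s (weight cs t)

  ∣sign*∣ : ∀ {s} → IsSign s → ∀ i → ∣ s ℤ.* i ∣ ≡ ∣ i ∣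
  ∣sign*∣ (inj₁ refl) i = cong ∣_∣ (ℤₚ.*-identityˡ i)
  ∣sign*∣ (inj₂ refl) i = trans (cong ∣_∣ (ℤₚ.-1*i≡-i i)) (ℤₚ.∣-i∣≡∣i∣ i)

  Signs : List Condition → Set
  Signs = All (IsSign ∘ proj₂)

  -- A single sum is bounded by the fraction C/w, and multiplying by w keeps everything in ℕ. `Good`
  -- is the invariant of the expansion: it survives leaving out or taking the next factor, and
  -- yields the bound when none is left.
  module _ (w C : ℕ) (Good : List F → List Condition → Set)
    (skip : ∀ {g c cs} → Good g (c ∷ cs) → Good g cs)
    (take : ∀ {g f s cs} → Good g ((f , s) ∷ cs) → Good (mulL g f) cs)
    (bound : ∀ {g} → Good g [] → w ℕ.* ∣ characterSum g [] ∣ ≤ C) where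

    good-bound : ∀ cs → Signs cs → ∀ {g} → Good g cs → w ℕ.* ∣ characterSum g cs ∣ ≤ 2 ℕ.^ length cs ℕ.* C
    good-bound []             _        G = ℕₚ.≤-trans (bound G) (ℕₚ.≤-reflexive (sym (ℕₚ.*-identityˡ C)))
    good-bound ((f , s) ∷ cs) (is ∷ ss) {g} G = begin
      w ℕ.* ∣ characterSum g ((f , s) ∷ cs) ∣ ≡⟨ cong (λ z → w ℕ.* ∣ z ∣) (characterSum-∷ g f s cs) ⟩
      w ℕ.* ∣ S ℤ.+ s ℤ.* S′ ∣                                           ≤⟨ ℕₚ.*-monoʳ-≤ w (ℤₚ.∣i+j∣≤∣i∣+∣j∣ S (s ℤ.* S′)) ⟩
      w ℕ.* (∣ S ∣ ℕ.+ ∣ s ℤ.* S′ ∣) ≡⟨ cong (λ z → w ℕ.* (∣ S ∣ ℕ.+ z)) (∣sign*∣ is S′) ⟩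
      w ℕ.* (∣ S ∣ ℕ.+ ∣ S′ ∣)                                           ≡⟨ ℕₚ.*-distribˡ-+ w ∣ S ∣ ∣ S′ ∣ ⟩
      w ℕ.* ∣ S ∣ ℕ.+ w ℕ.* ∣ S′ ∣ ≤⟨ ℕₚ.+-mono-≤ (good-bound cs ss (skip G)) (good-bound cs ss (take G)) ⟩
      2 ℕ.^ length cs ℕ.* C ℕ.+ 2 ℕ.^ length cs ℕ.* C ≡⟨ solve 2 (λ p C → p :* C :+ p :* C := (p :+ (p :+ con 0)) :* C) refl (2 ℕ.^ length cs) C ⟩
      2 ℕ.^ suc (length cs) ℕ.* C                                        ∎
      where
      open ℕₚ.≤-Reasoning
      open Data.Nat.Solver.+-*-Solver
      S S′ : ℤ
      S  = characterSum g cs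
      S′ = characterSum (mulL g f) cs

    -- Every nontrivial product is filed under the first factor it takes, and `Good` starts there.
    GoodTails : List Condition → Set
    GoodTails []             = ⊤
    GoodTails ((f , s) ∷ cs) = Good (mulL (1# ∷ []) f) cs × GoodTails cs

    -- The empty product contributes q. The products whose first factor is followed by m conditions
    -- cost 2^m C, and these costs add up to less than 2^n C.
    main-term : ∀ cs → Signs cs → GoodTails cs → w ℕ.* q ≤ w ℕ.* ∣ characterSum (1# ∷ []) cs ∣ ℕ.+ 2 ℕ.^ length cs ℕ.* C
    main-term [] _ _ = ℕₚ.≤-trans (ℕₚ.*-monoʳ-≤ w (ℕₚ.≤-reflexive (sym (trans (∑-1 elements one) length-elements)))) (ℕₚ.m≤m+n _ _)
      where
      one : ∀ t → η (ev (1# ∷ []) t) ℤ.* 1ℤ ≡ 1ℤ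
      one t = trans (ℤₚ.*-identityʳ _) (trans (cong η (trans (cong (1# +_) (zeroʳ t)) (+-identityʳ 1#))) η-one)
    main-term ((f , s) ∷ cs) (is ∷ ss) (G , Gs) = begin
      w ℕ.* q                                                      ≤⟨ main-term cs ss Gs ⟩
      w ℕ.* ∣ S ∣ ℕ.+ P ℕ.* C                                      ≤⟨ ℕₚ.+-monoˡ-≤ (P ℕ.* C) (ℕₚ.*-monoʳ-≤ w triangle) ⟩
      w ℕ.* (∣ T ∣ ℕ.+ ∣ S′ ∣) ℕ.+ P ℕ.* C                         ≡⟨ cong (ℕ._+ P ℕ.* C) (ℕₚ.*-distribˡ-+ w ∣ T ∣ ∣ S′ ∣) ⟩
      w ℕ.* ∣ T ∣ ℕ.+ w ℕ.* ∣ S′ ∣ ℕ.+ P ℕ.* C ≤⟨ ℕₚ.+-monoˡ-≤ (P ℕ.* C) (ℕₚ.+-monoʳ-≤ (w ℕ.* ∣ T ∣) (good-bound cs ss G)) ⟩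
      w ℕ.* ∣ T ∣ ℕ.+ P ℕ.* C ℕ.+ P ℕ.* C ≡⟨ solve 3 (λ a p C → a :+ p :* C :+ p :* C := a :+ (p :+ (p :+ con 0)) :* C) refl (w ℕ.* ∣ T ∣) P C ⟩
      w ℕ.* ∣ T ∣ ℕ.+ 2 ℕ.^ suc (length cs) ℕ.* C                  ∎
      where
      open ℕₚ.≤-Reasoning
      open Data.Nat.Solver.+-*-Solver
      S S′ T : ℤ
      S  = characterSum (1# ∷ []) cs
      S′ = characterSum (mulL (1# ∷ []) f) cs
      T  = characterSum (1# ∷ []) ((f , s) ∷ cs)
      P : ℕ
      P = 2 ℕ.^ length cs
      triangle : ∣ S ∣ ≤ ∣ T ∣ ℕ.+ ∣ S′ ∣
      triangle = ℕₚ.≤-trans (ℕₚ.≤-reflexive (cong ∣_∣ (trans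
          (ℤS.solve 2 (λ a b → a ℤS.:= (a ℤS.:+ b) ℤS.:- b) refl S (s ℤ.* S′))
          (cong (ℤ._- (s ℤ.* S′)) (sym (characterSum-∷ (1# ∷ []) f s cs))))))
        (ℕₚ.≤-trans (ℤₚ.∣i-j∣≤∣i∣+∣j∣ T (s ℤ.* S′)) (ℕₚ.≤-reflexive (cong (∣ T ∣ ℕ.+_) (∣sign*∣ is S′))))
        where module ℤS = Data.Integer.Solver.+-*-Solver

    weight-bound : ∀ cs → Signs cs → ∀ t → ∣ weight cs t ∣ ≤ 2 ℕ.^ length cs
    weight-bound []             _         t = ℕₚ.≤-refl
    weight-bound ((f , s) ∷ cs) (is ∷ ss) t = ℕₚ.≤-trans (ℕₚ.≤-reflexive (ℤₚ.abs-* (1ℤ ℤ.+ s ℤ.* η (ev f t)) (weight cs t)))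
      (ℕₚ.*-mono-≤ (ℕₚ.≤-trans (ℤₚ.∣i+j∣≤∣i∣+∣j∣ 1ℤ (s ℤ.* η (ev f t))) (s≤s (ℕₚ.≤-trans (ℕₚ.≤-reflexive (∣sign*∣ is (η (ev f t)))) (∣η∣≤1 (ev f t)))))
        (weight-bound cs ss t))
      where
      ∣η∣≤1 : ∀ x → ∣ η x ∣ ≤ 1
      ∣η∣≤1 x with ηview x
      ... | is-zero _ e     rewrite e = z≤n
      ... | is-square _ _ e rewrite e = ℕₚ.≤-refl
      ... | nonsquare _ _ e rewrite e = ℕₚ.≤-refl

    weight-0 : ∀ cs → Signs cs → ∀ t → All (λ c → ev (proj₁ c) t ≢ 0#) cs → weight cs t ≡ 0ℤ ⊎ All (Holds t) cs
    weight-0 []             _         t _         = inj₂ []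
    weight-0 ((f , s) ∷ cs) (is ∷ ss) t (≢0 ∷ ≢0s) with weight-0 cs ss t ≢0s
    ... | inj₁ e rewrite e = inj₁ (ℤₚ.*-zeroʳ (1ℤ ℤ.+ s ℤ.* η (ev f t)))
    ... | inj₂ hs with is | η-sign ≢0
    ...   | inj₁ refl | inj₁ e = inj₂ (e ∷ hs)
    ...   | inj₂ refl | inj₂ e = inj₂ (e ∷ hs)
    ...   | inj₁ refl | inj₂ e rewrite e = inj₁ refl
    ...   | inj₂ refl | inj₁ e rewrite e = inj₁ refl

    -- Where some f vanishes the weight is only known to be at most 2^n; such points are collected
    -- in `Bad`. If the weight were zero at all others, the total would fall short of the main term.
    attained : ∀ cs → Signs cs → GoodTails cs → {Bad : F → Set} (Bad? : Decidable Bad) →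
      (∀ t → ¬ Bad t → All (λ c → ev (proj₁ c) t ≢ 0#) cs) →
      w ℕ.* (length (filter Bad? elements) ℕ.* 2 ℕ.^ length cs) ℕ.+ 2 ℕ.^ length cs ℕ.* C < w ℕ.* q →
      ∃ λ t → ¬ Bad t × All (Holds t) cs
    attained cs ss Gs {Bad} Bad? nonzero large with search elements
      where
      search : ∀ ts → (∃ λ t → ¬ Bad t × All (Holds t) cs) ⊎ All (λ t → ¬ Bad t → weight cs t ≡ 0ℤ) ts
      search [] = inj₂ []
      search (t ∷ ts) with search ts
      ... | inj₁ found = inj₁ found
      ... | inj₂ none with Bad? t
      ...   | yes bad = inj₂ (contradiction bad ∷ none)
      ...   | no ¬bad with weight-0 cs ss t (nonzero t ¬bad)
      ...     | inj₁ e  = inj₂ ((λ _ → e) ∷ none)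
      ...     | inj₂ hs = inj₁ (t , ¬bad , hs)
    ... | inj₁ found = found
    ... | inj₂ none = ⊥-elim (ℕₚ.<⇒≱ large (ℕₚ.≤-trans (main-term cs ss Gs) (ℕₚ.+-monoˡ-≤ (2 ℕ.^ length cs ℕ.* C) (ℕₚ.*-monoʳ-≤ w
        (∑-bound Bad? elements (λ t → η (ev (1# ∷ []) t) ℤ.* weight cs t) (2 ℕ.^ length cs) off on)))))
      where
      simplify : ∀ t → η (ev (1# ∷ []) t) ℤ.* weight cs t ≡ weight cs t
      simplify t = trans (cong (λ z → η z ℤ.* weight cs t) (trans (cong (1# +_) (zeroʳ t)) (+-identityʳ 1#)))
        (trans (cong (ℤ._* weight cs t) η-one) (ℤₚ.*-identityˡ _))
      off : ∀ t → ¬ Bad t → η (ev (1# ∷ []) t) ℤ.* weight cs t ≡ 0ℤ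
      off t ¬bad = trans (simplify t) (All.lookup none (∈-elements t) ¬bad)
      on : ∀ t → ∣ η (ev (1# ∷ []) t) ℤ.* weight cs t ∣ ≤ 2 ℕ.^ length cs
      on t = ℕₚ.≤-trans (ℕₚ.≤-reflexive (cong ∣_∣ (simplify t))) (weight-bound cs ss t)

-- The bound for one character sum.

module CharacterSumBound {q : ℕ} (K : FiniteField q) (k : ℕ) (q≡4k+3 : q ≡ suc (suc (k ℕ.+ k) ℕ.+ suc (k ℕ.+ k)))
  {p n : ℕ} (pr : Prime p) (q≡pⁿ : q ≡ p ℕ.^ n)
  (R w j : ℕ) (R+15≡2k : R ℕ.+ 15 ≡ k ℕ.+ k) (2w≤q : w ℕ.+ w ≤ q)
  (w-small : w ℕ.* suc (j ℕ.+ 63 ℕ.* w) < j ℕ.* R) where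
  open FieldFacts K
  open PowerSeries K
  open Polynomials K
  open Stepanov K
  open QuadraticCharacter K k q≡4k+3
  open SignPatterns K k q≡4k+3
  open EvF using (ev)
  open EvS using () renaming (ev to evˢ)

  -- `vanish-everywhere` with multiplicity 1 and step 1; the value at 0 certifies that r is not the
  -- zero polynomial.
  zeros-bound : ∀ r d → length r ≤ suc d → (ev r 0# ≢ 0#) → ∀ xs → Unique xs → All (λ x → ev r x ≡ 0#) xs → length xs ≤ d
  zeros-bound r d len r0≢0 []       _    _     = z≤n
  zeros-bound r d len r0≢0 (x ∷ xs) uniq zeros with length (x ∷ xs) ℕₚ.≤? d
  ... | yes ≤d = ≤d
  ... | no  ≰d = contradiction (trans (sym (ev-X-zero r)) (r≋0 0)) r0≢0
    where
    vanishes : ∀ {z} → ev r z ≡ 0# → VanishesAt r (λ _ → 1#) 1 z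
    vanishes {z} e zero    _        = trans (ev-line-zero r z 1#) e
    vanishes {z} e (suc i) (s≤s ())
    r≋0 : evˢ r X ≋ 𝟘
    r≋0 = vanish-everywhere (λ _ → 1#) 1 _ r refl 1 x xs (All.universal (λ _ → 0≢1 ∘ sym) (x ∷ xs)) uniq
      (vanishes (All.head zeros)) (All.map vanishes (All.tail zeros))
      (ℕₚ.≤-trans len (ℕₚ.≤-trans (ℕₚ.≰⇒> ≰d) (ℕₚ.≤-reflexive (cong suc (sym (ℕₚ.*-identityʳ (length xs)))))))

  private
    open Data.Nat.Solver.+-*-Solver

    -- A count N with N ℓ ≤ (17 + J) q satisfies N ≤ q/2 + (17 + j) q/(2 w): J is half of ℓ up to
    -- the small excess j.
    ℓ J : ℕ
    ℓ = w ℕ.+ w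
    J = w ℕ.+ j

    -- 2 w R occurs on both sides, and what remains is twice `w-small`; the 63 w there is 62 w from
    -- 31 ℓ plus one w from J.
    few : ℓ ℕ.* suc (R ℕ.+ J ℕ.+ ℓ ℕ.* 31) < J ℕ.* (R ℕ.+ R)
    few = begin-strict
      ℓ ℕ.* suc (R ℕ.+ J ℕ.+ ℓ ℕ.* 31)
        ≡⟨ solve 3 (λ w j R → (w :+ w) :* (con 1 :+ (R :+ (w :+ j) :+ (w :+ w) :* con 31)) := w :* (con 1 :+ (j :+ con 63 :* w)) :+ w :* (con 1 :+ (j :+ con 63 :* w)) :+ (w :* R :+ w :* R)) refl w j R ⟩
      w ℕ.* suc (j ℕ.+ 63 ℕ.* w) ℕ.+ w ℕ.* suc (j ℕ.+ 63 ℕ.* w) ℕ.+ (w ℕ.* R ℕ.+ w ℕ.* R)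
        <⟨ ℕₚ.+-monoˡ-< _ (ℕₚ.+-mono-< w-small w-small) ⟩
      j ℕ.* R ℕ.+ j ℕ.* R ℕ.+ (w ℕ.* R ℕ.+ w ℕ.* R)
        ≡⟨ solve 3 (λ w j R → j :* R :+ j :* R :+ (w :* R :+ w :* R) := (w :+ j) :* (R :+ R)) refl w j R ⟩
      J ℕ.* (R ℕ.+ R) ∎
      where open ℕₚ.≤-Reasoning

    -- An equality: R = 2 k - 15 is as large as a polynomial f with 33 coefficients permits.
    small : R ℕ.+ R ℕ.+ 33 ≤ q
    small = ℕₚ.≤-reflexive (trans (solve 1 (λ R → R :+ R :+ con 33 := con 1 :+ (con 1 :+ (R :+ con 15) :+ (con 1 :+ (R :+ con 15)))) refl R)
      (trans (cong (λ z → suc (suc z ℕ.+ suc z)) R+15≡2k) (sym q≡4k+3)))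

    -- 32 h is about 16 q, coming from f^h, and the remaining q covers R.
    degree-bound : suc (h ℕ.* 32 ℕ.+ R) ≤ 17 ℕ.* q
    degree-bound = begin
      suc (h ℕ.* 32 ℕ.+ R)                       ≤⟨ ℕₚ.m≤m+n _ (16 ℕ.+ h ℕ.+ h ℕ.∸ R) ⟩
      suc (h ℕ.* 32 ℕ.+ R) ℕ.+ (16 ℕ.+ h ℕ.+ h ℕ.∸ R) ≡⟨ eq ⟩
      17 ℕ.* suc (h ℕ.+ h)                       ≡⟨ cong (17 ℕ.*_) q≡4k+3 ⟨
      17 ℕ.* q                                   ∎
      where
      open ℕₚ.≤-Reasoning
      R≤ : R ≤ 16 ℕ.+ h ℕ.+ h
      R≤ = ℕₚ.≤-trans (ℕₚ.m≤m+n R 15) (ℕₚ.≤-trans (ℕₚ.≤-reflexive R+15≡2k) (ℕₚ.≤-trans (ℕₚ.n≤1+n (k ℕ.+ k)) (ℕₚ.m≤n+m h (16 ℕ.+ h))))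
      eq : suc (h ℕ.* 32 ℕ.+ R) ℕ.+ (16 ℕ.+ h ℕ.+ h ℕ.∸ R) ≡ 17 ℕ.* suc (h ℕ.+ h)
      eq = trans (solve 3 (λ h R x → con 1 :+ (h :* con 32 :+ R) :+ x := con 1 :+ h :* con 32 :+ (R :+ x)) refl h R (16 ℕ.+ h ℕ.+ h ℕ.∸ R))
        (trans (cong (suc (h ℕ.* 32) ℕ.+_) (ℕₚ.m+[n∸m]≡n R≤))
          (solve 1 (λ h → con 1 :+ h :* con 32 :+ (con 16 :+ h :+ h) := con 17 :* (con 1 :+ (h :+ h))) refl h))

  module _ (f : List F) (len-f : length f ≤ 33) (f-notSquare : NotSquare R (evˢ f X)) (f0≢0 : ev f 0# ≢ 0#) where
    private
      φ : F → ℤ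
      φ = η ∘ ev f

      values : ∀ x → φ x ≡ 0ℤ ⊎ φ x ≡ 1ℤ ⊎ φ x ≡ -1ℤ
      values x with ηview (ev f x)
      ... | is-zero _ e     = inj₁ e
      ... | is-square _ _ e = inj₂ (inj₁ e)
      ... | nonsquare _ _ e = inj₂ (inj₂ e)

      count : ℤ → ℕ
      count s = length (filter (λ x → φ x ℤ.≟ s) elements)

      unique : ∀ s → Unique (filter (λ x → φ x ℤ.≟ s) elements)
      unique s = Uniqueₚ.filter⁺ (λ x → φ x ℤ.≟ s) elements-unique

      hits : ∀ s → All (λ x → φ x ≡ s) (filter (λ x → φ x ℤ.≟ s) elements)
      hits s = Allₚ.all-filter (λ x → φ x ℤ.≟ s) elements

      count-± : ∀ s a → (∀ {x} → φ x ≡ s → ev f x ≢ 0# × ev f x ^ h ≡ a) → count s ℕ.* ℓ ≤ 17 ℕ.* q ℕ.+ J ℕ.* q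
      count-± s a to-power = ℕₚ.≤-trans
        (stepanov {n = n} pr q≡pⁿ 31 h R q≡4k+3 small f len-f f-notSquare a ℓ J 2w≤q few _ (unique s) (All.map to-power (hits s)))
        (ℕₚ.+-monoˡ-≤ (J ℕ.* q) degree-bound)

      count-1 : count 1ℤ ℕ.* ℓ ≤ 17 ℕ.* q ℕ.+ J ℕ.* q
      count-1 = count-± 1ℤ 1# λ {x} → go x
        where
        go : ∀ x → φ x ≡ 1ℤ → ev f x ≢ 0# × ev f x ^ h ≡ 1#
        go x e with ηview (ev f x)
        ... | is-zero _ e′ with () ← trans (sym e) e′
        ... | is-square ≢0 p _ = ≢0 , p
        ... | nonsquare _ _ e′ with () ← trans (sym e) e′

      count--1 : count -1ℤ ℕ.* ℓ ≤ 17 ℕ.* q ℕ.+ J ℕ.* q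
      count--1 = count-± -1ℤ (- 1#) λ {x} → go x
        where
        go : ∀ x → φ x ≡ -1ℤ → ev f x ≢ 0# × ev f x ^ h ≡ - 1#
        go x e with ηview (ev f x)
        ... | is-zero _ e′ with () ← trans (sym e) e′
        ... | nonsquare ≢0 p _ = ≢0 , p
        ... | is-square _ _ e′ with () ← trans (sym e) e′

      count-0 : count 0ℤ ≤ 32
      count-0 = zeros-bound f 32 len-f f0≢0 _ (unique 0ℤ) (All.map (λ {x} → go x) (hits 0ℤ))
        where
        go : ∀ x → φ x ≡ 0ℤ → ev f x ≡ 0#
        go x e with ηview (ev f x)
        ... | is-zero x≡0 _ = x≡0
        ... | is-square _ _ e′ with () ← trans (sym e) e′
        ... | nonsquare _ _ e′ with () ← trans (sym e) e′

      C : ℕ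
      C = w ℕ.* 32 ℕ.+ (17 ℕ.+ j) ℕ.* q

      -- Replacing q by a + b + z in the term w q cancels one of the two copies of w a.
      balance : ∀ a b z → q ≡ a ℕ.+ b ℕ.+ z → z ≤ 32 → a ℕ.* ℓ ≤ 17 ℕ.* q ℕ.+ J ℕ.* q → w ℕ.* a ≤ w ℕ.* b ℕ.+ C
      balance a b z q≡ z≤ aℓ≤ = ℕₚ.+-cancelˡ-≤ (w ℕ.* a) _ _ (begin
        w ℕ.* a ℕ.+ w ℕ.* a ≡⟨ solve 2 (λ w a → w :* a :+ w :* a := a :* (w :+ w)) refl w a ⟩
        a ℕ.* ℓ                                                  ≤⟨ aℓ≤ ⟩
        17 ℕ.* q ℕ.+ (w ℕ.+ j) ℕ.* q ≡⟨ solve 3 (λ w j q → con 17 :* q :+ (w :+ j) :* q := w :* q :+ (con 17 :+ j) :* q) refl w j q ⟩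
        w ℕ.* q ℕ.+ (17 ℕ.+ j) ℕ.* q                             ≡⟨ cong (λ v → w ℕ.* v ℕ.+ (17 ℕ.+ j) ℕ.* q) q≡ ⟩
        w ℕ.* (a ℕ.+ b ℕ.+ z) ℕ.+ (17 ℕ.+ j) ℕ.* q ≤⟨ ℕₚ.+-monoˡ-≤ _ (ℕₚ.*-monoʳ-≤ w (ℕₚ.+-monoʳ-≤ (a ℕ.+ b) z≤)) ⟩
        w ℕ.* (a ℕ.+ b ℕ.+ 32) ℕ.+ (17 ℕ.+ j) ℕ.* q ≡⟨ solve 4 (λ w a b y → w :* (a :+ b :+ con 32) :+ y := w :* a :+ (w :* b :+ (w :* con 32 :+ y))) refl w a b ((17 ℕ.+ j) ℕ.* q) ⟩
        w ℕ.* a ℕ.+ (w ℕ.* b ℕ.+ C)                              ∎)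
        where open ℕₚ.≤-Reasoning

      total : q ≡ count 1ℤ ℕ.+ count -1ℤ ℕ.+ count 0ℤ
      total = trans (sym length-elements) (proj₂ (∑-signs φ values elements))

    characterSum-bound : w ℕ.* ∣ characterSum f [] ∣ ≤ w ℕ.* 32 ℕ.+ (17 ℕ.+ j) ℕ.* q
    characterSum-bound = subst (λ z → w ℕ.* ∣ z ∣ ≤ C)
      (sym (trans (∑-cong elements (λ t → ℤₚ.*-identityʳ (φ t))) (proj₁ (∑-signs φ values elements))))
      (∣-∣-bound w (count 1ℤ) (count -1ℤ) C
        (balance (count 1ℤ) (count -1ℤ) (count 0ℤ) total count-0 count-1)
        (balance (count -1ℤ) (count 1ℤ) (count 0ℤ) (trans total (cong (ℕ._+ count 0ℤ) (ℕₚ.+-comm (count 1ℤ) (count -1ℤ)))) count-0 count--1))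

module _ {A : Set} where

  length-filter-⊎ : ∀ {P Q R : A → Set} (P? : Decidable P) (Q? : Decidable Q) (R? : Decidable R) →
    (∀ {x} → R x → P x ⊎ Q x) → ∀ xs → length (filter R? xs) ≤ length (filter P? xs) ℕ.+ length (filter Q? xs)
  length-filter-⊎ P? Q? R? split [] = z≤n
  length-filter-⊎ P? Q? R? split (x ∷ xs) with R? x | P? x | Q? x | length-filter-⊎ P? Q? R? split xs
  ... | yes r | yes p | yes q | IH = s≤s (ℕₚ.≤-trans IH (ℕₚ.+-monoʳ-≤ _ (ℕₚ.n≤1+n _)))
  ... | yes r | yes p | no  _ | IH = s≤s IH
  ... | yes r | no  _ | yes q | IH = ℕₚ.≤-trans (s≤s IH) (ℕₚ.≤-reflexive (sym (ℕₚ.+-suc _ _)))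
  ... | yes r | no ¬p | no ¬q | IH with split r
  ...   | inj₁ p = contradiction p ¬p
  ...   | inj₂ q = contradiction q ¬q
  length-filter-⊎ P? Q? R? split (x ∷ xs) | no _ | yes p | yes q | IH = ℕₚ.m≤n⇒m≤1+n (ℕₚ.≤-trans IH (ℕₚ.+-monoʳ-≤ _ (ℕₚ.n≤1+n _)))
  length-filter-⊎ P? Q? R? split (x ∷ xs) | no _ | yes p | no  _ | IH = ℕₚ.m≤n⇒m≤1+n IH
  length-filter-⊎ P? Q? R? split (x ∷ xs) | no _ | no  _ | yes q | IH = ℕₚ.≤-trans IH (ℕₚ.+-monoʳ-≤ _ (ℕₚ.n≤1+n _))
  length-filter-⊎ P? Q? R? split (x ∷ xs) | no _ | no  _ | no  _ | IH = IH

-- Rotations of the conic and the resulting quadratics.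

module Conic {q : ℕ} (K : FiniteField q) (k : ℕ) (q≡4k+3 : q ≡ suc (suc (k ℕ.+ k) ℕ.+ suc (k ℕ.+ k))) where
  open FieldFacts K
  open PowerSeries K
  open Polynomials K
  open Degree K
  open QuadraticFactors K
  open QuadraticCharacter K k q≡4k+3
  open EvF using (ev)
  open EvS using () renaming (ev to evˢ)

  record Form : Set where
    constructor form
    field x y κ : F
  open Form

  norm : Form → F
  norm φ = x φ * x φ + y φ * y φ

  -- With N = 1 + t², the point (x, y) rotated by (1 − t²)/N, 2t/N has first coordinate
  -- x′ = (x (1 − t²) − 2 y t)/N, and the form below is N (x′ − κ).
  poly : Form → List F
  poly (form x y κ) = x - κ ∷ - (y + y) ∷ - (x + κ) ∷ []

  N : List F
  N = 1# ∷ 0# ∷ 1# ∷ []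

  -- A zero would make -1 a square. Hence the rotation is defined at every t.
  Nt≢0 : ∀ t → ev N t ≢ 0#
  Nt≢0 t e = 1≢-1 (trans (sym (square^h t≢0)) (trans (cong (_^ h) tt≡-1) -1^h))
    where
    open Solver
    tt≡-1 : t * t ≡ - 1#
    tt≡-1 = x-y≡0⇒x≡y (trans (solve 1 (λ t → t :* t :- (:- con 1ℤ) := con 1ℤ :+ t :* (con 0ℤ :+ t :* (con 1ℤ :+ t :* con 0ℤ))) refl t) e)
    t≢0 : t ≢ 0#
    t≢0 refl = -‿nonzero (0≢1 ∘ sym) (trans (sym tt≡-1) (zeroˡ 0#))

  rotate : F → F → F → F
  rotate t x y = (x * (1# - t * t) - (y + y) * t) * proj₁ (inverse (ev N t) (Nt≢0 t))

  rotate-spec : ∀ t x y → ev N t * rotate t x y ≡ x * (1# - t * t) - (y + y) * t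
  rotate-spec t x y = trans (solve 3 (λ n a i → n :* (a :* i) := a :* (n :* i)) refl (ev N t) _ _)
    (trans (cong ((x * (1# - t * t) - (y + y) * t) *_) (proj₂ (inverse (ev N t) (Nt≢0 t)))) (*-identityʳ _))
    where open Solver

  rotate-form : ∀ t x y κ → ev (poly (form x y κ)) t ≡ ev N t * (rotate t x y - κ)
  rotate-form t x y κ = sym (begin
    n * (rotate t x y - κ) ≡⟨ solve 3 (λ n a k → n :* (a :- k) := n :* a :- n :* k) refl n (rotate t x y) κ ⟩
    n * rotate t x y - n * κ                         ≡⟨ cong (_- n * κ) (rotate-spec t x y) ⟩
    x * (1# - t * t) - (y + y) * t - n * κ
      ≡⟨ solve 4 (λ t x y κ → x :* (con 1ℤ :- t :* t) :- (y :+ y) :* t :- (con 1ℤ :+ t :* (con 0ℤ :+ t :* (con 1ℤ :+ t :* con 0ℤ))) :* κ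
           := (x :- κ) :+ t :* ((:- (y :+ y)) :+ t :* ((:- (x :+ κ)) :+ t :* con 0ℤ))) refl t x y κ ⟩
    ev (poly (form x y κ)) t                         ∎)
    where
    open ≡-Reasoning
    open Solver
    n : F
    n = ev N t

  -- The second coordinate of the rotated point is the first coordinate belonging to (y, - x); this
  -- lets one shape of `Form` serve both r and r′.
  rotate-norm : ∀ t x y → rotate t x y * rotate t x y + rotate t y (- x) * rotate t y (- x) ≡ x * x + y * y
  rotate-norm t x y = *-cancelˡ (*-nonzero (Nt≢0 t) (Nt≢0 t)) (begin
    n * n * (a * a + b * b)
      ≡⟨ solve 3 (λ n a b → n :* n :* (a :* a :+ b :* b) := (n :* a) :* (n :* a) :+ (n :* b) :* (n :* b)) refl n a b ⟩
    (n * a) * (n * a) + (n * b) * (n * b)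
      ≡⟨ cong₂ (λ u v → u * u + v * v) (rotate-spec t x y) (rotate-spec t y (- x)) ⟩
    X₁ * X₁ + X₂ * X₂
      ≡⟨ solve 3 (λ t x y → (x :* (con 1ℤ :- t :* t) :- (y :+ y) :* t) :* (x :* (con 1ℤ :- t :* t) :- (y :+ y) :* t)
             :+ (y :* (con 1ℤ :- t :* t) :- ((:- x) :+ (:- x)) :* t) :* (y :* (con 1ℤ :- t :* t) :- ((:- x) :+ (:- x)) :* t)
           := (con 1ℤ :+ t :* (con 0ℤ :+ t :* (con 1ℤ :+ t :* con 0ℤ))) :* (con 1ℤ :+ t :* (con 0ℤ :+ t :* (con 1ℤ :+ t :* con 0ℤ))) :* (x :* x :+ y :* y)) refl t x y ⟩
    n * n * (x * x + y * y) ∎)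
    where
    open ≡-Reasoning
    open Solver
    n a b X₁ X₂ : F
    n = ev N t
    a = rotate t x y
    b = rotate t y (- x)
    X₁ = x * (1# - t * t) - (y + y) * t
    X₂ = y * (1# - t * t) - ((- x) + (- x)) * t

  -- `poly φ` gives N (x′ - κ). One more N turns this into N² (x′ - κ), which has the character of
  -- x′ - κ itself; this is why each condition has degree 4.
  η-rotate : ∀ t φ → η (ev (mulL (poly φ) N) t) ≡ η (rotate t (x φ) (y φ) - κ φ)
  η-rotate t (form x y κ) = begin
    η (ev (mulL (poly (form x y κ)) N) t)            ≡⟨ cong η (EvF.ev-mulL (poly (form x y κ)) N t) ⟩
    η (ev (poly (form x y κ)) t * n)                 ≡⟨ cong (λ z → η (z * n)) (rotate-form t x y κ) ⟩
    η (n * z * n)                                    ≡⟨ cong η (solve 2 (λ n z → n :* z :* n := (n :* n) :* z) refl n z) ⟩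
    η (n * n * z)                                    ≡⟨ η-* (n * n) z ⟩
    η (n * n) ℤ.* η z                                ≡⟨ cong (ℤ._* η z) (η-square (Nt≢0 t)) ⟩
    1ℤ ℤ.* η z                                       ≡⟨ ℤₚ.*-identityˡ (η z) ⟩
    η z                                              ∎
    where
    open ≡-Reasoning
    open Solver
    n z : F
    n = ev N t
    z = rotate t x y - κ

  IsRoot : F → Form → Set
  IsRoot t φ = ev (poly φ) t ≡ 0#

  isRoot? : ∀ t φ → Dec (IsRoot t φ)
  isRoot? t φ = ev (poly φ) t ≟ 0#

  root-difference : ∀ a b c t u → t ≢ u → ev (a ∷ b ∷ c ∷ []) t ≡ 0# → ev (a ∷ b ∷ c ∷ []) u ≡ 0# → b + c * (t + u) ≡ 0#
  root-difference a b c t u t≢u et eu = *-cancelˡ-0 {t - u} (λ e → t≢u (x-y≡0⇒x≡y e)) (trans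
    (solve 5 (λ a b c t u → (t :- u) :* (b :+ c :* (t :+ u)) := (a :+ t :* (b :+ t :* (c :+ t :* con 0ℤ))) :- (a :+ u :* (b :+ u :* (c :+ u :* con 0ℤ)))) refl a b c t u)
    (x≡y⇒x-y≡0 (trans et (sym eu))))
    where open Solver

  three-roots : ∀ a b c t u v → t ≢ u → t ≢ v → u ≢ v → ev (a ∷ b ∷ c ∷ []) t ≡ 0# → ev (a ∷ b ∷ c ∷ []) u ≡ 0# →
    ev (a ∷ b ∷ c ∷ []) v ≡ 0# → a ≡ 0# × b ≡ 0# × c ≡ 0#
  three-roots a b c t u v t≢u t≢v u≢v et eu e-v = a≡0 , b≡0 , c≡0
    where
    open Solver
    c≡0 : c ≡ 0#
    c≡0 = *-cancelˡ-0 {u - v} (λ e → u≢v (x-y≡0⇒x≡y e)) (trans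
      (solve 5 (λ b c t u v → (u :- v) :* c := (b :+ c :* (t :+ u)) :- (b :+ c :* (t :+ v))) refl b c t u v)
      (x≡y⇒x-y≡0 (trans (root-difference a b c t u t≢u et eu) (sym (root-difference a b c t v t≢v et e-v)))))
    b≡0 : b ≡ 0#
    b≡0 = trans (sym (+-identityʳ b)) (trans (cong (b +_) (sym (trans (cong (_* (t + u)) c≡0) (zeroˡ (t + u))))) (root-difference a b c t u t≢u et eu))
    a≡0 : a ≡ 0#
    a≡0 = trans (solve 2 (λ a t → a := a :+ t :* (con 0ℤ :+ t :* (con 0ℤ :+ t :* con 0ℤ))) refl a t)
      (trans (cong₂ (λ b c → a + t * (b + t * (c + t * 0#))) (sym b≡0) (sym c≡0)) et)

  quadratic-roots : ∀ a b c → ¬ (a ≡ 0# × b ≡ 0# × c ≡ 0#) → ∀ xs → Unique xs →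
    All (λ t → ev (a ∷ b ∷ c ∷ []) t ≡ 0#) xs → length xs ≤ 2
  quadratic-roots a b c abc≢0 []           _ _ = z≤n
  quadratic-roots a b c abc≢0 (_ ∷ [])     _ _ = s≤s z≤n
  quadratic-roots a b c abc≢0 (_ ∷ _ ∷ []) _ _ = s≤s (s≤s z≤n)
  quadratic-roots a b c abc≢0 (t ∷ u ∷ v ∷ _) ((t≢u ∷ t≢v ∷ _) ∷ (u≢v ∷ _) ∷ _) (et ∷ eu ∷ e-v ∷ _) =
    contradiction (three-roots a b c t u v t≢u t≢v u≢v et eu e-v) abc≢0

  poly-nonzero : ∀ φ → norm φ ≢ 0# → ¬ (x φ - κ φ ≡ 0# × - (y φ + y φ) ≡ 0# × - (x φ + κ φ) ≡ 0#)
  poly-nonzero (form x y κ) norm≢0 (e₀ , e₁ , e₂) = norm≢0 (begin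
    x * x + y * y    ≡⟨ cong₂ (λ a b → a * a + b * b) x≡0 y≡0 ⟩
    0# * 0# + 0# * 0#  ≡⟨ solve 0 (con 0ℤ :* con 0ℤ :+ con 0ℤ :* con 0ℤ := con 0ℤ) refl ⟩
    0#               ∎)
    where
    open ≡-Reasoning
    open Solver
    halve : ∀ {z} → z + z ≡ 0# → z ≡ 0#
    halve {z} e with z ≟ 0#
    ... | yes z≡0 = z≡0
    ... | no  z≢0 = contradiction e (x+x≢0 z≢0)
    y≡0 : y ≡ 0#
    y≡0 = halve (trans (sym (-‿involutive _)) (trans (cong -_ e₁) -0#≈0#))
    x≡0 : x ≡ 0#
    x≡0 = halve (trans (solve 2 (λ x κ → x :+ x := (x :- κ) :- (:- (x :+ κ))) refl x κ) (x≡y⇒x-y≡0 (trans e₀ (sym e₂))))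

  roots-count : ∀ φs → All (λ φ → norm φ ≢ 0#) φs → length (filter (λ t → Any.any? (isRoot? t) φs) elements) ≤ length φs ℕ.* 2
  roots-count [] _ = ℕₚ.≤-reflexive (cong length (none elements))
    where
    none : ∀ ts → filter (λ t → Any.any? (isRoot? t) []) ts ≡ []
    none []       = refl
    none (t ∷ ts) = none ts
  roots-count (φ ∷ φs) (norm≢0 ∷ norms≢0) = ℕₚ.≤-trans
    (length-filter-⊎ (λ t → isRoot? t φ) (λ t → Any.any? (isRoot? t) φs) (λ t → Any.any? (isRoot? t) (φ ∷ φs))
      (λ { (here e) → inj₁ e ; (there e) → inj₂ e }) elements)
    (ℕₚ.+-mono-≤ (quadratic-roots _ _ _ (poly-nonzero φ norm≢0) _ (Uniqueₚ.filter⁺ (λ t → isRoot? t φ) elements-unique)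
      (Allₚ.all-filter (λ t → isRoot? t φ) elements)) (roots-count φs norms≢0))

  non-root : ∀ φs → All (λ φ → norm φ ≢ 0#) φs → length φs ℕ.* 2 < q → ∃ λ t → ¬ Any (IsRoot t) φs
  non-root φs norms≢0 few with Any.any? (λ t → ¬? (Any.any? (isRoot? t) φs)) elements
  ... | yes found = Any.satisfied found
  ... | no none = contradiction (ℕₚ.≤-trans (ℕₚ.≤-reflexive (trans (sym length-elements) (sym (cong length all-roots)))) (roots-count φs norms≢0)) (ℕₚ.<⇒≱ few)
    where
    all-roots : filter (λ t → Any.any? (isRoot? t) φs) elements ≡ elements
    all-roots = filter-all (λ t → Any.any? (isRoot? t) φs)
      (All.map (λ {t} → decidable-stable (Any.any? (isRoot? t) φs)) (Allₚ.¬Any⇒All¬ elements none))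

  private
    a n : Series
    a = 𝟙 ⊕ ⊝ (X ⊛ X)
    n = 𝟙 ⊕ X ⊛ X

    coord formˢ : Series → Series → Series
    coord x y = x ⊛ a ⊕ ⊝ ((y ⊕ y) ⊛ X)
    formˢ p κ = p ⊕ ⊝ (κ ⊛ n)

    poly-series : ∀ x y κ → evˢ (poly (form x y κ)) X ≋ formˢ (coord ⌜ x ⌝ ⌜ y ⌝) ⌜ κ ⌝
    poly-series x y κ = S.trans (S.+-cong (S.trans (⌜⌝-+ x (- κ)) (S.+-congˡ {⌜ x ⌝} (⌜⌝-- κ)))
      (S.*-congˡ {X} (S.+-cong (S.trans (⌜⌝-- (y + y)) (S.-‿cong (⌜⌝-+ y y)))
        (S.*-congˡ {X} (S.+-congʳ {X ⊛ 𝟘} (S.trans (⌜⌝-- (x + κ)) (S.-‿cong (⌜⌝-+ x κ))))))))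
      (solve 4 (λ x y κ X → (x :- κ) :+ X :* ((:- (y :+ y)) :+ X :* ((:- (x :+ κ)) :+ X :* con 0ℤ))
        := (x :* (con 1ℤ :- X :* X) :- (y :+ y) :* X) :- κ :* (con 1ℤ :+ X :* X)) S.refl ⌜ x ⌝ ⌜ y ⌝ ⌜ κ ⌝ X)
      where open SeriesSolver

    Nˢ : Series
    Nˢ = evˢ N X

    N-series : Nˢ ≋ n
    N-series = S.trans (S.+-congˡ {𝟙} (S.*-congˡ {X} (S.+-congʳ {X ⊛ (𝟙 ⊕ X ⊛ 𝟘)} ⌜⌝-0)))
      (solve 1 (λ X → con 1ℤ :+ X :* (con 0ℤ :+ X :* (con 1ℤ :+ X :* con 0ℤ)) := con 1ℤ :+ X :* X) S.refl X)
      where open SeriesSolver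

    formˢ-cong : ∀ {p p′ κ κ′} → p ≋ p′ → κ ≋ κ′ → formˢ p κ ≋ formˢ p′ κ′
    formˢ-cong ep eκ = S.+-cong ep (S.-‿cong (S.*-congʳ {n} eκ))

    coord-norm : ∀ x y → coord x y ⊛ coord x y ⊕ coord y (⊝ x) ⊛ coord y (⊝ x) ≋ (x ⊛ x ⊕ y ⊛ y) ⊛ (n ⊛ n)
    coord-norm x y = S.trans
      (solve 4 (λ x y a X → (x :* a :- (y :+ y) :* X) :* (x :* a :- (y :+ y) :* X) :+ (y :* a :- ((:- x) :+ (:- x)) :* X) :* (y :* a :- ((:- x) :+ (:- x)) :* X)
        := (x :* x :+ y :* y) :* (a :* a :+ (X :+ X) :* (X :+ X))) S.refl x y a X)
      (S.*-congˡ {x ⊛ x ⊕ y ⊛ y} (solve 1 (λ X → (con 1ℤ :- X :* X) :* (con 1ℤ :- X :* X) :+ (X :+ X) :* (X :+ X) := (con 1ℤ :+ X :* X) :* (con 1ℤ :+ X :* X)) S.refl X))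
      where open SeriesSolver

  -- When two of the quadratics are coprime. On one coordinate the shifts must differ; across
  -- coordinates a common zero would force κ² + κ′² = r² + r′², which is the norm.
  data Separated : Form → Form → Set where
    same  : ∀ {x y κ κ′} → κ′ - κ ≢ 0# → Separated (form x y κ) (form x y κ′)
    cross : ∀ {x y κ κ′} → x * x + y * y - κ * κ - κ′ * κ′ ≢ 0# → Separated (form x y κ) (form y (- x) κ′)

  -- In turn: nonzero value at 0, true degree 2, coprimality to 1 + t², and separability, the
  -- discriminant being 4 (norm - κ²).
  record Regular (φ : Form) : Set where
    field
      minus≢0 : x φ - κ φ ≢ 0#
      plus≢0  : x φ + κ φ ≢ 0#
      norm≢0  : norm φ ≢ 0#
      disc≢0  : norm φ - κ φ * κ φ ≢ 0#

  module Coprime (φ : Form) (reg : Regular φ) where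
    open Regular reg
    open Form φ renaming (x to x₀; y to y₀; κ to κ₀)
    open Quadratic (x₀ - κ₀) (- (y₀ + y₀)) (- (x₀ + κ₀)) (-‿nonzero plus≢0) public

    discriminant≢0 : - (y₀ + y₀) * - (y₀ + y₀) - (1# + 1# + 1# + 1#) * ((x₀ - κ₀) * - (x₀ + κ₀)) ≢ 0#
    discriminant≢0 e = *-nonzero (*-nonzero 2≢0 2≢0) disc≢0 (trans
      (solve 3 (λ x y κ → (con 1ℤ :+ con 1ℤ) :* (con 1ℤ :+ con 1ℤ) :* (x :* x :+ y :* y :- κ :* κ)
        := (:- (y :+ y)) :* (:- (y :+ y)) :- (con 1ℤ :+ con 1ℤ :+ con 1ℤ :+ con 1ℤ) :* ((x :- κ) :* (:- (x :+ κ)))) refl x₀ y₀ κ₀) e)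
      where open Solver

    Cancelling : Series → Set
    Cancelling = Cancels discriminant≢0

    private
      cx cy cκ : Series
      cx = ⌜ x₀ ⌝
      cy = ⌜ y₀ ⌝
      cκ = ⌜ κ₀ ⌝

      Q≋ : Q ≋ formˢ (coord cx cy) cκ
      Q≋ = poly-series x₀ y₀ κ₀

      norm-series : ⌜ norm φ ⌝ ≋ cx ⊛ cx ⊕ cy ⊛ cy
      norm-series = S.trans (⌜⌝-+ (x₀ * x₀) (y₀ * y₀)) (S.+-cong (⌜⌝-* x₀ x₀) (⌜⌝-* y₀ y₀))

    -- (x + y t) Q + (2 y² + (x + κ)(x + y t)) N = 2 (x² + y²).
    cancels-N : Cancelling Nˢ
    cancels-N = Cancels-Bézout discriminant≢0 {Nˢ} A B ⌜ norm φ + norm φ ⌝ pA pB bezout (Cancels-⌜⌝ discriminant≢0 (x+x≢0 norm≢0))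
      where
      open ≋-Reasoning
      A B : Series
      A = cx ⊕ cy ⊛ X
      B = cy ⊛ cy ⊕ cy ⊛ cy ⊕ (cx ⊕ cκ) ⊛ A
      pA : IsPoly A
      pA = IsPoly-line x₀ y₀
      pB : IsPoly B
      pB = IsPoly-⊕ (IsPoly-⊕ (IsPoly-⊛ (IsPoly-⌜⌝ y₀) (IsPoly-⌜⌝ y₀)) (IsPoly-⊛ (IsPoly-⌜⌝ y₀) (IsPoly-⌜⌝ y₀)))
        (IsPoly-⊛ (IsPoly-⊕ (IsPoly-⌜⌝ x₀) (IsPoly-⌜⌝ κ₀)) pA)
      bezout : A ⊛ Q ⊕ B ⊛ Nˢ ≋ ⌜ norm φ + norm φ ⌝
      bezout = begin
        A ⊛ Q ⊕ B ⊛ Nˢ                                 ≈⟨ S.+-cong (S.*-congˡ {A} Q≋) (S.*-congˡ {B} N-series) ⟩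
        A ⊛ formˢ (coord cx cy) cκ ⊕ B ⊛ n
          ≈⟨ solve 4 (λ x y κ X → (x :+ y :* X) :* ((x :* (con 1ℤ :- X :* X) :- (y :+ y) :* X) :- κ :* (con 1ℤ :+ X :* X))
               :+ (y :* y :+ y :* y :+ (x :+ κ) :* (x :+ y :* X)) :* (con 1ℤ :+ X :* X)
               := (x :* x :+ y :* y) :+ (x :* x :+ y :* y)) S.refl cx cy cκ X ⟩
        (cx ⊛ cx ⊕ cy ⊛ cy) ⊕ (cx ⊛ cx ⊕ cy ⊛ cy) ≈⟨ S.trans (⌜⌝-+ (norm φ) (norm φ)) (S.+-cong norm-series norm-series) ⟨
        ⌜ norm φ + norm φ ⌝                            ∎
        where open SeriesSolver

    -- Same coordinate: the two quadratics differ by (κ′ - κ) N. Across: they are p - κ N and p′ -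
    -- κ′ N with p² + p′² = (x² + y²) N², so multiplying them by p + κ N and p′ + κ′ N and adding
    -- gives (x² + y² - κ² - κ′²) N².
    cancels-poly : ∀ {ψ} → Separated φ ψ → Cancelling (evˢ (poly ψ) X)
    cancels-poly (same {κ′ = κ′} κ≢) = Cancels-Bézout discriminant≢0 𝟙 (⊝ 𝟙) (⌜ κ′ - κ₀ ⌝ ⊛ Nˢ) (IsPoly-⌜⌝ 1#) (IsPoly-⊝ (IsPoly-⌜⌝ 1#)) (begin
        𝟙 ⊛ Q ⊕ ⊝ 𝟙 ⊛ evˢ (poly (form x₀ y₀ κ′)) X ≈⟨ S.+-cong (S.*-congˡ {𝟙} Q≋) (S.*-congˡ {⊝ 𝟙} (poly-series x₀ y₀ κ′)) ⟩
        𝟙 ⊛ formˢ (coord cx cy) cκ ⊕ ⊝ 𝟙 ⊛ formˢ (coord cx cy) ⌜ κ′ ⌝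
          ≈⟨ solve 4 (λ p κ λ′ n → con 1ℤ :* (p :- κ :* n) :+ (:- con 1ℤ) :* (p :- λ′ :* n) := (λ′ :- κ) :* n) S.refl (coord cx cy) cκ ⌜ κ′ ⌝ n ⟩
        (⌜ κ′ ⌝ ⊕ ⊝ cκ) ⊛ n ≈⟨ S.*-cong (S.trans (⌜⌝-+ κ′ (- κ₀)) (S.+-congˡ {⌜ κ′ ⌝} (⌜⌝-- κ₀))) N-series ⟨
        ⌜ κ′ - κ₀ ⌝ ⊛ Nˢ                               ∎)
        (Cancels-⊛ discriminant≢0 {Nˢ} {⌜ κ′ - κ₀ ⌝} (_ , Deg<-ev N) (Cancels-⌜⌝ discriminant≢0 κ≢) cancels-N)
      where
      open ≋-Reasoning
      open SeriesSolver
    cancels-poly (cross {κ′ = κ′} D≢) = Cancels-Bézout discriminant≢0 A B H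
        (_ , Deg<-ev (poly (form x₀ y₀ (- κ₀)))) (_ , Deg<-ev (poly (form y₀ (- x₀) (- κ′)))) (begin
        A ⊛ Q ⊕ B ⊛ evˢ (poly (form y₀ (- x₀) κ′)) X
          ≈⟨ S.+-cong (S.*-cong A≋ Q≋) (S.*-cong B≋ (S.trans (poly-series y₀ (- x₀) κ′) (formˢ-cong coord-neg (S.refl {⌜ κ′ ⌝})))) ⟩
        formˢ p (⊝ cκ) ⊛ formˢ p cκ ⊕ formˢ p′ (⊝ ⌜ κ′ ⌝) ⊛ formˢ p′ ⌜ κ′ ⌝
          ≈⟨ solve 5 (λ p p′ κ λ′ n → (p :- (:- κ) :* n) :* (p :- κ :* n) :+ (p′ :- (:- λ′) :* n) :* (p′ :- λ′ :* n)
               := (p :* p :+ p′ :* p′) :- (κ :* κ :+ λ′ :* λ′) :* (n :* n)) S.refl p p′ cκ ⌜ κ′ ⌝ n ⟩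
        (p ⊛ p ⊕ p′ ⊛ p′) ⊕ ⊝ ((cκ ⊛ cκ ⊕ ⌜ κ′ ⌝ ⊛ ⌜ κ′ ⌝) ⊛ (n ⊛ n))
          ≈⟨ S.+-congʳ {⊝ ((cκ ⊛ cκ ⊕ ⌜ κ′ ⌝ ⊛ ⌜ κ′ ⌝) ⊛ (n ⊛ n))} (coord-norm cx cy) ⟩
        (cx ⊛ cx ⊕ cy ⊛ cy) ⊛ (n ⊛ n) ⊕ ⊝ ((cκ ⊛ cκ ⊕ ⌜ κ′ ⌝ ⊛ ⌜ κ′ ⌝) ⊛ (n ⊛ n))
          ≈⟨ solve 4 (λ d k l m → d :* m :- (k :+ l) :* m := (d :- k :- l) :* m) S.refl (cx ⊛ cx ⊕ cy ⊛ cy) (cκ ⊛ cκ) (⌜ κ′ ⌝ ⊛ ⌜ κ′ ⌝) (n ⊛ n) ⟩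
        ((cx ⊛ cx ⊕ cy ⊛ cy) ⊕ ⊝ (cκ ⊛ cκ) ⊕ ⊝ (⌜ κ′ ⌝ ⊛ ⌜ κ′ ⌝)) ⊛ (n ⊛ n)
          ≈⟨ S.*-cong constant (S.*-cong N-series N-series) ⟨
        H ∎)
        (Cancels-⊛ discriminant≢0 {Nˢ ⊛ Nˢ} {⌜ norm φ - κ₀ * κ₀ - κ′ * κ′ ⌝} (IsPoly-⊛ pN pN) (Cancels-⌜⌝ discriminant≢0 D≢)
          (Cancels-⊛ discriminant≢0 {Nˢ} {Nˢ} pN cancels-N cancels-N))
      where
      open ≋-Reasoning
      open SeriesSolver
      A B H p p′ : Series
      A = evˢ (poly (form x₀ y₀ (- κ₀))) X
      B = evˢ (poly (form y₀ (- x₀) (- κ′))) X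
      H = ⌜ norm φ - κ₀ * κ₀ - κ′ * κ′ ⌝ ⊛ (Nˢ ⊛ Nˢ)
      p = coord cx cy
      p′ = coord cy (⊝ cx)
      pN : IsPoly Nˢ
      pN = _ , Deg<-ev N
      coord-neg : coord cy ⌜ - x₀ ⌝ ≋ p′
      coord-neg = S.+-congˡ {cy ⊛ a} (S.-‿cong (S.*-congʳ {X} (S.+-cong (⌜⌝-- x₀) (⌜⌝-- x₀))))
      A≋ : A ≋ formˢ p (⊝ cκ)
      A≋ = S.trans (poly-series x₀ y₀ (- κ₀)) (formˢ-cong (S.refl {p}) (⌜⌝-- κ₀))
      B≋ : B ≋ formˢ p′ (⊝ ⌜ κ′ ⌝)
      B≋ = S.trans (poly-series y₀ (- x₀) (- κ′)) (formˢ-cong coord-neg (⌜⌝-- κ′))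
      constant : ⌜ norm φ - κ₀ * κ₀ - κ′ * κ′ ⌝ ≋ (cx ⊛ cx ⊕ cy ⊛ cy) ⊕ ⊝ (cκ ⊛ cκ) ⊕ ⊝ (⌜ κ′ ⌝ ⊛ ⌜ κ′ ⌝)
      constant = S.trans (⌜⌝-+ (norm φ - κ₀ * κ₀) (- (κ′ * κ′))) (S.+-cong
        (S.trans (⌜⌝-+ (norm φ) (- (κ₀ * κ₀))) (S.+-cong norm-series (S.trans (⌜⌝-- (κ₀ * κ₀)) (S.-‿cong (⌜⌝-* κ₀ κ₀)))))
        (S.trans (⌜⌝-- (κ′ * κ′)) (S.-‿cong (⌜⌝-* κ′ κ′))))

-- Every pattern of eight signs occurs on the conic.

module SignsOnConic {q : ℕ} (K : FiniteField q) (k : ℕ) (q≡4k+3 : q ≡ suc (suc (k ℕ.+ k) ℕ.+ suc (k ℕ.+ k)))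
  {p n : ℕ} (pr : Prime p) (q≡pⁿ : q ≡ p ℕ.^ n)
  (R w j : ℕ) (R+15≡2k : R ℕ.+ 15 ≡ k ℕ.+ k) (2w≤q : w ℕ.+ w ≤ q)
  (w-small : w ℕ.* suc (j ℕ.+ 63 ℕ.* w) < j ℕ.* R)
  (w-large : w ℕ.* (20 ℕ.* 256) ℕ.+ 256 ℕ.* (w ℕ.* 32 ℕ.+ (17 ℕ.+ j) ℕ.* q) < w ℕ.* q) where
  open FieldFacts K
  open PowerSeries K
  open Polynomials K
  open Degree K
  open QuadraticFactors K
  open QuadraticCharacter K k q≡4k+3
  open SignPatterns K k q≡4k+3
  open CharacterSumBound K k q≡4k+3 {n = n} pr q≡pⁿ R w j R+15≡2k 2w≤q w-small
  open Conic K k q≡4k+3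
  open Form
  open EvF using (ev)
  open EvS using () renaming (ev to evˢ)

  private
    C : ℕ
    C = w ℕ.* 32 ℕ.+ (17 ℕ.+ j) ℕ.* q

  -- φ is the first factor taken. Its quadratic is coprime to the cofactor G and to all conditions
  -- still to come, which is what the descent requires. `room` reserves degree 4 for each of these
  -- conditions within the total of 32.
  record Good (g : List F) (cs : List Condition) : Set where
    field
      φ      : Form
      reg    : Regular φ
      G      : Series
      pG     : IsPoly G
      g≋     : evˢ g X ≋ Coprime.Q φ reg ⊛ G
      cancel : Coprime.Cancelling φ reg G
      g0≢0   : ev g 0# ≢ 0#
      m      : ℕ
      len    : length g ≤ suc m
      room   : m ℕ.+ length cs ℕ.* 4 ≤ 32
      rest   : All (λ c → Coprime.Cancelling φ reg (evˢ (proj₁ c) X) × ev (proj₁ c) 0# ≢ 0# × length (proj₁ c) ≤ 5) cs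

  skip : ∀ {g c cs} → Good g (c ∷ cs) → Good g cs
  skip {cs = cs} good = record
    { φ = φ ; reg = reg ; G = G ; pG = pG ; g≋ = g≋ ; cancel = cancel ; g0≢0 = g0≢0 ; m = m ; len = len
    ; room = ℕₚ.≤-trans (ℕₚ.+-monoʳ-≤ m (ℕₚ.m≤n+m (length cs ℕ.* 4) 4)) room
    ; rest = All.tail rest }
    where open Good good

  take : ∀ {g f s cs} → Good g ((f , s) ∷ cs) → Good (mulL g f) cs
  take {g} {f} {cs = cs} good = record
    { φ = φ ; reg = reg ; G = G ⊛ evˢ f X
    ; pG = IsPoly-⊛ pG (_ , Deg<-ev f)
    ; g≋ = S.trans (EvS.ev-mulL g f X) (S.trans (S.*-congʳ {evˢ f X} g≋) (S.*-assoc (Coprime.Q φ reg) G (evˢ f X)))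
    ; cancel = Coprime.Cancels-⊛ φ reg (Coprime.discriminant≢0 φ reg) {evˢ f X} {G} (_ , Deg<-ev f) cancel (proj₁ (All.head rest))
    ; g0≢0 = λ e → *-nonzero g0≢0 (proj₁ (proj₂ (All.head rest))) (trans (sym (EvF.ev-mulL g f 0#)) e)
    ; m = m ℕ.+ 4
    ; len = length-mulL g f len (proj₂ (proj₂ (All.head rest)))
    ; room = ℕₚ.≤-trans (ℕₚ.≤-reflexive (ℕₚ.+-assoc m 4 (length cs ℕ.* 4))) room
    ; rest = All.tail rest }
    where open Good good

  bound : ∀ {g} → Good g [] → w ℕ.* ∣ characterSum g [] ∣ ≤ C
  bound {g} good = characterSum-bound g
    (ℕₚ.≤-trans len (s≤s (ℕₚ.≤-trans (ℕₚ.≤-reflexive (sym (ℕₚ.+-identityʳ m))) room)))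
    (Coprime.notSquare φ reg (Coprime.discriminant≢0 φ reg) {evˢ g X} {G} pG g≋ (g0≢0 ∘ trans (sym (ev-X-zero g))) cancel R) g0≢0
    where open Good good

  condition : Form × ℤ → Condition
  condition (φ , s) = mulL (poly φ) N , s

  ev-condition-0 : ∀ φ → Regular φ → ev (mulL (poly φ) N) 0# ≢ 0#
  ev-condition-0 φ reg e = *-nonzero (Regular.minus≢0 reg) (0≢1 ∘ sym) (trans
    (solve 4 (λ a b c o → a :* o := (a :+ con 0ℤ :* (b :+ con 0ℤ :* (c :+ con 0ℤ :* con 0ℤ))) :* (o :+ con 0ℤ :* (con 0ℤ :+ con 0ℤ :* (o :+ con 0ℤ :* con 0ℤ))))
      refl (x φ - κ φ) (- (y φ + y φ)) (- (x φ + κ φ)) 1#)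
    (trans (sym (EvF.ev-mulL (poly φ) N 0#)) e))
    where open Solver

  -- A product starts as `poly φ` times N, so its first cofactor is N, and the degree used so far is
  -- 4.
  goodTails : ∀ items → length items ≤ 8 → AllPairs (λ a b → Separated (proj₁ a) (proj₁ b)) items →
    All (Regular ∘ proj₁) items → GoodTails w C Good skip take bound (map condition items)
  goodTails []                  _         _             _              = tt
  goodTails ((φ , s) ∷ items) (s≤s few) (sep ∷ seps) (reg ∷ regs) = record
    { φ = φ ; reg = reg ; G = evˢ N X
    ; pG = _ , Deg<-ev N
    ; g≋ = S.trans (EvS.ev-mulL (1# ∷ []) (mulL (poly φ) N) X) (S.trans (S.*-congʳ {evˢ (mulL (poly φ) N) X} one)
        (S.trans (S.*-identityˡ _) (EvS.ev-mulL (poly φ) N X)))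
    ; cancel = cancels-N
    ; g0≢0 = λ e → *-nonzero (0≢1 ∘ sym) (ev-condition-0 φ reg) (trans (cong (_* ev (mulL (poly φ) N) 0#)
        (sym (trans (cong (1# +_) (zeroˡ 0#)) (+-identityʳ 1#)))) (trans (sym (EvF.ev-mulL (1# ∷ []) (mulL (poly φ) N) 0#)) e))
    ; m = 4
    ; len = length-mulL {0} {4} (1# ∷ []) (mulL (poly φ) N) (s≤s z≤n) len5
    ; room = ℕₚ.+-monoʳ-≤ 4 (ℕₚ.*-monoˡ-≤ 4 (ℕₚ.≤-trans (ℕₚ.≤-reflexive (length-map condition items)) few))
    ; rest = Allₚ.map⁺ (All.map (λ {item} → coprime item) (All.zip (sep , regs))) }
    , goodTails items (ℕₚ.m≤n⇒m≤1+n few) seps regs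
    where
    open Coprime φ reg
    one : evˢ (1# ∷ []) X ≋ 𝟙
    one = S.trans (S.+-congˡ {𝟙} (S.zeroʳ X)) (S.+-identityʳ 𝟙)
    coprime : ∀ item → Separated φ (proj₁ item) × Regular (proj₁ item) →
      Cancelling (evˢ (mulL (poly (proj₁ item)) N) X) × ev (mulL (poly (proj₁ item)) N) 0# ≢ 0# × length (mulL (poly (proj₁ item)) N) ≤ 5
    coprime (ψ , _) (sep , reg′) =
        Cancels-resp discriminant≢0 (S.sym (EvS.ev-mulL (poly ψ) N X))
          (Cancels-⊛ discriminant≢0 {evˢ N X} {evˢ (poly ψ) X} (_ , Deg<-ev N) (cancels-poly sep) cancels-N)
      , ev-condition-0 ψ reg′ , ℕₚ.≤-refl
    len5 : length (mulL (poly φ) N) ≤ 5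
    len5 = ℕₚ.≤-refl

  -- What `Regular` and `Separated` amount to when x² + y² = D and the shifts run over ±α, ±β, apart
  -- from the position of the base point.
  record Constants (D α β : F) : Set where
    field
      D≢0    : D ≢ 0#
      α≢0    : α ≢ 0#
      β≢0    : β ≢ 0#
      α≢β    : α - β ≢ 0#
      α≢-β   : α + β ≢ 0#
      D≢αα   : D - α * α ≢ 0#
      D≢ββ   : D - β * β ≢ 0#
      D≢αααα : D - α * α - α * α ≢ 0#
      D≢ααββ : D - α * α - β * β ≢ 0#
      D≢ββββ : D - β * β - β * β ≢ 0#

  module _ {D α β : F} (constants : Constants D α β) where
    open Constants constants

    private
      κs : List F
      κs = α ∷ - α ∷ β ∷ - β ∷ []

      OnConic : F → F → Set
      OnConic ρ σ = ρ * ρ + σ * σ ≡ D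

      Avoids : F → Set
      Avoids r = All (λ κ → r - κ ≢ 0#) κs

      turn : ∀ {ρ σ} → OnConic ρ σ → OnConic σ (- ρ)
      turn {ρ} {σ} e = trans (solve 2 (λ ρ σ → σ :* σ :+ (:- ρ) :* (:- ρ) := ρ :* ρ :+ σ :* σ) refl ρ σ) e
        where open Solver

      -- The shift 0 is included so that a common non-root also has nonzero coordinates r and r′.
      -- These are ten quadratics, with at most 20 roots in all.
      forms : F → F → List Form
      forms ρ σ = map (form ρ σ) (0# ∷ κs) ++ map (form σ (- ρ)) (0# ∷ κs)

      forms-norm : ∀ {ρ σ} → OnConic ρ σ → All (λ φ → norm φ ≢ 0#) (forms ρ σ)
      forms-norm e = Allₚ.++⁺ (Allₚ.map⁺ (All.universal (λ _ z → D≢0 (trans (sym e) z)) (0# ∷ κs)))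
        (Allₚ.map⁺ (All.universal (λ _ z → D≢0 (trans (sym (turn e)) z)) (0# ∷ κs)))

      avoid : ∀ {ρ σ} t → ¬ Any (IsRoot t) (forms ρ σ) →
        All (λ κ → rotate t ρ σ - κ ≢ 0#) (0# ∷ κs) × All (λ κ → rotate t σ (- ρ) - κ ≢ 0#) (0# ∷ κs)
      avoid {ρ} {σ} t ¬root =
          All.map (λ {κ} → go ρ σ κ) (Allₚ.map⁻ (proj₁ split)) , All.map (λ {κ} → go σ (- ρ) κ) (Allₚ.map⁻ (proj₂ split))
        where
        split : All (λ φ → ¬ IsRoot t φ) (map (form ρ σ) (0# ∷ κs)) × All (λ φ → ¬ IsRoot t φ) (map (form σ (- ρ)) (0# ∷ κs))
        split = Allₚ.++⁻ (map (form ρ σ) (0# ∷ κs)) (Allₚ.¬Any⇒All¬ (forms ρ σ) ¬root)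
        go : ∀ ρ σ κ → ¬ IsRoot t (form ρ σ κ) → rotate t ρ σ - κ ≢ 0#
        go ρ σ κ ¬r e = ¬r (trans (rotate-form t ρ σ κ) (trans (cong (ev N t *_) e) (zeroʳ _)))

      -- The point given by `sum-of-squares` may have a coordinate among ±α, ±β, which would spoil
      -- the constant or leading coefficient of a quadratic. Rotating it by a common non-root avoids
      -- these values.
      basePoint : 20 < q → ∃ λ ρ → ∃ λ σ → OnConic ρ σ × Avoids ρ × Avoids σ
      basePoint 20<q = go (sum-of-squares D)
        where
        go : (∃ λ a → ∃ λ b → a * a + b * b ≡ D) → ∃ λ ρ → ∃ λ σ → OnConic ρ σ × Avoids ρ × Avoids σ
        go (a , b , e) = move (non-root (forms a b) (forms-norm e) 20<q)
          where
          move : (∃ λ t → ¬ Any (IsRoot t) (forms a b)) → ∃ λ ρ → ∃ λ σ → OnConic ρ σ × Avoids ρ × Avoids σ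
          move (t , ¬root) = rotate t a b , rotate t b (- a) , trans (rotate-norm t a b) e
            , All.tail (proj₁ (avoid t ¬root)) , All.tail (proj₂ (avoid t ¬root))

      regular : ∀ {ρ σ} → OnConic ρ σ → Avoids ρ → All (λ κ → Regular (form ρ σ κ)) κs
      regular {ρ} {σ} e (a₁ ∷ a₂ ∷ a₃ ∷ a₄ ∷ []) =
        reg a₁ (a₂ ∘ plus α) disc-α ∷ reg a₂ a₁ disc--α ∷ reg a₃ (a₄ ∘ plus β) disc-β ∷ reg a₄ a₃ disc--β ∷ []
        where
        open Solver
        reg : ∀ {κ} → ρ - κ ≢ 0# → ρ + κ ≢ 0# → ρ * ρ + σ * σ - κ * κ ≢ 0# → Regular (form ρ σ κ)
        reg m p d = record { minus≢0 = m ; plus≢0 = p ; norm≢0 = λ z → D≢0 (trans (sym e) z) ; disc≢0 = d }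
        plus : ∀ κ → ρ + κ ≡ 0# → ρ - (- κ) ≡ 0#
        plus κ z = trans (cong (ρ +_) (-‿involutive κ)) z
        square-neg : ∀ κ → - κ * - κ ≡ κ * κ
        square-neg κ = solve 1 (λ κ → (:- κ) :* (:- κ) := κ :* κ) refl κ
        disc-α : ρ * ρ + σ * σ - α * α ≢ 0#
        disc-α z = D≢αα (trans (cong (_- α * α) (sym e)) z)
        disc--α : ρ * ρ + σ * σ - (- α) * (- α) ≢ 0#
        disc--α z = disc-α (trans (cong (λ z → ρ * ρ + σ * σ - z) (sym (square-neg α))) z)
        disc-β : ρ * ρ + σ * σ - β * β ≢ 0#
        disc-β z = D≢ββ (trans (cong (_- β * β) (sym e)) z)
        disc--β : ρ * ρ + σ * σ - (- β) * (- β) ≢ 0#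
        disc--β z = disc-β (trans (cong (λ z → ρ * ρ + σ * σ - z) (sym (square-neg β))) z)

      distinct : AllPairs (λ κ κ′ → κ′ - κ ≢ 0#) κs
      distinct = (neg α≢0 ∷ β-α ∷ -β-α ∷ []) ∷ (β+α ∷ -β+α ∷ []) ∷ (neg β≢0 ∷ []) ∷ [] ∷ []
        where
        open Solver
        neg0 : ∀ {z} → z ≡ 0# → - z ≡ 0#
        neg0 e = trans (cong -_ e) -0#≈0#
        neg : ∀ {z} → z ≢ 0# → - z - z ≢ 0#
        neg {z} z≢0 e = x+x≢0 z≢0 (trans (solve 1 (λ z → z :+ z := :- ((:- z) :- z)) refl z) (neg0 e))
        β-α : β - α ≢ 0#
        β-α e = α≢β (trans (solve 2 (λ α β → α :- β := :- (β :- α)) refl α β) (neg0 e))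
        -β-α : - β - α ≢ 0#
        -β-α e = α≢-β (trans (solve 2 (λ α β → α :+ β := :- ((:- β) :- α)) refl α β) (neg0 e))
        β+α : β - (- α) ≢ 0#
        β+α e = α≢-β (trans (solve 2 (λ α β → α :+ β := β :- (:- α)) refl α β) e)
        -β+α : - β - (- α) ≢ 0#
        -β+α e = α≢β (trans (solve 2 (λ α β → α :- β := (:- β) :- (:- α)) refl α β) e)

      squares : All (λ κ → κ * κ ≡ α * α ⊎ κ * κ ≡ β * β) κs
      squares = inj₁ refl ∷ inj₁ (square-neg α) ∷ inj₂ refl ∷ inj₂ (square-neg β) ∷ []
        where
        open Solver
        square-neg : ∀ κ → - κ * - κ ≡ κ * κ
        square-neg κ = solve 1 (λ κ → (:- κ) :* (:- κ) := κ :* κ) refl κ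

      crossing : ∀ {ρ σ} → OnConic ρ σ → All (λ κ → All (λ κ′ → Separated (form ρ σ κ) (form σ (- ρ) κ′)) κs) κs
      crossing {ρ} {σ} e = All.map (λ {κ} sκ → All.map (λ {κ′} sκ′ → cross (go κ κ′ sκ sκ′)) squares) squares
        where
        open Solver
        go : ∀ κ κ′ → κ * κ ≡ α * α ⊎ κ * κ ≡ β * β → κ′ * κ′ ≡ α * α ⊎ κ′ * κ′ ≡ β * β → ρ * ρ + σ * σ - κ * κ - κ′ * κ′ ≢ 0#
        go κ κ′ (inj₁ a) (inj₁ b) z rewrite e | a | b = D≢αααα z
        go κ κ′ (inj₁ a) (inj₂ b) z rewrite e | a | b = D≢ααββ z
        go κ κ′ (inj₂ a) (inj₁ b) z rewrite e | a | b = D≢ααββ (trans (solve 3 (λ D a b → D :- a :- b := D :- b :- a) refl D (α * α) (β * β)) z)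
        go κ κ′ (inj₂ a) (inj₂ b) z rewrite e | a | b = D≢ββββ z

    module _ (s₁ s₂ s₃ s₄ s₅ s₆ s₇ s₈ : ℤ) (signs : All IsSign (s₁ ∷ s₂ ∷ s₃ ∷ s₄ ∷ s₅ ∷ s₆ ∷ s₇ ∷ s₈ ∷ [])) (20<q : 20 < q) where
      private
        items : F → F → List (Form × ℤ)
        items ρ σ = (form ρ σ α , s₁) ∷ (form ρ σ (- α) , s₂) ∷ (form ρ σ β , s₃) ∷ (form ρ σ (- β) , s₄)
          ∷ (form σ (- ρ) α , s₅) ∷ (form σ (- ρ) (- α) , s₆) ∷ (form σ (- ρ) β , s₇) ∷ (form σ (- ρ) (- β) , s₈) ∷ []

        lift : ∀ {P : Form → Set} ρ σ → All P (map (form ρ σ) κs ++ map (form σ (- ρ)) κs) → All (P ∘ proj₁) (items ρ σ)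
        lift ρ σ (a ∷ b ∷ c ∷ d ∷ e ∷ f ∷ g ∷ h ∷ []) = a ∷ b ∷ c ∷ d ∷ e ∷ f ∷ g ∷ h ∷ []

        separated : ∀ {ρ σ} → OnConic ρ σ → AllPairs (λ a b → Separated (proj₁ a) (proj₁ b)) (items ρ σ)
        separated {ρ} {σ} e = AllPairsₚ.map⁻ {f = proj₁} {xs = items ρ σ} (AllPairsₚ.++⁺ (within ρ σ) (within σ (- ρ))
            (Allₚ.map⁺ (All.map Allₚ.map⁺ (crossing e))))
          where
          within : ∀ ρ σ → AllPairs Separated (map (form ρ σ) κs)
          within ρ σ = AllPairsₚ.map⁺ (Data.List.Relation.Unary.AllPairs.map same distinct)

        regulars : ∀ {ρ σ} → OnConic ρ σ → Avoids ρ → Avoids σ → All (Regular ∘ proj₁) (items ρ σ)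
        regulars {ρ} {σ} e aρ aσ = lift {Regular} ρ σ (Allₚ.++⁺ (Allₚ.map⁺ (regular e aρ)) (Allₚ.map⁺ (regular (turn e) aσ)))

        bad? : ∀ ρ σ t → Dec (Any (IsRoot t) (forms ρ σ))
        bad? ρ σ t = Any.any? (isRoot? t) (forms ρ σ)

        nonzero : ∀ ρ σ t → ¬ Any (IsRoot t) (forms ρ σ) → All (λ c → ev (proj₁ c) t ≢ 0#) (map condition (items ρ σ))
        nonzero ρ σ t ¬root = Allₚ.map⁺ {f = condition} (lift {λ φ → ev (mulL (poly φ) N) t ≢ 0#} ρ σ (All.map (λ {φ} → go φ) (Allₚ.++⁺ (All.tail (proj₁ split)) (All.tail (proj₂ split)))))
          where
          split : All (λ φ → ¬ IsRoot t φ) (map (form ρ σ) (0# ∷ κs)) × All (λ φ → ¬ IsRoot t φ) (map (form σ (- ρ)) (0# ∷ κs))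
          split = Allₚ.++⁻ (map (form ρ σ) (0# ∷ κs)) (Allₚ.¬Any⇒All¬ (forms ρ σ) ¬root)
          go : ∀ φ → ¬ IsRoot t φ → ev (mulL (poly φ) N) t ≢ 0#
          go φ ¬r e = *-nonzero ¬r (Nt≢0 t) (trans (sym (EvF.ev-mulL (poly φ) N t)) e)

      signs-attained : Attained D α β s₁ s₂ s₃ s₄ s₅ s₆ s₇ s₈
      signs-attained = go (basePoint 20<q)
        where
        go : (∃ λ ρ → ∃ λ σ → OnConic ρ σ × Avoids ρ × Avoids σ) → Attained D α β s₁ s₂ s₃ s₄ s₅ s₆ s₇ s₈
        go (ρ , σ , e , aρ , aσ) = conclude (attained w C Good skip take bound (map condition (items ρ σ)) (attach signs)
            (goodTails (items ρ σ) ℕₚ.≤-refl (separated e) (regulars e aρ aσ)) (bad? ρ σ) (nonzero ρ σ)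
            (ℕₚ.≤-<-trans (ℕₚ.+-monoˡ-≤ (256 ℕ.* C) (ℕₚ.*-monoʳ-≤ w (ℕₚ.*-monoˡ-≤ 256 (roots-count (forms ρ σ) (forms-norm e))))) w-large))
          where
          attach : All IsSign (s₁ ∷ s₂ ∷ s₃ ∷ s₄ ∷ s₅ ∷ s₆ ∷ s₇ ∷ s₈ ∷ []) → Signs (map condition (items ρ σ))
          attach (a ∷ b ∷ c ∷ d ∷ e ∷ f ∷ g ∷ h ∷ []) = a ∷ b ∷ c ∷ d ∷ e ∷ f ∷ g ∷ h ∷ []
          conclude : (∃ λ t → ¬ Any (IsRoot t) (forms ρ σ) × All (Holds t) (map condition (items ρ σ))) → Attained D α β s₁ s₂ s₃ s₄ s₅ s₆ s₇ s₈
          conclude (t , ¬root , (h₁ ∷ h₂ ∷ h₃ ∷ h₄ ∷ h₅ ∷ h₆ ∷ h₇ ∷ h₈ ∷ [])) =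
            rotate t ρ σ , rotate t σ (- ρ) , trans (rotate-norm t ρ σ) e
            , All.head (proj₁ (avoid t ¬root)) ∘ minus-0 , All.head (proj₂ (avoid t ¬root)) ∘ minus-0
            , (read h₁ , read h₂ , read h₃ , read h₄) , (read h₅ , read h₆ , read h₇ , read h₈)
            where
            minus-0 : ∀ {z} → z ≡ 0# → z - 0# ≡ 0#
            minus-0 e = trans (cong (_ +_) -0#≈0#) (trans (+-identityʳ _) e)
            read : ∀ {φ s} → η (ev (mulL (poly φ) N) t) ≡ s → η (rotate t (x φ) (y φ) - κ φ) ≡ s
            read {φ} e = trans (sym (η-rotate t φ)) e

-- Counting in lists without repetition.

module _ {A : Set} where

  unique-⊆⇒length≤ : ∀ (xs ys : List A) → Unique xs → All (_∈ ys) xs → length xs ≤ length ys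
  unique-⊆⇒length≤ []       ys _            _              = z≤n
  unique-⊆⇒length≤ (x ∷ xs) ys (x∉ ∷ uniq) (x∈ys ∷ xs⊆ys) with ∈-∃++ x∈ys
  ... | as , bs , refl = ℕₚ.≤-trans (s≤s (unique-⊆⇒length≤ xs (as ++ bs) uniq (All.map (λ {z} → remove z) (All.zip (x∉ , xs⊆ys)))))
      (ℕₚ.≤-reflexive (trans (cong suc (length-++ as)) (trans (sym (ℕₚ.+-suc (length as) (length bs))) (sym (length-++ as)))))
    where
    remove : ∀ z → x ≢ z × z ∈ as ++ x ∷ bs → z ∈ as ++ bs
    remove z (x≢z , z∈) with ∈-++⁻ as z∈
    ... | inj₁ z∈as         = ∈-++⁺ˡ z∈as
    ... | inj₂ (here z≡x)   = contradiction (sym z≡x) x≢z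
    ... | inj₂ (there z∈bs) = ∈-++⁺ʳ as z∈bs

  module _ {P : A → Set} (P? : Decidable P) where

    all-equal⇒count≤1 : (∀ {x y} → P x → P y → x ≡ y) → ∀ {xs} → Unique xs → length (filter P? xs) ≤ 1
    all-equal⇒count≤1 equal {xs} uniq = go (filter P? xs) (Uniqueₚ.filter⁺ P? uniq) (Allₚ.all-filter P? xs)
      where
      go : ∀ ys → Unique ys → All P ys → length ys ≤ 1
      go []          _                 _             = z≤n
      go (_ ∷ [])    _                 _             = s≤s z≤n
      go (y ∷ z ∷ _) ((y≢z ∷ _) ∷ _) (Py ∷ Pz ∷ _) = contradiction (equal Py Pz) y≢z

    none⇒count≤0 : (∀ {x} → ¬ P x) → ∀ xs → length (filter P? xs) ≤ 0
    none⇒count≤0 none []       = z≤n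
    none⇒count≤0 none (x ∷ xs) with P? x
    ... | yes Px = contradiction Px none
    ... | no  _  = none⇒count≤0 none xs

    two-distinct : ∀ {xs} → Unique xs → 2 ≤ length (filter P? xs) → ∃ λ x → ∃ λ y → x ≢ y × P x × P y
    two-distinct {xs} uniq le = go (filter P? xs) (Uniqueₚ.filter⁺ P? uniq) (Allₚ.all-filter P? xs) le
      where
      go : ∀ ys → Unique ys → All P ys → 2 ≤ length ys → ∃ λ x → ∃ λ y → x ≢ y × P x × P y
      go (y ∷ z ∷ _) ((y≢z ∷ _) ∷ _) (Py ∷ Pz ∷ _) _ = y , z , y≢z , Py , Pz
      go (y ∷ [])    _ _ (s≤s ())

-- At most five solutions.

module Differences {q : ℕ} (K : FiniteField q) (k : ℕ) (q≡4k+3 : q ≡ suc (suc (k ℕ.+ k) ℕ.+ suc (k ℕ.+ k)))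
  (u : FiniteField.F K) where
  open FieldFacts K
  open Polynomials K
  open QuadraticCharacter K k q≡4k+3
  open Conic K k q≡4k+3 using (quadratic-roots; root-difference)
  open EvF using (ev)
  open Solver

  α β c : F
  α = 1# + u
  β = 1# - u
  c = u + u

  f : F → F
  f = F₂ u

  f-zero : ∀ {x} → x ≡ 0# → f x ≡ 0#
  f-zero refl = trans (cong (_* (1# + u * ι (η 0#))) (zeroˡ 0#)) (zeroˡ _)

  f-square : ∀ {x} → η x ≡ 1ℤ → f x ≡ α * (x * x)
  f-square {x} e = trans (cong (λ s → x * x * (1# + u * ι s)) e)
    -- 1 + 0 mirrors how `ι` unfolds at the integer 1.
    (solve 2 (λ x u → x :* x :* (con 1ℤ :+ u :* (con 1ℤ :+ con 0ℤ)) := (con 1ℤ :+ u) :* (x :* x)) refl x u)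

  f-nonsquare : ∀ {x} → η x ≡ -1ℤ → f x ≡ β * (x * x)
  f-nonsquare {x} e = trans (cong (λ s → x * x * (1# + u * ι s)) e)
    (solve 2 (λ x u → x :* x :* (con 1ℤ :+ u :* (:- (con 1ℤ :+ con 0ℤ))) := (con 1ℤ :- u) :* (x :* x)) refl x u)

  module Upper (u≢0 : u ≢ 0#) (α≢0 : α ≢ 0#) (β≢0 : β ≢ 0#) (a : F) (a≢0 : a ≢ 0#) (b : F) where

    Solution : F → Set
    Solution x = f (x + a) - f x ≡ b

    c≢0 : c ≢ 0#
    c≢0 = x+x≢0 u≢0

    -- Solutions with x = 0 or x + a = 0 join a linear class according to the other character,
    -- because f, α x² and β x² all vanish at 0. `ClassP` records the characters for the sake of
    -- `not-all`.
    ClassA ClassB ClassP ClassM : F → Set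
    ClassA x = Solution x × η (x + a) ≡ 1ℤ × η x ≡ -1ℤ
    ClassB x = Solution x × η (x + a) ≡ -1ℤ × η x ≡ 1ℤ
    ClassP x = α * (a * (x + x + a)) ≡ b × (η (x + a) ≡ 1ℤ ⊎ x + a ≡ 0#) × (η x ≡ 1ℤ ⊎ x ≡ 0#)
    ClassM x = β * (a * (x + x + a)) ≡ b

    solution? : Decidable Solution
    solution? x = (f (x + a) - f x) ≟ b

    classA? : Decidable ClassA
    classA? x = solution? x ×-dec (η (x + a) ℤ.≟ 1ℤ) ×-dec (η x ℤ.≟ -1ℤ)

    classB? : Decidable ClassB
    classB? x = solution? x ×-dec (η (x + a) ℤ.≟ -1ℤ) ×-dec (η x ℤ.≟ 1ℤ)

    classP? : Decidable ClassP
    classP? x = ((α * (a * (x + x + a))) ≟ b) ×-dec ((η (x + a) ℤ.≟ 1ℤ) ⊎-dec ((x + a) ≟ 0#)) ×-dec ((η x ℤ.≟ 1ℤ) ⊎-dec (x ≟ 0#))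

    classM? : Decidable ClassM
    classM? x = (β * (a * (x + x + a))) ≟ b

    telescope : ∀ γ x → γ * ((x + a) * (x + a)) - γ * (x * x) ≡ γ * (a * (x + x + a))
    telescope γ x = solve 3 (λ γ x a → γ :* ((x :+ a) :* (x :+ a)) :- γ :* (x :* x) := γ :* (a :* (x :+ x :+ a))) refl γ x a

    linear : ∀ {γ} x → Solution x → f (x + a) ≡ γ * ((x + a) * (x + a)) → f x ≡ γ * (x * x) → γ * (a * (x + x + a)) ≡ b
    linear {γ} x sol e₁ e₂ = trans (sym (telescope γ x)) (trans (sym (cong₂ _-_ e₁ e₂)) sol)

    f-any : ∀ γ {x} → x ≡ 0# → f x ≡ γ * (x * x)
    f-any γ refl = trans (f-zero refl) (sym (trans (cong (γ *_) (zeroˡ 0#)) (zeroʳ γ)))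

    classify : ∀ x → Solution x → (ClassA x ⊎ ClassB x) ⊎ (ClassP x ⊎ ClassM x)
    classify x sol = go (ηview (x + a)) (ηview x)
      where
      go : ηView (x + a) → ηView x → (ClassA x ⊎ ClassB x) ⊎ (ClassP x ⊎ ClassM x)
      go (is-square _ _ e₁)  (nonsquare _ _ e₂) = inj₁ (inj₁ (sol , e₁ , e₂))
      go (nonsquare _ _ e₁)  (is-square _ _ e₂) = inj₁ (inj₂ (sol , e₁ , e₂))
      go (is-square _ _ e₁)  (is-square _ _ e₂) = inj₂ (inj₁ (linear x sol (f-square e₁) (f-square e₂) , inj₁ e₁ , inj₁ e₂))
      go (is-square _ _ e₁)  (is-zero e₂ _)     = inj₂ (inj₁ (linear x sol (f-square e₁) (f-any α e₂) , inj₁ e₁ , inj₂ e₂))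
      go (is-zero e₁ _)      (is-square _ _ e₂) = inj₂ (inj₁ (linear x sol (f-any α e₁) (f-square e₂) , inj₂ e₁ , inj₁ e₂))
      go (is-zero e₁ _)      (is-zero e₂ _)     = inj₂ (inj₁ (linear x sol (f-any α e₁) (f-any α e₂) , inj₂ e₁ , inj₂ e₂))
      go (nonsquare _ _ e₁)  (nonsquare _ _ e₂) = inj₂ (inj₂ (linear x sol (f-nonsquare e₁) (f-nonsquare e₂)))
      go (nonsquare _ _ e₁)  (is-zero e₂ _)     = inj₂ (inj₂ (linear x sol (f-nonsquare e₁) (f-any β e₂)))
      go (is-zero e₁ _)      (nonsquare _ _ e₂) = inj₂ (inj₂ (linear x sol (f-any β e₁) (f-nonsquare e₂)))

    linear-unique : ∀ {γ x y} → γ ≢ 0# → γ * (a * (x + x + a)) ≡ b → γ * (a * (y + y + a)) ≡ b → x ≡ y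
    linear-unique {γ} {x} {y} γ≢0 ex ey = x-y≡0⇒x≡y (*-cancelˡ-0 {(γ * a) * 2#} (*-nonzero (*-nonzero γ≢0 a≢0) 2≢0)
      (trans (solve 4 (λ γ a x y → γ :* a :* (con 1ℤ :+ con 1ℤ) :* (x :- y) := γ :* (a :* (x :+ x :+ a)) :- γ :* (a :* (y :+ y :+ a))) refl γ a x y)
        (x≡y⇒x-y≡0 (trans ex (sym ey)))))

    v : F
    v = α * (a * a)

    quadA : ∀ {x} → ClassA x → ev (v - b ∷ α * (a + a) ∷ c ∷ []) x ≡ 0#
    quadA {x} (sol , e₁ , e₂) = trans
      (solve 4 (λ u a b x → ((con 1ℤ :+ u) :* (a :* a) :- b) :+ x :* ((con 1ℤ :+ u) :* (a :+ a) :+ x :* ((u :+ u) :+ x :* con 0ℤ))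
        := ((con 1ℤ :+ u) :* ((x :+ a) :* (x :+ a)) :- (con 1ℤ :- u) :* (x :* x)) :- b) refl u a b x)
      (x≡y⇒x-y≡0 (trans (sym (cong₂ _-_ (f-square e₁) (f-nonsquare e₂))) sol))

    -- Written in x + a, so that the product of the roots is (v + b)/(2u), the counterpart of (v -
    -- b)/(2u) in `quadA`.
    quadB : ∀ {x} → ClassB x → ev (v + b ∷ - (α * (a + a)) ∷ c ∷ []) (x + a) ≡ 0#
    quadB {x} (sol , e₁ , e₂) = trans
      (solve 4 (λ u a b x → ((con 1ℤ :+ u) :* (a :* a) :+ b) :+ (x :+ a) :* ((:- ((con 1ℤ :+ u) :* (a :+ a))) :+ (x :+ a) :* ((u :+ u) :+ (x :+ a) :* con 0ℤ))
        := b :- ((con 1ℤ :- u) :* ((x :+ a) :* (x :+ a)) :- (con 1ℤ :+ u) :* (x :* x))) refl u a b x)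
      (x≡y⇒x-y≡0 (sym (trans (sym (cong₂ _-_ (f-nonsquare e₁) (f-square e₂))) sol)))

    vieta : ∀ {a₀ a₁ a₂} x y → x ≢ y → ev (a₀ ∷ a₁ ∷ a₂ ∷ []) x ≡ 0# → ev (a₀ ∷ a₁ ∷ a₂ ∷ []) y ≡ 0# → a₂ * (x * y) ≡ a₀
    vieta {a₀} {a₁} {a₂} x y x≢y ex ey = sym (x-y≡0⇒x≡y (begin
      a₀ - a₂ * (x * y)
        ≡⟨ solve 5 (λ a₀ a₁ a₂ x y → a₀ :- a₂ :* (x :* y) := (a₀ :+ x :* (a₁ :+ x :* (a₂ :+ x :* con 0ℤ))) :- x :* (a₁ :+ a₂ :* (x :+ y))) refl a₀ a₁ a₂ x y ⟩
      ev (a₀ ∷ a₁ ∷ a₂ ∷ []) x - x * (a₁ + a₂ * (x + y))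
        ≡⟨ cong₂ (λ z w → z - x * w) ex (root-difference a₀ a₁ a₂ x y x≢y ex ey) ⟩
      0# - x * 0#
        ≡⟨ solve 1 (λ x → con 0ℤ :- x :* con 0ℤ := con 0ℤ) refl x ⟩
      0# ∎))
      where open ≡-Reasoning

    count : ∀ {P : F → Set} → Decidable P → ℕ
    count P? = length (filter P? elements)

    countA≤2 : count classA? ≤ 2
    countA≤2 = quadratic-roots (v - b) (α * (a + a)) c (λ (_ , _ , e) → c≢0 e) _
      (Uniqueₚ.filter⁺ classA? elements-unique) (All.map (λ {x} → quadA {x}) (Allₚ.all-filter classA? elements))

    countB≤2 : count classB? ≤ 2
    countB≤2 = quadratic-roots (β * (a * a) - b) (β * (a + a)) (- c) (λ (_ , _ , e) → -‿nonzero c≢0 e) _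
      (Uniqueₚ.filter⁺ classB? elements-unique) (All.map (λ {x} → quad {x}) (Allₚ.all-filter classB? elements))
      where
      quad : ∀ {x} → ClassB x → ev (β * (a * a) - b ∷ β * (a + a) ∷ - c ∷ []) x ≡ 0#
      quad {x} (sol , e₁ , e₂) = trans
        (solve 4 (λ u a b x → ((con 1ℤ :- u) :* (a :* a) :- b) :+ x :* ((con 1ℤ :- u) :* (a :+ a) :+ x :* ((:- (u :+ u)) :+ x :* con 0ℤ))
          := ((con 1ℤ :- u) :* ((x :+ a) :* (x :+ a)) :- (con 1ℤ :+ u) :* (x :* x)) :- b) refl u a b x)
        (x≡y⇒x-y≡0 (trans (sym (cong₂ _-_ (f-nonsquare e₁) (f-square e₂))) sol))

    countP≤1 : count classP? ≤ 1
    countP≤1 = all-equal⇒count≤1 classP? (λ {x} {y} (ex , _) (ey , _) → linear-unique {α} {x} {y} α≢0 ex ey) elements-unique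

    countM≤1 : count classM? ≤ 1
    countM≤1 = all-equal⇒count≤1 classM? (λ {x} {y} ex ey → linear-unique {β} {x} {y} β≢0 ex ey) elements-unique

    product-sign : ∀ {w x y s} → IsSign s → η x ≡ s → η y ≡ s → c * (x * y) ≡ w → η w ≡ η c
    product-sign {w} {x} {y} {s} is ex ey e = begin
      η w                            ≡⟨ cong η e ⟨
      η (c * (x * y))                ≡⟨ trans (η-* c (x * y)) (cong (η c ℤ.*_) (η-* x y)) ⟩
      η c ℤ.* (η x ℤ.* η y)          ≡⟨ cong (η c ℤ.*_) (cong₂ ℤ._*_ ex ey) ⟩
      η c ℤ.* (s ℤ.* s)              ≡⟨ cong (η c ℤ.*_) (square is) ⟩
      η c ℤ.* 1ℤ                     ≡⟨ ℤₚ.*-identityʳ (η c) ⟩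
      η c                            ∎
      where
      open ≡-Reasoning
      square : ∀ {s} → IsSign s → s ℤ.* s ≡ 1ℤ
      square (inj₁ refl) = refl
      square (inj₂ refl) = refl

    -- With v = (1 + u) a², two solutions in class A give η(v − b) = η(2u), two in class B give η(v + b) = η(2u),
    -- and one in class P gives η(b − v) = η(b + v) unless one of these vanishes; but η(−1) = −1.
    not-all : (∃ λ x → ∃ λ y → x ≢ y × ClassA x × ClassA y) → (∃ λ x → ∃ λ y → x ≢ y × ClassB x × ClassB y) → ∀ {x} → ¬ ClassP x
    not-all (x₁ , x₂ , x₁≢x₂ , A₁ , A₂) (y₁ , y₂ , y₁≢y₂ , B₁ , B₂) {x} (ex , zero-or₁ , zero-or₂) = clash zero-or₁ zero-or₂
      where
      ηA : η (v - b) ≡ η c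
      ηA = product-sign (inj₂ refl) (proj₂ (proj₂ A₁)) (proj₂ (proj₂ A₂)) (vieta x₁ x₂ x₁≢x₂ (quadA {x₁} A₁) (quadA {x₂} A₂))
      shifted≢ : y₁ + a ≢ y₂ + a
      shifted≢ e = y₁≢y₂ (trans (solve 2 (λ y a → y := (y :+ a) :- a) refl y₁ a) (trans (cong (_- a) e) (solve 2 (λ y a → (y :+ a) :- a := y) refl y₂ a)))
      ηB : η (v + b) ≡ η c
      ηB = product-sign (inj₂ refl) (proj₁ (proj₂ B₁)) (proj₁ (proj₂ B₂)) (vieta (y₁ + a) (y₂ + a) shifted≢ (quadB {y₁} B₁) (quadB {y₂} B₂))
      -- With w = 2 α a the linear equation of class P reads v - b = - w x and equally v + b = w (x
      -- + a).
      w : F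
      w = α * (a + a)
      -wx : - (w * x) ≡ v - b
      -wx = trans (solve 3 (λ α a x → :- (α :* (a :+ a) :* x) := α :* (a :* a) :- α :* (a :* (x :+ x :+ a))) refl α a x) (cong (λ z → v - z) ex)
      wx : w * (x + a) ≡ v + b
      wx = trans (solve 3 (λ α a x → α :* (a :+ a) :* (x :+ a) := α :* (a :* a) :+ α :* (a :* (x :+ x :+ a))) refl α a x) (cong (v +_) ex)
      clash : (η (x + a) ≡ 1ℤ ⊎ x + a ≡ 0#) → (η x ≡ 1ℤ ⊎ x ≡ 0#) → _
      clash (inj₂ e) _ = contradiction (trans (sym wx) (trans (cong (w *_) e) (zeroʳ w))) (sign-nonzero (η-sign c≢0) ηB)
      clash _ (inj₂ e) = contradiction (trans (sym -wx) (trans (cong (λ z → - (w * z)) e) (trans (cong -_ (zeroʳ w)) -0#≈0#))) (sign-nonzero (η-sign c≢0) ηA)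
      clash (inj₁ e₁) (inj₁ e₂) = opposite (η-sign c≢0) (begin
        η c                      ≡⟨ ηA ⟨
        η (v - b)                ≡⟨ cong η -wx ⟨
        η (- (w * x))            ≡⟨ trans (η-neg (w * x)) (cong ℤ.-_ (trans (η-* w x) (cong (η w ℤ.*_) e₂))) ⟩
        ℤ.- (η w ℤ.* 1ℤ)         ≡⟨ cong ℤ.-_ (trans (η-* w (x + a)) (cong (η w ℤ.*_) e₁)) ⟨
        ℤ.- η (w * (x + a))      ≡⟨ cong (ℤ.-_ ∘ η) wx ⟩
        ℤ.- η (v + b)            ≡⟨ cong ℤ.-_ ηB ⟩
        ℤ.- η c                  ∎)
        where
        open ≡-Reasoning
        opposite : ∀ {s} → IsSign s → s ≢ ℤ.- s
        opposite (inj₁ refl) ()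
        opposite (inj₂ refl) ()

    three-classes : count classA? ℕ.+ count classB? ℕ.+ count classP? ≤ 4
    three-classes with count classA? ℕₚ.≤? 1 | count classB? ℕₚ.≤? 1
    ... | yes A≤1 | _       = ℕₚ.+-mono-≤ (ℕₚ.+-mono-≤ A≤1 countB≤2) countP≤1
    ... | no _    | yes B≤1 = ℕₚ.+-mono-≤ (ℕₚ.+-mono-≤ countA≤2 B≤1) countP≤1
    ... | no A≰1  | no B≰1  = ℕₚ.+-mono-≤ (ℕₚ.+-mono-≤ countA≤2 countB≤2)
      (none⇒count≤0 classP? (not-all (two-distinct classA? elements-unique (ℕₚ.≰⇒> A≰1)) (two-distinct classB? elements-unique (ℕₚ.≰⇒> B≰1))) elements)

    δ≤5 : δ f a b ≤ 5
    δ≤5 = begin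
      count solution?
        ≤⟨ length-filter-⊎ (λ x → classA? x ⊎-dec classB? x) (λ x → classP? x ⊎-dec classM? x) solution? (λ {x} → classify x) elements ⟩
      count (λ x → classA? x ⊎-dec classB? x) ℕ.+ count (λ x → classP? x ⊎-dec classM? x)
        ≤⟨ ℕₚ.+-mono-≤ (length-filter-⊎ classA? classB? (λ x → classA? x ⊎-dec classB? x) (λ z → z) elements)
                       (length-filter-⊎ classP? classM? (λ x → classP? x ⊎-dec classM? x) (λ z → z) elements) ⟩
      (count classA? ℕ.+ count classB?) ℕ.+ (count classP? ℕ.+ count classM?)
        ≡⟨ ℕₚ.+-assoc (count classA? ℕ.+ count classB?) (count classP?) (count classM?) ⟨
      count classA? ℕ.+ count classB? ℕ.+ count classP? ℕ.+ count classM?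
        ≤⟨ ℕₚ.+-mono-≤ three-classes countM≤1 ⟩
      5 ∎
      where open ℕₚ.≤-Reasoning

foldr-⊔-upper : ∀ {m} xs → All (_≤ m) xs → foldr ℕ._⊔_ 0 xs ≤ m
foldr-⊔-upper []       _          = z≤n
foldr-⊔-upper (x ∷ xs) (x≤ ∷ xs≤) = ℕₚ.⊔-lub x≤ (foldr-⊔-upper xs xs≤)

∈⇒≤foldr-⊔ : ∀ {x} xs → x ∈ xs → x ≤ foldr ℕ._⊔_ 0 xs
∈⇒≤foldr-⊔ (y ∷ xs) (here refl) = ℕₚ.m≤m⊔n y _
∈⇒≤foldr-⊔ (y ∷ xs) (there x∈)  = ℕₚ.≤-trans (∈⇒≤foldr-⊔ xs x∈) (ℕₚ.m≤n⊔m y _)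

-- Five solutions from one point of the conic.

module LowerBound {q : ℕ} (K : FiniteField q) (k : ℕ) (q≡4k+3 : q ≡ suc (suc (k ℕ.+ k) ℕ.+ suc (k ℕ.+ k)))
  (u : FiniteField.F K) (u≢0 : u ≢ FiniteField.0# K) where
  open FieldFacts K hiding (_^_)
  open QuadraticCharacter K k q≡4k+3
  open Differences K k q≡4k+3 u
  open Solver

  c≢0 : c ≢ 0#
  c≢0 = x+x≢0 u≢0

  ratio : ∀ {γ x y} → γ ≢ 0# → γ * x ≡ y → η x ≡ η γ ℤ.* η y
  ratio {γ} {x} {y} γ≢0 e = sym (begin
    η γ ℤ.* η y            ≡⟨ cong (λ z → η γ ℤ.* η z) e ⟨
    η γ ℤ.* η (γ * x)      ≡⟨ η-* γ (γ * x) ⟨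
    η (γ * (γ * x))        ≡⟨ cong η (*-assoc γ γ x) ⟨
    η (γ * γ * x)          ≡⟨ η-* (γ * γ) x ⟩
    η (γ * γ) ℤ.* η x      ≡⟨ cong (ℤ._* η x) (η-square γ≢0) ⟩
    1ℤ ℤ.* η x             ≡⟨ ℤₚ.*-identityˡ (η x) ⟩
    η x                    ∎)
    where open ≡-Reasoning

  divide : ∀ {γ} → γ ≢ 0# → ∀ y → ∃ λ x → γ * x ≡ y
  divide {γ} γ≢0 y = y * γ⁻¹ , trans (solve 3 (λ γ y i → γ :* (y :* i) := y :* (γ :* i)) refl γ y γ⁻¹)
    (trans (cong (y *_) (proj₂ (inverse γ γ≢0))) (*-identityʳ y))
    where
    γ⁻¹ : F
    γ⁻¹ = proj₁ (inverse γ γ≢0)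

  -- As α - β = c, multiplying the equation by c completes the square: (c x + α)² = c b + α β, and
  -- this is r².
  solution-A : ∀ {b r x} → c * x ≡ r - α → c * b ≡ r * r - α * β → α * ((x + 1#) * (x + 1#)) - β * (x * x) ≡ b
  solution-A {b} {r} {x} cx cb = *-cancelˡ (*-nonzero c≢0 c≢0) (begin
    c * c * (α * ((x + 1#) * (x + 1#)) - β * (x * x))
      ≡⟨ solve 2 (λ u x → (u :+ u) :* (u :+ u) :* ((con 1ℤ :+ u) :* ((x :+ con 1ℤ) :* (x :+ con 1ℤ)) :- (con 1ℤ :- u) :* (x :* x))
           := (con 1ℤ :+ u) :* (((u :+ u) :* x :+ (u :+ u)) :* ((u :+ u) :* x :+ (u :+ u))) :- (con 1ℤ :- u) :* (((u :+ u) :* x) :* ((u :+ u) :* x))) refl u x ⟩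
    α * ((c * x + c) * (c * x + c)) - β * ((c * x) * (c * x))
      ≡⟨ cong (λ z → α * ((z + c) * (z + c)) - β * (z * z)) cx ⟩
    α * ((r - α + c) * (r - α + c)) - β * ((r - α) * (r - α))
      ≡⟨ solve 2 (λ u r → (con 1ℤ :+ u) :* ((r :- (con 1ℤ :+ u) :+ (u :+ u)) :* (r :- (con 1ℤ :+ u) :+ (u :+ u))) :- (con 1ℤ :- u) :* ((r :- (con 1ℤ :+ u)) :* (r :- (con 1ℤ :+ u)))
           := (u :+ u) :* (r :* r :- (con 1ℤ :+ u) :* (con 1ℤ :- u))) refl u r ⟩
    c * (r * r - α * β)
      ≡⟨ cong (c *_) cb ⟨
    c * (c * b)
      ≡⟨ *-assoc c c b ⟨
    c * c * b ∎)
    where open ≡-Reasoning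

  -- Here multiplication by - c gives (c x - β)² = α β - c b. Together with the square in
  -- `solution-A` the two right-hand sides add up to 2 α β: this is the origin of the conic.
  solution-B : ∀ {b r x} → c * x ≡ r + β → c * b ≡ α * β - r * r → β * ((x + 1#) * (x + 1#)) - α * (x * x) ≡ b
  solution-B {b} {r} {x} cx cb = *-cancelˡ (*-nonzero c≢0 c≢0) (begin
    c * c * (β * ((x + 1#) * (x + 1#)) - α * (x * x))
      ≡⟨ solve 2 (λ u x → (u :+ u) :* (u :+ u) :* ((con 1ℤ :- u) :* ((x :+ con 1ℤ) :* (x :+ con 1ℤ)) :- (con 1ℤ :+ u) :* (x :* x))
           := (con 1ℤ :- u) :* (((u :+ u) :* x :+ (u :+ u)) :* ((u :+ u) :* x :+ (u :+ u))) :- (con 1ℤ :+ u) :* (((u :+ u) :* x) :* ((u :+ u) :* x))) refl u x ⟩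
    β * ((c * x + c) * (c * x + c)) - α * ((c * x) * (c * x))
      ≡⟨ cong (λ z → β * ((z + c) * (z + c)) - α * (z * z)) cx ⟩
    β * ((r + β + c) * (r + β + c)) - α * ((r + β) * (r + β))
      ≡⟨ solve 2 (λ u r → (con 1ℤ :- u) :* ((r :+ (con 1ℤ :- u) :+ (u :+ u)) :* (r :+ (con 1ℤ :- u) :+ (u :+ u))) :- (con 1ℤ :+ u) :* ((r :+ (con 1ℤ :- u)) :* (r :+ (con 1ℤ :- u)))
           := (u :+ u) :* ((con 1ℤ :+ u) :* (con 1ℤ :- u) :- r :* r)) refl u r ⟩
    c * (α * β - r * r)
      ≡⟨ cong (c *_) cb ⟨
    c * (c * b)
      ≡⟨ *-assoc c c b ⟨
    c * c * b ∎)
    where open ≡-Reasoning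

  solution-linear : ∀ {b γ x} → (γ + γ) * x ≡ b - γ → γ * ((x + 1#) * (x + 1#)) - γ * (x * x) ≡ b
  solution-linear {b} {γ} {x} e = trans
    (solve 2 (λ γ x → γ :* ((x :+ con 1ℤ) :* (x :+ con 1ℤ)) :- γ :* (x :* x) := (γ :+ γ) :* x :+ γ) refl γ x)
    (trans (cong (_+ γ) e) (solve 2 (λ b γ → (b :- γ) :+ γ := b) refl b γ))

  shift-c : ∀ {x y} → c * x ≡ y → c * (x + 1#) ≡ y + c
  shift-c {x} e = trans (solve 2 (λ c x → c :* (x :+ con 1ℤ) := c :* x :+ c) refl c x) (cong (_+ c) e)

  shift-linear : ∀ {b γ x} → (γ + γ) * x ≡ b - γ → (γ + γ) * (x + 1#) ≡ b + γ
  shift-linear {b} {γ} {x} e = trans (solve 2 (λ γ x → (γ :+ γ) :* (x :+ con 1ℤ) := (γ :+ γ) :* x :+ (γ :+ γ)) refl γ x)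
    (trans (cong (_+ (γ + γ)) e) (solve 2 (λ b γ → (b :- γ) :+ (γ :+ γ) := b :+ γ) refl b γ))

  module _ (b : F) where

    record SolutionOfType (s t : ℤ) : Set where
      field
        x   : F
        ηx  : η x ≡ s
        ηx′ : η (x + 1#) ≡ t
        eq  : f (x + 1#) - f x ≡ b
    open SolutionOfType

    differ : ∀ {s t s′ t′} (X : SolutionOfType s t) (Y : SolutionOfType s′ t′) → s ≢ s′ ⊎ t ≢ t′ → x X ≢ x Y
    differ X Y (inj₁ s≢) e = s≢ (trans (sym (ηx X)) (trans (cong η e) (ηx Y)))
    differ X Y (inj₂ t≢) e = t≢ (trans (sym (ηx′ X)) (trans (cong (λ z → η (z + 1#)) e) (ηx′ Y)))

    -- Solutions of different types differ by their characters; only the fifth shares its type with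
    -- another one and comes with a proof of distinctness.
    five-solutions : (X₁ : SolutionOfType 1ℤ 1ℤ) (X₂ : SolutionOfType -1ℤ -1ℤ)
      (X₃ : SolutionOfType -1ℤ 1ℤ) (X₄ : SolutionOfType 1ℤ -1ℤ) →
      (∃ λ (X₅ : SolutionOfType -1ℤ 1ℤ) → x X₃ ≢ x X₅) ⊎ (∃ λ (X₅ : SolutionOfType 1ℤ -1ℤ) → x X₄ ≢ x X₅) →
      5 ≤ δ f 1# b
    five-solutions X₁ X₂ X₃ X₄ fifth = unique-⊆⇒length≤ (x X₁ ∷ x X₂ ∷ x X₃ ∷ x X₄ ∷ x₅ fifth ∷ []) _ (unique fifth)
        (member (eq X₁) ∷ member (eq X₂) ∷ member (eq X₃) ∷ member (eq X₄) ∷ member (eq₅ fifth) ∷ [])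
      where
      Fifth : Set
      Fifth = (∃ λ (X₅ : SolutionOfType -1ℤ 1ℤ) → x X₃ ≢ x X₅) ⊎ (∃ λ (X₅ : SolutionOfType 1ℤ -1ℤ) → x X₄ ≢ x X₅)
      x₅ : Fifth → F
      x₅ (inj₁ (X₅ , _)) = x X₅
      x₅ (inj₂ (X₅ , _)) = x X₅
      eq₅ : ∀ X₅ → f (x₅ X₅ + 1#) - f (x₅ X₅) ≡ b
      eq₅ (inj₁ (X₅ , _)) = eq X₅
      eq₅ (inj₂ (X₅ , _)) = eq X₅
      member : ∀ {z} → f (z + 1#) - f z ≡ b → z ∈ filter (λ z → (f (z + 1#) - f z) ≟ b) elements
      member {z} e = ∈-filter⁺ (λ z → (f (z + 1#) - f z) ≟ b) (∈-elements z) e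
      unique : ∀ X₅ → Unique (x X₁ ∷ x X₂ ∷ x X₃ ∷ x X₄ ∷ x₅ X₅ ∷ [])
      unique (inj₁ (X₅ , ≢5)) =
          (differ X₁ X₂ (inj₁ λ ()) ∷ differ X₁ X₃ (inj₁ λ ()) ∷ differ X₁ X₄ (inj₂ λ ()) ∷ differ X₁ X₅ (inj₁ λ ()) ∷ [])
        ∷ (differ X₂ X₃ (inj₂ λ ()) ∷ differ X₂ X₄ (inj₁ λ ()) ∷ differ X₂ X₅ (inj₂ λ ()) ∷ [])
        ∷ (differ X₃ X₄ (inj₁ λ ()) ∷ ≢5 ∷ []) ∷ (differ X₄ X₅ (inj₁ λ ()) ∷ []) ∷ [] ∷ []
      unique (inj₂ (X₅ , ≢5)) =
          (differ X₁ X₂ (inj₁ λ ()) ∷ differ X₁ X₃ (inj₁ λ ()) ∷ differ X₁ X₄ (inj₂ λ ()) ∷ differ X₁ X₅ (inj₂ λ ()) ∷ [])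
        ∷ (differ X₂ X₃ (inj₂ λ ()) ∷ differ X₂ X₄ (inj₁ λ ()) ∷ differ X₂ X₅ (inj₁ λ ()) ∷ [])
        ∷ (differ X₃ X₄ (inj₁ λ ()) ∷ differ X₃ X₅ (inj₁ λ ()) ∷ []) ∷ (≢5 ∷ []) ∷ [] ∷ []

  module _ (α≢0 : α ≢ 0#) (β≢0 : β ≢ 0#) {d e s₁ s₂ s₃ s₄ s₅ s₆ s₇ s₈ : ℤ}
    (ηc : η c ≡ d) (η2α : η (α + α) ≡ e) (η2β : η (β + β) ≡ ℤ.- e)
    (attained : Attained (α * β + α * β) α β s₁ s₂ s₃ s₄ s₅ s₆ s₇ s₈) where

    private
      r r′ : F
      r = proj₁ attained
      r′ = proj₁ (proj₂ attained)

      conic : r * r + r′ * r′ ≡ α * β + α * β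
      conic = proj₁ (proj₂ (proj₂ attained))

      r≢0 : r ≢ 0#
      r≢0 = proj₁ (proj₂ (proj₂ (proj₂ attained)))

      r′≢0 : r′ ≢ 0#
      r′≢0 = proj₁ (proj₂ (proj₂ (proj₂ (proj₂ attained))))

      signs₁ : η (r - α) ≡ s₁ × η (r - (- α)) ≡ s₂ × η (r - β) ≡ s₃ × η (r - (- β)) ≡ s₄
      signs₁ = proj₁ (proj₂ (proj₂ (proj₂ (proj₂ (proj₂ attained)))))

      signs₂ : η (r′ - α) ≡ s₅ × η (r′ - (- α)) ≡ s₆ × η (r′ - β) ≡ s₇ × η (r′ - (- β)) ≡ s₈
      signs₂ = proj₂ (proj₂ (proj₂ (proj₂ (proj₂ (proj₂ attained)))))

      h₁ : η (r - α) ≡ s₁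
      h₁ = proj₁ signs₁
      h₂ : η (r - (- α)) ≡ s₂
      h₂ = proj₁ (proj₂ signs₁)
      h₃ : η (r - β) ≡ s₃
      h₃ = proj₁ (proj₂ (proj₂ signs₁))
      h₄ : η (r - (- β)) ≡ s₄
      h₄ = proj₂ (proj₂ (proj₂ signs₁))
      h₅ : η (r′ - α) ≡ s₅
      h₅ = proj₁ signs₂
      h₆ : η (r′ - (- α)) ≡ s₆
      h₆ = proj₁ (proj₂ signs₂)
      h₇ : η (r′ - β) ≡ s₇
      h₇ = proj₁ (proj₂ (proj₂ signs₂))
      h₈ : η (r′ - (- β)) ≡ s₈
      h₈ = proj₂ (proj₂ (proj₂ signs₂))

      b : F
      b = proj₁ (divide c≢0 (r * r - α * β))

      cb : c * b ≡ r * r - α * β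
      cb = proj₂ (divide c≢0 (r * r - α * β))

      cb′ : c * b ≡ α * β - r′ * r′
      cb′ = trans cb (trans (solve 3 (λ s t p → s :- p := (s :+ t) :- p :- t) refl (r * r) (r′ * r′) (α * β))
        (trans (cong (λ z → z - α * β - r′ * r′) conic) (solve 2 (λ p t → (p :+ p) :- p :- t := p :- t) refl (α * β) (r′ * r′))))

      by-c : ∀ {x y z s} → c * x ≡ y → y ≡ z → η z ≡ s → η x ≡ d ℤ.* s
      by-c cx≡y y≡z ηz = trans (ratio c≢0 (trans cx≡y y≡z)) (cong₂ ℤ._*_ ηc ηz)

      η-neg-of : ∀ {z s} → η z ≡ s → η (- z) ≡ ℤ.- s
      η-neg-of {z} ηz = trans (η-neg z) (cong ℤ.-_ ηz)

      η-product : ∀ {y z s t} → η y ≡ s → η z ≡ t → η (y * z) ≡ s ℤ.* t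
      η-product {y} {z} ηy ηz = trans (η-* y z) (cong₂ ℤ._*_ ηy ηz)

      -- c b = r² - α β and α β + c α = α² give c (b - α) = (r - α)(r + α). The next three
      -- identities are analogous, with β for α or with c b = α β - r′².
      ηb-α : η (b - α) ≡ d ℤ.* (s₁ ℤ.* s₂)
      ηb-α = by-c (trans (solve 3 (λ c b α → c :* (b :- α) := c :* b :- c :* α) refl c b α) (cong (_- c * α) cb))
        (solve 2 (λ u r → (r :* r :- (con 1ℤ :+ u) :* (con 1ℤ :- u)) :- (u :+ u) :* (con 1ℤ :+ u) := (r :- (con 1ℤ :+ u)) :* (r :- (:- (con 1ℤ :+ u)))) refl u r)
        (η-product h₁ h₂)

      ηb+β : η (b + β) ≡ d ℤ.* (s₃ ℤ.* s₄)
      ηb+β = by-c (trans (solve 3 (λ c b β → c :* (b :+ β) := c :* b :+ c :* β) refl c b β) (cong (_+ c * β) cb))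
        (solve 2 (λ u r → (r :* r :- (con 1ℤ :+ u) :* (con 1ℤ :- u)) :+ (u :+ u) :* (con 1ℤ :- u) := (r :- (con 1ℤ :- u)) :* (r :- (:- (con 1ℤ :- u)))) refl u r)
        (η-product h₃ h₄)

      ηb+α : η (b + α) ≡ d ℤ.* (ℤ.- (s₅ ℤ.* s₆))
      ηb+α = by-c (trans (solve 3 (λ c b α → c :* (b :+ α) := c :* b :+ c :* α) refl c b α) (cong (_+ c * α) cb′))
        (solve 2 (λ u r → ((con 1ℤ :+ u) :* (con 1ℤ :- u) :- r :* r) :+ (u :+ u) :* (con 1ℤ :+ u) := :- ((r :- (con 1ℤ :+ u)) :* (r :- (:- (con 1ℤ :+ u))))) refl u r′)
        (η-neg-of (η-product h₅ h₆))

      ηb-β : η (b - β) ≡ d ℤ.* (ℤ.- (s₇ ℤ.* s₈))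
      ηb-β = by-c (trans (solve 3 (λ c b β → c :* (b :- β) := c :* b :- c :* β) refl c b β) (cong (_- c * β) cb′))
        (solve 2 (λ u r → ((con 1ℤ :+ u) :* (con 1ℤ :- u) :- r :* r) :- (u :+ u) :* (con 1ℤ :- u) := :- ((r :- (con 1ℤ :- u)) :* (r :- (:- (con 1ℤ :- u))))) refl u r′)
        (η-neg-of (η-product h₇ h₈))

      Typed : ℤ → ℤ → Set
      Typed = SolutionOfType b

      X₁ : e ℤ.* (d ℤ.* (s₁ ℤ.* s₂)) ≡ 1ℤ → e ℤ.* (d ℤ.* (ℤ.- (s₅ ℤ.* s₆))) ≡ 1ℤ → Typed 1ℤ 1ℤ
      X₁ e₁ e₂ = record { x = x ; ηx = ηx ; ηx′ = ηx′ ; eq = trans (cong₂ _-_ (f-square ηx′) (f-square ηx)) (solution-linear ex) }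
        where
        2α≢0 : α + α ≢ 0#
        2α≢0 = x+x≢0 α≢0
        x : F
        x = proj₁ (divide 2α≢0 (b - α))
        ex : (α + α) * x ≡ b - α
        ex = proj₂ (divide 2α≢0 (b - α))
        ηx : η x ≡ 1ℤ
        ηx = trans (ratio 2α≢0 ex) (trans (cong₂ ℤ._*_ η2α ηb-α) e₁)
        ηx′ : η (x + 1#) ≡ 1ℤ
        ηx′ = trans (ratio 2α≢0 (shift-linear ex)) (trans (cong₂ ℤ._*_ η2α ηb+α) e₂)

      X₂ : (ℤ.- e) ℤ.* (d ℤ.* (ℤ.- (s₇ ℤ.* s₈))) ≡ -1ℤ → (ℤ.- e) ℤ.* (d ℤ.* (s₃ ℤ.* s₄)) ≡ -1ℤ → Typed -1ℤ -1ℤ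
      X₂ e₁ e₂ = record { x = x ; ηx = ηx ; ηx′ = ηx′ ; eq = trans (cong₂ _-_ (f-nonsquare ηx′) (f-nonsquare ηx)) (solution-linear ex) }
        where
        2β≢0 : β + β ≢ 0#
        2β≢0 = x+x≢0 β≢0
        x : F
        x = proj₁ (divide 2β≢0 (b - β))
        ex : (β + β) * x ≡ b - β
        ex = proj₂ (divide 2β≢0 (b - β))
        ηx : η x ≡ -1ℤ
        ηx = trans (ratio 2β≢0 ex) (trans (cong₂ ℤ._*_ η2β ηb-β) e₁)
        ηx′ : η (x + 1#) ≡ -1ℤ
        ηx′ = trans (ratio 2β≢0 (shift-linear ex)) (trans (cong₂ ℤ._*_ η2β ηb+β) e₂)

      -- The quadratic solutions are (r − α)/c and −(r + α)/c of type (−1, 1), and (r′ + β)/c and −(r′ − β)/c of type (1, −1).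
      root-A : ∀ t {s s′} → c * b ≡ t * t - α * β → η (t - α) ≡ s → η (t - β) ≡ s′ → d ℤ.* s ≡ -1ℤ → d ℤ.* s′ ≡ 1ℤ → Typed -1ℤ 1ℤ
      root-A t cb hs hs′ e₁ e₂ = record { x = x ; ηx = ηx ; ηx′ = ηx′ ; eq = trans (cong₂ _-_ (f-square ηx′) (f-nonsquare ηx)) (solution-A {r = t} ex cb) }
        where
        x : F
        x = proj₁ (divide c≢0 (t - α))
        ex : c * x ≡ t - α
        ex = proj₂ (divide c≢0 (t - α))
        ηx : η x ≡ -1ℤ
        ηx = trans (by-c ex refl hs) e₁
        ηx′ : η (x + 1#) ≡ 1ℤ
        ηx′ = trans (by-c (shift-c ex) (solve 2 (λ t u → t :- (con 1ℤ :+ u) :+ (u :+ u) := t :- (con 1ℤ :- u)) refl t u) hs′) e₂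

      root-B : ∀ t {s s′} → c * b ≡ α * β - t * t → η (t + β) ≡ s → η (t + α) ≡ s′ → d ℤ.* s ≡ 1ℤ → d ℤ.* s′ ≡ -1ℤ → Typed 1ℤ -1ℤ
      root-B t cb hs hs′ e₁ e₂ = record { x = x ; ηx = ηx ; ηx′ = ηx′ ; eq = trans (cong₂ _-_ (f-nonsquare ηx′) (f-square ηx)) (solution-B {r = t} ex cb) }
        where
        x : F
        x = proj₁ (divide c≢0 (t + β))
        ex : c * x ≡ t + β
        ex = proj₂ (divide c≢0 (t + β))
        ηx : η x ≡ 1ℤ
        ηx = trans (by-c ex refl hs) e₁
        ηx′ : η (x + 1#) ≡ -1ℤ
        ηx′ = trans (by-c (shift-c ex) (solve 2 (λ t u → t :+ (con 1ℤ :- u) :+ (u :+ u) := t :+ (con 1ℤ :+ u)) refl t u) hs′) e₂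

      plus : ∀ {z κ s} → η (z - (- κ)) ≡ s → η (z + κ) ≡ s
      plus {z} {κ} = trans (cong (λ y → η (z + y)) (sym (-‿involutive κ)))

      negate : ∀ {z κ s} → η (z - κ) ≡ s → η (- z + κ) ≡ ℤ.- s
      negate {z} {κ} hs = trans (cong η (solve 2 (λ z κ → (:- z) :+ κ := :- (z :- κ)) refl z κ)) (η-neg-of hs)

      negate′ : ∀ {z κ s} → η (z - (- κ)) ≡ s → η (- z - κ) ≡ ℤ.- s
      negate′ {z} {κ} hs = trans (cong η (solve 2 (λ z κ → (:- z) :- κ := :- (z :- (:- κ))) refl z κ)) (η-neg-of hs)

      neg-square : ∀ z → - z * - z ≡ z * z
      neg-square z = solve 1 (λ z → (:- z) :* (:- z) := z :* z) refl z

      X₃ : d ℤ.* s₁ ≡ -1ℤ → d ℤ.* s₃ ≡ 1ℤ → Typed -1ℤ 1ℤ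
      X₃ = root-A r cb h₁ h₃

      X₄ : d ℤ.* s₈ ≡ 1ℤ → d ℤ.* s₆ ≡ -1ℤ → Typed 1ℤ -1ℤ
      X₄ = root-B r′ cb′ (plus h₈) (plus h₆)

      X₅-A : d ℤ.* (ℤ.- s₂) ≡ -1ℤ → d ℤ.* (ℤ.- s₄) ≡ 1ℤ → Typed -1ℤ 1ℤ
      X₅-A = root-A (- r) (trans cb (cong (_- α * β) (sym (neg-square r)))) (negate′ h₂) (negate′ h₄)

      X₅-B : d ℤ.* (ℤ.- s₇) ≡ 1ℤ → d ℤ.* (ℤ.- s₅) ≡ -1ℤ → Typed 1ℤ -1ℤ
      X₅-B = root-B (- r′) (trans cb′ (cong (λ z → α * β - z) (sym (neg-square r′)))) (negate h₇) (negate h₅)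

      z≢-z : ∀ {z γ} → z ≢ 0# → z + γ ≢ - z + γ
      z≢-z {z} {γ} z≢0 e = x+x≢0 z≢0 (trans (solve 2 (λ z γ → z :+ z := (z :+ γ) :- ((:- z) :+ γ)) refl z γ) (x≡y⇒x-y≡0 e))

      quotients-differ : ∀ {y z} → y ≢ z → proj₁ (divide c≢0 y) ≢ proj₁ (divide c≢0 z)
      quotients-differ {y} {z} y≢z e = y≢z (trans (sym (proj₂ (divide c≢0 y))) (trans (cong (c *_) e) (proj₂ (divide c≢0 z))))

    -- The hypotheses say that the solutions have their intended types. They are relations between
    -- signs, so for concrete signs each one is settled by computation.
    lower : e ℤ.* (d ℤ.* (s₁ ℤ.* s₂)) ≡ 1ℤ → e ℤ.* (d ℤ.* (ℤ.- (s₅ ℤ.* s₆))) ≡ 1ℤ →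
      (ℤ.- e) ℤ.* (d ℤ.* (ℤ.- (s₇ ℤ.* s₈))) ≡ -1ℤ → (ℤ.- e) ℤ.* (d ℤ.* (s₃ ℤ.* s₄)) ≡ -1ℤ →
      d ℤ.* s₁ ≡ -1ℤ → d ℤ.* s₃ ≡ 1ℤ → d ℤ.* s₈ ≡ 1ℤ → d ℤ.* s₆ ≡ -1ℤ →
      (d ℤ.* (ℤ.- s₂) ≡ -1ℤ × d ℤ.* (ℤ.- s₄) ≡ 1ℤ) ⊎ (d ℤ.* (ℤ.- s₇) ≡ 1ℤ × d ℤ.* (ℤ.- s₅) ≡ -1ℤ) →
      ∃ λ b → 5 ≤ δ f 1# b
    lower p₁ p₂ p₃ p₄ p₅ p₆ p₇ p₈ fifth = b , five-solutions b (X₁ p₁ p₂) (X₂ p₃ p₄) (X₃ p₅ p₆) (X₄ p₇ p₈) (X₅ fifth)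
      where
      X₅ : (d ℤ.* (ℤ.- s₂) ≡ -1ℤ × d ℤ.* (ℤ.- s₄) ≡ 1ℤ) ⊎ (d ℤ.* (ℤ.- s₇) ≡ 1ℤ × d ℤ.* (ℤ.- s₅) ≡ -1ℤ) →
        (∃ λ (X₅ : Typed -1ℤ 1ℤ) → SolutionOfType.x (X₃ p₅ p₆) ≢ SolutionOfType.x X₅) ⊎
        (∃ λ (X₅ : Typed 1ℤ -1ℤ) → SolutionOfType.x (X₄ p₇ p₈) ≢ SolutionOfType.x X₅)
      X₅ (inj₁ (e₁ , e₂)) = inj₁ (X₅-A e₁ e₂ , quotients-differ (z≢-z r≢0))
      X₅ (inj₂ (e₁ , e₂)) = inj₂ (X₅-B e₁ e₂ , quotients-differ (z≢-z r′≢0))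

-- Putting the two bounds together.

module Assembly {q : ℕ} (K : FiniteField q) (k : ℕ) (q≡4k+3 : q ≡ suc (suc (k ℕ.+ k) ℕ.+ suc (k ℕ.+ k)))
  {p n : ℕ} (pr : Prime p) (q≡pⁿ : q ≡ p ℕ.^ n)
  (R w j : ℕ) (R+15≡2k : R ℕ.+ 15 ≡ k ℕ.+ k) (2w≤q : w ℕ.+ w ≤ q)
  (w-small : w ℕ.* suc (j ℕ.+ 63 ℕ.* w) < j ℕ.* R)
  (w-large : w ℕ.* (20 ℕ.* 256) ℕ.+ 256 ℕ.* (w ℕ.* 32 ℕ.+ (17 ℕ.+ j) ℕ.* q) < w ℕ.* q) (20<q : 20 < q)
  (u : FiniteField.F K) (u∉U : ¬ FiniteField.InU K p u)
  (ηα≡η[u-1] : FiniteField.η K (FiniteField._+_ K (FiniteField.1# K) u) ≡ FiniteField.η K (FiniteField._-_ K u (FiniteField.1# K))) where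
  open FieldFacts K hiding (_^_)
  open QuadraticCharacter K k q≡4k+3
  open SignsOnConic K k q≡4k+3 {n = n} pr q≡pⁿ R w j R+15≡2k 2w≤q w-small w-large
  open Differences K k q≡4k+3 u
  open Solver

  private
    u≢0 : u ≢ 0#
    u≢0 = proj₁ (∉U p u u∉U)

    α≢0 : α ≢ 0#
    α≢0 e = proj₁ (proj₂ (proj₂ (∉U p u u∉U))) (x-y≡0⇒x≡y (trans (solve 1 (λ u → u :- (:- con 1ℤ) := con 1ℤ :+ u) refl u) e))

    β≢0 : β ≢ 0#
    β≢0 e = proj₁ (proj₂ (∉U p u u∉U)) (sym (x-y≡0⇒x≡y e))

    -- In characteristic 3 this holds because 3 u = 0; otherwise it is the exclusion of ±1/3.
    3u≢±1 : 3# * u ≢ 1# × 3# * u ≢ - 1#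
    3u≢±1 = by-characteristic (p ℕ.≟ 3)
      where
      3≡0 : ∀ {m} → m ≡ 3 → q ≡ m ℕ.^ n → 3# ≡ 0#
      3≡0 refl q≡ = trans (solve 0 (con 1ℤ :+ con 1ℤ :+ con 1ℤ := con 1ℤ :+ (con 1ℤ :+ (con 1ℤ :+ con 0ℤ))) refl) (p×1≡0 n q≡)
      by-characteristic : Dec (p ≡ 3) → 3# * u ≢ 1# × 3# * u ≢ - 1#
      by-characteristic (no p≢3)  = proj₂ (proj₂ (proj₂ (∉U p u u∉U))) p≢3
      by-characteristic (yes p≡3) = (λ e → 0≢1 (trans (sym 3u≡0) e)) , (λ e → -‿nonzero (0≢1 ∘ sym) (trans (sym e) 3u≡0))
        where
        3u≡0 : 3# * u ≡ 0#
        3u≡0 = trans (cong (_* u) (3≡0 p≡3 q≡pⁿ)) (zeroˡ u)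

    c≢0 : c ≢ 0#
    c≢0 = x+x≢0 u≢0

    D : F
    D = α * β + α * β

    one : ∀ {n} → Polynomial n
    one = con 1ℤ

    -- With α - β = 2 u and α + β = 2, the last five quantities are α (1 - 3 u), β (1 + 3 u), - 4 u
    -- α, - 4 u² and 4 u β. This is where the excluded values of u come from.
    constants : Constants D α β
    constants = record
      { D≢0    = x+x≢0 (*-nonzero α≢0 β≢0)
      ; α≢0    = α≢0
      ; β≢0    = β≢0
      ; α≢β    = λ e → c≢0 (trans (solve 1 (λ u → u :+ u := (one :+ u) :- (one :- u)) refl u) e)
      ; α≢-β   = λ e → 2≢0 (trans (solve 1 (λ u → one :+ one := (one :+ u) :+ (one :- u)) refl u) e)
      ; D≢αα   = λ e → *-nonzero α≢0 (λ z → proj₁ 3u≢±1 (sym (x-y≡0⇒x≡y z))) (trans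
          (solve 1 (λ u → (one :+ u) :* (one :- (one :+ one :+ one) :* u) := (one :+ u) :* (one :- u) :+ (one :+ u) :* (one :- u) :- (one :+ u) :* (one :+ u)) refl u) e)
      ; D≢ββ   = λ e → *-nonzero β≢0 (λ z → proj₂ 3u≢±1 (x-y≡0⇒x≡y z)) (trans
          (solve 1 (λ u → (one :- u) :* ((one :+ one :+ one) :* u :- (:- one)) := (one :+ u) :* (one :- u) :+ (one :+ u) :* (one :- u) :- (one :- u) :* (one :- u)) refl u) e)
      ; D≢αααα = λ e → *-nonzero α≢0 (-‿nonzero (x+x≢0 c≢0)) (trans
          (solve 1 (λ u → (one :+ u) :* (:- ((u :+ u) :+ (u :+ u))) := (one :+ u) :* (one :- u) :+ (one :+ u) :* (one :- u) :- (one :+ u) :* (one :+ u) :- (one :+ u) :* (one :+ u)) refl u) e)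
      ; D≢ααββ = λ e → -‿nonzero (*-nonzero c≢0 c≢0) (trans
          (solve 1 (λ u → :- ((u :+ u) :* (u :+ u)) := (one :+ u) :* (one :- u) :+ (one :+ u) :* (one :- u) :- (one :+ u) :* (one :+ u) :- (one :- u) :* (one :- u)) refl u) e)
      ; D≢ββββ = λ e → *-nonzero β≢0 (x+x≢0 c≢0) (trans
          (solve 1 (λ u → (one :- u) :* ((u :+ u) :+ (u :+ u)) := (one :+ u) :* (one :- u) :+ (one :+ u) :* (one :- u) :- (one :- u) :* (one :- u) :- (one :- u) :* (one :- u)) refl u) e)
      }

    -- 2 β = - 2 (u - 1), and -1 is a nonsquare; the hypothesis η(1 + u) = η(u - 1) then makes the
    -- characters of 2 α and 2 β opposite.
    η2β : η (β + β) ≡ ℤ.- η (α + α)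
    η2β = begin
      η (β + β) ≡⟨ cong η (solve 1 (λ u → (one :- u) :+ (one :- u) := :- ((one :+ one) :* (u :- one))) refl u) ⟩
      η (- (2# * (u - 1#)))      ≡⟨ η-neg (2# * (u - 1#)) ⟩
      ℤ.- η (2# * (u - 1#))      ≡⟨ cong ℤ.-_ (η-* 2# (u - 1#)) ⟩
      ℤ.- (η 2# ℤ.* η (u - 1#))  ≡⟨ cong (λ s → ℤ.- (η 2# ℤ.* s)) ηα≡η[u-1] ⟨
      ℤ.- (η 2# ℤ.* η α)         ≡⟨ cong ℤ.-_ (η-* 2# α) ⟨
      ℤ.- η (2# * α) ≡⟨ cong (ℤ.-_ ∘ η) (solve 1 (λ u → (one :+ one) :* (one :+ u) := (one :+ u) :+ (one :+ u)) refl u) ⟩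
      ℤ.- η (α + α)              ∎
      where open ≡-Reasoning

    module L = LowerBound K k q≡4k+3 u u≢0

    -- The fifth solution is the second root of type (1, −1) if η(2u) = η(2(1 + u)), and of type (−1, 1) otherwise.
    lower-bound : IsSign (η c) → IsSign (η (α + α)) → ∃ λ b → 5 ≤ δ f 1# b
    -- With d = η(c) and e = η(2 α), the first four solutions force the signs (-d, -e, d, e, e, -d,
    -- -e, d). The fifth then needs d e = 1 for type (1, -1), or d e = -1 for type (-1, 1), so one
    -- of the two is always available.
    lower-bound (inj₁ ηc) (inj₁ η2α) = L.lower α≢0 β≢0 ηc η2α (trans η2β (cong ℤ.-_ η2α))
      (signs-attained constants -1ℤ -1ℤ 1ℤ 1ℤ 1ℤ -1ℤ -1ℤ 1ℤ (inj₂ refl ∷ inj₂ refl ∷ inj₁ refl ∷ inj₁ refl ∷ inj₁ refl ∷ inj₂ refl ∷ inj₂ refl ∷ inj₁ refl ∷ []) 20<q)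
      refl refl refl refl refl refl refl refl (inj₂ (refl , refl))
    lower-bound (inj₂ ηc) (inj₂ η2α) = L.lower α≢0 β≢0 ηc η2α (trans η2β (cong ℤ.-_ η2α))
      (signs-attained constants 1ℤ 1ℤ -1ℤ -1ℤ -1ℤ 1ℤ 1ℤ -1ℤ (inj₁ refl ∷ inj₁ refl ∷ inj₂ refl ∷ inj₂ refl ∷ inj₂ refl ∷ inj₁ refl ∷ inj₁ refl ∷ inj₂ refl ∷ []) 20<q)
      refl refl refl refl refl refl refl refl (inj₂ (refl , refl))
    lower-bound (inj₁ ηc) (inj₂ η2α) = L.lower α≢0 β≢0 ηc η2α (trans η2β (cong ℤ.-_ η2α))
      (signs-attained constants -1ℤ 1ℤ 1ℤ -1ℤ -1ℤ -1ℤ 1ℤ 1ℤ (inj₂ refl ∷ inj₁ refl ∷ inj₁ refl ∷ inj₂ refl ∷ inj₂ refl ∷ inj₂ refl ∷ inj₁ refl ∷ inj₁ refl ∷ []) 20<q)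
      refl refl refl refl refl refl refl refl (inj₁ (refl , refl))
    lower-bound (inj₂ ηc) (inj₁ η2α) = L.lower α≢0 β≢0 ηc η2α (trans η2β (cong ℤ.-_ η2α))
      (signs-attained constants 1ℤ -1ℤ -1ℤ 1ℤ 1ℤ 1ℤ -1ℤ -1ℤ (inj₁ refl ∷ inj₂ refl ∷ inj₂ refl ∷ inj₁ refl ∷ inj₁ refl ∷ inj₁ refl ∷ inj₂ refl ∷ inj₂ refl ∷ []) 20<q)
      refl refl refl refl refl refl refl refl (inj₁ (refl , refl))

  uniformity : diffUniformity (F₂ u) ≡ 5
  uniformity = ℕₚ.≤-antisym
    (foldr-⊔-upper (concatMap (λ a → map (δ f a) elements) nonzeroElements)
      (Allₚ.concat⁺ (Allₚ.map⁺ (All.map (λ {a} a≢0 → Allₚ.map⁺ (All.universal (Upper.δ≤5 u≢0 α≢0 β≢0 a a≢0) elements))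
        (Allₚ.all-filter (λ x → ¬? (x ≟ 0#)) elements)))))
    (attain (lower-bound (η-sign c≢0) (η-sign (x+x≢0 α≢0))))
    where
    attain : (∃ λ b → 5 ≤ δ f 1# b) → 5 ≤ diffUniformity (F₂ u)
    attain (b , 5≤δ) = ℕₚ.≤-trans 5≤δ (∈⇒≤foldr-⊔ (concatMap (λ a → map (δ f a) elements) nonzeroElements)
      (∈-concatMap⁺ (λ a → map (δ f a) elements) (lose (∈-filter⁺ (λ x → ¬? (x ≟ 0#)) (∈-elements 1#) (0≢1 ∘ sym)) (∈-map⁺ (δ f 1#) (∈-elements b)))))

-- Once w = c t + e, the term c t q cancels, and only the surplus e q has to exceed the terms
-- without q.
large-parameter : ∀ w m c n t e q → w ≡ c ℕ.* t ℕ.+ e → w ℕ.* m ℕ.+ c ℕ.* (w ℕ.* n) < e ℕ.* q →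
  w ℕ.* m ℕ.+ c ℕ.* (w ℕ.* n ℕ.+ t ℕ.* q) < w ℕ.* q
large-parameter w m c n t e q w≡ small = begin-strict
  w ℕ.* m ℕ.+ c ℕ.* (w ℕ.* n ℕ.+ t ℕ.* q) ≡⟨ solve 5 (λ x c y t q → x :+ c :* (y :+ t :* q) := c :* t :* q :+ (x :+ c :* y)) refl (w ℕ.* m) c (w ℕ.* n) t q ⟩
  c ℕ.* t ℕ.* q ℕ.+ (w ℕ.* m ℕ.+ c ℕ.* (w ℕ.* n))      <⟨ ℕₚ.+-monoʳ-< (c ℕ.* t ℕ.* q) small ⟩
  c ℕ.* t ℕ.* q ℕ.+ e ℕ.* q                            ≡⟨ ℕₚ.*-distribʳ-+ q (c ℕ.* t) e ⟨
  (c ℕ.* t ℕ.+ e) ℕ.* q                                ≡⟨ cong (ℕ._* q) w≡ ⟨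
  w ℕ.* q                                              ∎
  where
  open ℕₚ.≤-Reasoning
  open Data.Nat.Solver.+-*-Solver

open import Data.Nat using (_^_; _%_; _≥_)

theorem3 : (p n q : ℕ) → Prime p → p ≢ 2 → n ≥ 1 → q ≡ p ^ n → q % 4 ≡ 3 → q ≥ 27535 ^ 2 →
    (K : FiniteField q) → let open FiniteField K in
    (u : F) → ¬ InU p u → η (1# + u) ≡ η (u - 1#) →
    diffUniformity (F₂ u) ≡ 5
theorem3 p n q pr _ _ q≡pⁿ q%4≡3 q≥ K u u∉U ηα≡ =
  -- w = 10000 and j = 17. `w-large` asks for w > 256 (17 + j) and `w-small` roughly for j q/2 > 63
  -- w², so q has to exceed about 126 · 256² (17 + j)²/j, which is least at j = 17. Then 256 · 34 =
  -- 8704, while q ≥ 27535² permits w up to about 10100; the choice 10000 leaves the surplus 1296.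
  Assembly.uniformity K k q≡4k+3 {n = n} pr q≡pⁿ R 10000 17 R+15≡2k (ℕₚ.≤-trans (ℕₚ.≤ᵇ⇒≤ 20000 (27535 ^ 2) tt) q≥)
    (ℕₚ.<-≤-trans (ℕₚ.<ᵇ⇒< (10000 ℕ.* suc (17 ℕ.+ 63 ℕ.* 10000)) (17 ℕ.* 379088097) tt) (ℕₚ.*-monoʳ-≤ 17 R-large))
    (large-parameter 10000 (20 ℕ.* 256) 256 32 (17 ℕ.+ 17) 1296 q refl
      (ℕₚ.<-≤-trans (ℕₚ.<ᵇ⇒< (10000 ℕ.* (20 ℕ.* 256) ℕ.+ 256 ℕ.* (10000 ℕ.* 32)) (1296 ℕ.* 27535 ^ 2) tt) (ℕₚ.*-monoʳ-≤ 1296 q≥)))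
    (ℕₚ.≤-trans (ℕₚ.≤ᵇ⇒≤ 21 (27535 ^ 2) tt) q≥) u u∉U ηα≡
  where
  k R : ℕ
  k = q ℕ./ 4
  R = k ℕ.+ k ℕ.∸ 15
  q≡4k+3 : q ≡ suc (suc (k ℕ.+ k) ℕ.+ suc (k ℕ.+ k))
  q≡4k+3 = trans (m≡m%n+[m/n]*n q 4) (trans (cong (ℕ._+ k ℕ.* 4) q%4≡3)
    (solve 1 (λ k → con 3 :+ k :* con 4 := con 1 :+ ((con 1 :+ (k :+ k)) :+ (con 1 :+ (k :+ k)))) refl k))
    where open Data.Nat.Solver.+-*-Solver
  -- 189544056 is the integer part of 27535²/4, and twice this number minus 15 is the bound for R
  -- below.
  k-large : 189544056 ≤ k
  k-large = /-monoˡ-≤ 4 q≥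
  R-large : 379088097 ≤ R
  R-large = ℕₚ.∸-monoˡ-≤ {189544056 ℕ.+ 189544056} {k ℕ.+ k} 15 (ℕₚ.+-mono-≤ {189544056} {k} {189544056} {k} k-large k-large)
  R+15≡2k : R ℕ.+ 15 ≡ k ℕ.+ k
  R+15≡2k = ℕₚ.m∸n+n≡m (ℕₚ.≤-trans (ℕₚ.≤ᵇ⇒≤ 15 189544056 tt) (ℕₚ.≤-trans k-large (ℕₚ.m≤m+n k k)))
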